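{- For all integers $\ell\geq 4$, $t\geq 3$, and all $q,q_1,q_2\geq 1$ with $q_1+q_2=q$, we have \[ s_{q_2}(K_t)+q_1\leq s_q(\mathcal{T}(q_1,q_2,\ell,t))\leq s_q(K_t). \]
   Context: All graphs are finite and simple. For graphs $H_1,\dots,H_q$, a graph $G$ is $q$-Ramsey for $(H_1,\dots,H_q)$ if every coloring of the edges of $G$ with colors $1,\dots,q$ contains, for some $i\in[q]$, a copy of $H_i$ all of whose edges have color $i$. $G$ is $q$-Ramsey-minimal for the tuple if it is $q$-Ramsey for it but no proper subgraph of $G$ is. $s_q(H_1,\dots,H_q)$ is the minimum of the minimum degree $\delta(G)$ over all $q$-Ramsey-minimal graphs $G$ for $(H_1,\dots,H_q)$; $s_q(H)$ abbreviates $s_q(H,\dots,H)$ ($q$ copies). $\mathcal{T}(q_1,q_2,\ell,t)$ denotes the $(q_1+q_2)$-tuple $(C_\ell,\dots,C_\ell,K_t,\dots,K_t)$ consisting of $q_1$ copies of the cycle $C_\ell$ on $\ell$ vertices followed by $q_2$ copies of the complete graph $K_t$. -}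

module Defs where

open import Data.Nat using (ℕ; zero; suc; _+_; _≤_; _≡ᵇ_)
open import Data.Bool using (Bool; true; false; _∧_; _∨_; not; if_then_else_)
open import Data.Bool.Properties using (∨-comm)
open import Data.Fin using (Fin; toℕ; splitAt; _≟_)
open import Data.List using (List; map)
open import Data.Nat.ListAction using (sum)
open import Data.Fin.Base using () 
open import Data.List using (allFin)
open import Data.Sum using ([_,_]′)
open import Data.Product using (Σ; ∃; _×_; _,_)
open import Data.Empty using (⊥)
open import Relation.Nullary using (¬_; Dec; yes; no)
open import Relation.Nullary.Decidable using (⌊_⌋)
open import Relation.Binary.PropositionalEquality using (_≡_; refl; cong; cong₂; sym)
open import Function.Definitions using (Injective; Surjective)

record Graph : Set where
  field
    n     : ℕ
    adj   : Fin n → Fin n → Bool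
    adj-sym   : ∀ u v → adj u v ≡ adj v u
    adj-irref : ∀ v → adj v v ≡ false
open Graph public

private
  eqb : ∀ {n} → Fin n → Fin n → Bool
  eqb u v = ⌊ u ≟ v ⌋

  eqb-sym : ∀ {n} (u v : Fin n) → eqb u v ≡ eqb v u
  eqb-sym u v with u ≟ v | v ≟ u
  ... | yes _ | yes _ = refl
  ... | no _  | no _  = refl
  ... | yes p | no ¬q with ¬q (sym p)
  ... | ()
  eqb-sym u v | no ¬p | yes q with ¬p (sym q)
  ... | ()

  eqb-refl : ∀ {n} (u : Fin n) → eqb u u ≡ true
  eqb-refl u with u ≟ u
  ... | yes _ = refl
  ... | no ¬p with ¬p refl
  ... | ()

  ∧-false : ∀ b → (b ∧ false) ≡ false
  ∧-false false = refl
  ∧-false true = refl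

simpleGraph : (m : ℕ) → (Fin m → Fin m → Bool) → Graph
simpleGraph m r = record
  { n = m
  ; adj = λ u v → (r u v ∨ r v u) ∧ not (eqb u v)
  ; adj-sym = λ u v → cong₂ (λ a b → a ∧ not b) (∨-comm (r u v) (r v u)) (eqb-sym u v)
  ; adj-irref = λ v → helper v
  }
  where
  helper : ∀ v → ((r v v ∨ r v v) ∧ not (eqb v v)) ≡ false
  helper v rewrite eqb-refl v = ∧-false (r v v ∨ r v v)

K : ℕ → Graph
K t = simpleGraph t (λ _ _ → true)

-- Cycle C_ℓ on vertices 0,…,ℓ-1 with edges {i,i+1} and {ℓ-1,0}
-- (a genuine cycle for ℓ ≥ 3).
C : ℕ → Graph
C ℓ = simpleGraph ℓ (λ i j → (toℕ j ≡ᵇ suc (toℕ i)) ∨ ((suc (toℕ i) ≡ᵇ ℓ) ∧ (toℕ j ≡ᵇ 0)))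

deg : (G : Graph) → Fin (n G) → ℕ
deg G v = sum (map (λ u → if adj G v u then 1 else 0) (allFin (n G)))

MinDeg : Graph → ℕ → Set
MinDeg G d = (∃ λ v → deg G v ≡ d) × (∀ v → d ≤ deg G v)

-- Edge colourings of G with q colours (symmetric colour function on pairs;
-- only values on edges matter).
record Colouring (G : Graph) (q : ℕ) : Set where
  field
    col     : Fin (n G) → Fin (n G) → Fin q
    col-sym : ∀ u v → col u v ≡ col v u
open Colouring public

MonoCopy : (H G : Graph) {q : ℕ} → Colouring G q → Fin q → Set
MonoCopy H G c i = Σ (Fin (n H) → Fin (n G)) λ f →
  Injective _≡_ _≡_ f ×
  (∀ x y → adj H x y ≡ true → (adj G (f x) (f y) ≡ true) × (col c (f x) (f y) ≡ i))

IsRamsey : (q : ℕ) → (Fin q → Graph) → Graph → Set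
IsRamsey q Hs G = (c : Colouring G q) → ∃ λ i → MonoCopy (Hs i) G c i

ProperSubgraph : Graph → Graph → Set
ProperSubgraph H G = Σ (Fin (n H) → Fin (n G)) λ f →
  Injective _≡_ _≡_ f ×
  (∀ x y → adj H x y ≡ true → adj G (f x) (f y) ≡ true) ×
  ( (¬ Surjective _≡_ _≡_ f)
  ⊎' (∃ λ u → ∃ λ v → (adj G u v ≡ true) ×
        ¬ (∃ λ x → ∃ λ y → (f x ≡ u) × (f y ≡ v) × (adj H x y ≡ true))))
  where
  open import Data.Sum using () renaming (_⊎_ to _⊎'_)

IsRamseyMinimal : (q : ℕ) → (Fin q → Graph) → Graph → Set
IsRamseyMinimal q Hs G = IsRamsey q Hs G × (∀ H → ProperSubgraph H G → ¬ IsRamsey q Hs H)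

IsS : (q : ℕ) → (Fin q → Graph) → ℕ → Set
IsS q Hs k = (∃ λ G → IsRamseyMinimal q Hs G × MinDeg G k)
           × (∀ G d → IsRamseyMinimal q Hs G → MinDeg G d → k ≤ d)

rep : (q : ℕ) → Graph → Fin q → Graph
rep q H _ = H

𝒯 : (q₁ q₂ ℓ t : ℕ) → Fin (q₁ + q₂) → Graph
𝒯 q₁ q₂ ℓ t i = [ (λ _ → C ℓ) , (λ _ → K t) ]′ (splitAt q₁ i)

{-# OPTIONS --safe #-}
module Submission where

-- Call a graph on d vertices, with edges typed by the K_t-colours and no K_t inside one type, a pattern if every
-- colouring of its vertices uses some C_ℓ-colour twice or some K_t-colour on a whole K_{t-1} of the same type. We show
-- that s_q(𝒯) is the least order of a pattern, also for q₁ = 0. Giving q₁ vertices of a pattern different C_ℓ-colours,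
-- respectively forgetting q₁ types, then yields the two inequalities.
--
-- If v is a vertex of a minimal Ramsey graph G, then a good colouring of G - v induces a pattern on the neighbours of v:
-- otherwise it extends to v. Hence no minimum degree is smaller than the least order of a pattern.
--
-- Conversely let S be a pattern on d vertices. The partite construction of Nešetřil and Rödl gives a typed graph F,
-- without K_t inside one type, whose colourings all have a copy of S with colours depending only on the types. Let K_n be
-- the largest complete graph that can be coloured by C_ℓ-colours without a monochromatic C_ℓ. Replace each vertex of F
-- by a sparse union U of copies of K_n in which vertex colourings have monochromatic copies of K_n. The result has a good
-- colouring, but it has none after a star is joined to every choice of d vertices in different blocks: the edges inside
-- a block must take C_ℓ-colours; so, as K_{n+1} is not colourable, each block has a path on ℓ - 3 vertices in every
-- C_ℓ-colour, and two stars using such a colour at the same two blocks close it to a C_ℓ. So a minimal Ramsey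
-- subgraph contains a star, which has degree at most d.

open import Defs
open import Data.Nat using (ℕ; zero; suc; _+_; _∸_; _≤_; _<_; z≤n; s≤s; _≤?_; _<?_)
import Data.Nat.Properties as ℕₚ
open import Data.Nat.DivMod using (_%_; _mod_; m%n<n; m<n⇒m%n≡m; %-distribˡ-+;
  m≤n⇒[n∸m]%m≡n%m; n%n≡0; m%n%n≡m%n; [m+n]%n≡m%n)
open import Data.Bool using (Bool; true; false; _∧_; _∨_; not; if_then_else_; T)
open import Data.Fin using (Fin; zero; suc; toℕ; splitAt; _↑ˡ_; _↑ʳ_; _≟_; punchIn; punchOut; inject₁; fromℕ)
import Data.Fin.Properties as Finₚ
import Data.Bool.Properties
import Data.Nat.ListAction
open import Data.List using (List; []; _∷_; map; _++_; length; lookup; allFin; cartesianProduct)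
import Data.List.Properties as Listₚ
open import Data.List.Membership.Propositional using (_∈_; lose)
open import Data.List.Membership.Propositional.Properties using (∈-allFin; ∈-map⁺; ∈-++⁺ˡ; ∈-++⁺ʳ; ∈-cartesianProduct⁺)
open import Data.List.Relation.Unary.Any using (here; there; any?; index; satisfied)
import Data.List.Relation.Unary.Any.Properties as Anyₚ
open import Data.Vec using (Vec; []; _∷_; tabulate; zipWith; replicate)
import Data.Vec as Vec
import Data.Vec.Properties as Vecₚ
open import Data.Maybe using (Maybe; just; nothing)
open import Data.Maybe.Properties using (just-injective)
open import Data.Sum using (_⊎_; inj₁; inj₂; [_,_]′)
open import Data.Sum.Properties using (inj₁-injective; inj₂-injective)
open import Data.Product using (Σ; ∃; _×_; _,_; proj₁; proj₂; Σ-syntax; ∃-syntax)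
open import Data.Unit using (⊤; tt)
open import Data.Empty using (⊥; ⊥-elim)
open import Function using (_∘_; id; case_of_)
open import Function.Definitions using (Injective; Surjective)
open import Relation.Nullary using (¬_; Dec; yes; no; ⌊_⌋; _×-dec_; _⊎-dec_; ¬?; _→-dec_)
import Relation.Nullary.Decidable as Dec
open import Relation.Binary using (DecidableEquality; tri<; tri≈; tri>)
open import Relation.Binary.PropositionalEquality using (_≡_; _≢_; refl; sym; trans; cong; cong₂; subst; subst₂; _≗_; module ≡-Reasoning)

-- Enumerated types

-- That the colours in a copy of S depend only on the types is not yet enough: a type could receive
-- a C_ℓ-colour, or two types the same colour. So the partite construction is applied to S together
-- with a C_ℓ in each type, a K_t mixed from any two types, and t - 2 pendant vertices for each
-- vertex and type. The first two additions make the colours of the types a permutation of the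
-- K_t-colours; the pendants force C_ℓ-colours inside the blocks. The main obstacle is that the
-- colours at a star may depend on the vertices it picks in the blocks. A product version of the
-- vertex-Ramsey property of U selects a K_n in each block such that this dependence disappears for
-- all stars and all pairs of blocks at once. Sparseness keeps the colourings of the copies of K_n
-- compatible: a C_ℓ inside a block lies in one of them. The number ℓ - 3 comes from joining a new
-- vertex to K_n in a single colour: the monochromatic cycle that arises passes through it, and two
-- stars and a vertex of another block take the places of the new vertex and its two neighbours.

record Enum (A : Set) : Set where
  field
    elems    : List A
    complete : ∀ a → a ∈ elems

  size : ℕ
  size = length elems

  to : A → Fin size
  to a = index (complete a)

  from : Fin size → A
  from = lookup elems

  from-to : ∀ a → from (to a) ≡ a
  from-to a = sym (Anyₚ.lookup-index (complete a))

  to-injective : ∀ {a b} → to a ≡ to b → a ≡ b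
  to-injective {a} {b} eq = trans (sym (from-to a)) (trans (cong from eq) (from-to b))

  dec-≡ : DecidableEquality A
  dec-≡ a b = Dec.map′ to-injective (cong to) (to a ≟ to b)

  ∃? : ∀ {P : A → Set} → (∀ a → Dec (P a)) → Dec (∃ P)
  ∃? P? = Dec.map′ satisfied (λ (a , pa) → lose (complete a) pa) (any? P? elems)

  ∀? : ∀ {P : A → Set} → (∀ a → Dec (P a)) → Dec (∀ a → P a)
  ∀? P? with ∃? (λ a → ¬? (P? a))
  ... | yes (a , ¬pa) = no λ f → ¬pa (f a)
  ... | no ¬∃ = yes λ a → Dec.decidable-stable (P? a) λ ¬pa → ¬∃ (a , ¬pa)

open Enum

Fin-enum : ∀ m → Enum (Fin m)
Fin-enum m = record { elems = allFin m ; complete = ∈-allFin }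

infixr 3 _⊎-enum_ _×-enum_

_⊎-enum_ : ∀ {A B} → Enum A → Enum B → Enum (A ⊎ B)
a ⊎-enum b = record
  { elems = map inj₁ (elems a) ++ map inj₂ (elems b)
  ; complete = λ { (inj₁ x) → ∈-++⁺ˡ (∈-map⁺ inj₁ (complete a x))
                 ; (inj₂ y) → ∈-++⁺ʳ (map inj₁ (elems a)) (∈-map⁺ inj₂ (complete b y)) } }

_×-enum_ : ∀ {A B} → Enum A → Enum B → Enum (A × B)
a ×-enum b = record
  { elems = cartesianProduct (elems a) (elems b)
  ; complete = λ (x , y) → ∈-cartesianProduct⁺ (complete a x) (complete b y) }

image-enum : ∀ {A B} → Enum A → (f : A → B) → (∀ b → ∃ λ a → f a ≡ b) → Enum B
image-enum e f surj = record
  { elems = map f (elems e)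
  ; complete = λ b → subst (_∈ map f (elems e)) (proj₂ (surj b)) (∈-map⁺ f (complete e (proj₁ (surj b)))) }

⊤-enum : Enum ⊤
⊤-enum = record { elems = tt ∷ [] ; complete = λ _ → here refl }

Maybe-enum : ∀ {A} → Enum A → Enum (Maybe A)
Maybe-enum e = image-enum (⊤-enum ⊎-enum e) [ (λ _ → nothing) , just ]′
  λ { nothing → inj₁ tt , refl ; (just a) → inj₂ a , refl }

Vec-enum : ∀ {A} → Enum A → ∀ m → Enum (Vec A m)
Vec-enum e zero = record { elems = [] ∷ [] ; complete = λ { [] → here refl } }
Vec-enum e (suc m) = image-enum (e ×-enum Vec-enum e m) (λ (x , v) → x ∷ v)
  λ { (x ∷ v) → (x , v) , refl }

-- Without function extensionality, reading back `tabulate f` gives a function only pointwise equal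
-- to `f`; hence the condition that `P` respects `_≗_`.
∃-function? : ∀ {A m} → Enum A → {P : (Fin m → A) → Set} →
  (∀ {f g} → f ≗ g → P f → P g) → (∀ f → Dec (P f)) → Dec (∃ P)
∃-function? {m = m} e resp P? =
  Dec.map′ (λ (v , p) → Vec.lookup v , p)
           (λ (f , p) → tabulate f , resp (λ i → sym (Vecₚ.lookup∘tabulate f i)) p)
           (∃? (Vec-enum e m) (λ v → P? (Vec.lookup v)))

∃-matrix? : ∀ {A k m} → Enum A → {P : (Fin k → Fin m → A) → Set} →
  (∀ {f g} → (∀ i j → f i j ≡ g i j) → P f → P g) → (∀ f → Dec (P f)) → Dec (∃ P)
∃-matrix? {k = k} {m} e resp P? =
  Dec.map′ (λ (v , p) → (λ i → Vec.lookup (Vec.lookup v i)) , p)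
           (λ (f , p) → tabulate (tabulate ∘ f) ,
              resp (λ i j → sym (trans (cong (λ w → Vec.lookup w j) (Vecₚ.lookup∘tabulate (tabulate ∘ f) i))
                                       (Vecₚ.lookup∘tabulate (f i) j))) p)
           (∃? (Vec-enum (Vec-enum e m) k) (λ v → P? (λ i → Vec.lookup (Vec.lookup v i))))

Inj : ∀ {A B : Set} → (A → B) → Set
Inj f = Injective _≡_ _≡_ f

injective? : ∀ {m A} → Enum A → (f : Fin m → A) → Dec (Inj f)
injective? {m} e f =
  Dec.map′ (λ h {x} {y} → h x y) (λ h x y → h)
    (∀? (Fin-enum m) λ x → ∀? (Fin-enum m) λ y → dec-≡ e (f x) (f y) →-dec (x ≟ y))

no-injection : ∀ {m k} → k < m → (f : Fin m → Fin k) → ¬ Inj f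
no-injection k<m f inj = let (i , j , i<j , eq) = Finₚ.pigeonhole k<m f in
  ℕₚ.<⇒≢ i<j (cong toℕ (inj eq))

injective⇒surjective : ∀ {m} (f : Fin m → Fin m) → Inj f → ∀ y → ∃ λ x → f x ≡ y
injective⇒surjective {zero} f inj ()
injective⇒surjective {suc m} f inj y with Finₚ.any? (λ x → f x ≟ y)
... | yes p = p
... | no ¬p = ⊥-elim (no-injection ℕₚ.≤-refl (λ x → punchOut (λ eq → ¬p (x , sym eq)))
                       (λ {a} {b} eq → inj (Finₚ.punchOut-injective (λ e → ¬p (a , sym e)) (λ e → ¬p (b , sym e)) eq)))

-- Pigeonhole principle and Ramsey's theorem

_<ᶠ_ : ∀ {m k} → Fin m → Fin k → Set
x <ᶠ y = toℕ x < toℕ y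

Increasing : ∀ {m k} → (Fin m → Fin k) → Set
Increasing e = ∀ {x y} → x <ᶠ y → e x <ᶠ e y

increasing⇒injective : ∀ {m k} (e : Fin m → Fin k) → Increasing e → Inj e
increasing⇒injective e inc {x} {y} eq with ℕₚ.<-cmp (toℕ x) (toℕ y)
... | tri< lt _ _ = ⊥-elim (ℕₚ.<⇒≢ (inc lt) (cong toℕ eq))
... | tri≈ _ ≈ _ = Finₚ.toℕ-injective ≈
... | tri> _ _ gt = ⊥-elim (ℕₚ.<⇒≢ (inc gt) (cong toℕ (sym eq)))

lift-suc : ∀ {m k} → (Fin k → Fin m) → Fin (suc k) → Fin (suc m)
lift-suc e zero = zero
lift-suc e (suc x) = suc (e x)

lift-suc-increasing : ∀ {m k} {e : Fin k → Fin m} → Increasing e → Increasing (lift-suc e)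
lift-suc-increasing inc {zero} {suc y} _ = s≤s z≤n
lift-suc-increasing inc {suc x} {suc y} (s≤s lt) = s≤s (inc lt)

split-increasing : ∀ {M} {P : Fin M → Set} (P? : ∀ x → Dec (P x)) a b → a + b ≤ M →
  (Σ[ e ∈ (Fin a → Fin M) ] Increasing e × (∀ x → P (e x))) ⊎
  (Σ[ e ∈ (Fin b → Fin M) ] Increasing e × (∀ x → ¬ P (e x)))
split-increasing P? zero b le = inj₁ ((λ ()) , (λ {x} → ⊥-elim (Finₚ.¬Fin0 x)) , λ ())
split-increasing P? (suc a) zero le = inj₂ ((λ ()) , (λ {x} → ⊥-elim (Finₚ.¬Fin0 x)) , λ ())
split-increasing {suc M} P? (suc a) (suc b) (s≤s le) with P? zero
split-increasing {suc M} P? (suc a) (suc b) (s≤s le) | yes p₀ with split-increasing (λ x → P? (suc x)) a (suc b) le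
... | inj₁ (e , inc , h) = inj₁ (lift-suc e , lift-suc-increasing inc , λ { zero → p₀ ; (suc x) → h x })
... | inj₂ (e , inc , h) = inj₂ (suc ∘ e , (λ lt → s≤s (inc lt)) , h)
split-increasing {suc M} P? (suc a) (suc b) (s≤s le) | no ¬p₀
  with split-increasing (λ x → P? (suc x)) (suc a) b (subst (_≤ M) (ℕₚ.+-suc a b) le)
... | inj₁ (e , inc , h) = inj₁ (suc ∘ e , (λ lt → s≤s (inc lt)) , h)
... | inj₂ (e , inc , h) = inj₂ (lift-suc e , lift-suc-increasing inc , λ { zero → ¬p₀ ; (suc x) → h x })

Homogeneous : ∀ {M} {C : Set} → (Fin M → C) → ℕ → Set
Homogeneous {M} {C} f l = Σ[ c ∈ C ] Σ[ e ∈ (Fin l → Fin M) ] Increasing e × (∀ x → f (e x) ≡ c)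

pigeonhole-Fin : ∀ k l → ∃ λ M → ∀ (f : Fin M → Fin k) → Homogeneous f l
pigeonhole-Fin zero l = 1 , λ f → ⊥-elim (Finₚ.¬Fin0 (f zero))
pigeonhole-Fin (suc k) l with pigeonhole-Fin k l
... | (M , ph) = l + M , go
  where
  go : (f : Fin (l + M) → Fin (suc k)) → Homogeneous f l
  go f with split-increasing (λ x → zero ≟ f x) l M ℕₚ.≤-refl
  ... | inj₁ (e , inc , h) = zero , e , inc , λ x → sym (h x)
  ... | inj₂ (e , inc , h) =
    let (c , e′ , inc′ , h′) = ph (λ x → punchOut (h x)) in
    suc c , e ∘ e′ , (λ lt → inc (inc′ lt)) ,
    λ x → trans (sym (Finₚ.punchIn-punchOut (h (e′ x)))) (cong suc (h′ x))

pigeonhole-enum : ∀ {C} → Enum C → ∀ l → ∃ λ M → ∀ (f : Fin M → C) → Homogeneous f l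
pigeonhole-enum E l = let (M , ph) = pigeonhole-Fin (size E) l in
  M , λ f → let (c , e , inc , h) = ph (to E ∘ f) in
    from E c , e , inc , λ x → trans (sym (from-to E (f (e x)))) (cong (from E) (h x))

-- The greedy half of Ramsey's theorem: keep the least element and pass to a set on which all pairs
-- with it agree. Afterwards a colour depends on the smaller element only, and one more pigeonhole
-- makes it constant.
end-homogeneous : ∀ {C} → Enum C → ∀ m → ∃ λ N → ∀ (g : Fin N → Fin N → C) →
  Σ[ η ∈ (Fin m → Fin N) ] Increasing η × Σ[ c ∈ (Fin m → C) ] (∀ {x y} → x <ᶠ y → g (η x) (η y) ≡ c x)
end-homogeneous E zero = 0 , λ g → (λ ()) , (λ {x} → ⊥-elim (Finₚ.¬Fin0 x)) , (λ ()) , λ {x} → ⊥-elim (Finₚ.¬Fin0 x)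
end-homogeneous {C} E (suc m) with end-homogeneous E m
... | (N , ih) with pigeonhole-enum E N
... | (M , ph) = suc M , go
  where
  go : (g : Fin (suc M) → Fin (suc M) → C) →
    Σ[ η ∈ (Fin (suc m) → Fin (suc M)) ] Increasing η ×
    Σ[ c ∈ (Fin (suc m) → C) ] (∀ {x y} → x <ᶠ y → g (η x) (η y) ≡ c x)
  go g with ph (λ x → g zero (suc x))
  ... | (c₀ , e , e-inc , h) with ih (λ x y → g (suc (e x)) (suc (e y)))
  ... | (η , η-inc , c , h′) = lift-suc (e ∘ η) , lift-suc-increasing (λ lt → e-inc (η-inc lt)) , c⁺ , mono
    where
    c⁺ : Fin (suc m) → C
    c⁺ zero = c₀
    c⁺ (suc x) = c x
    mono : ∀ {x y} → x <ᶠ y → g (lift-suc (e ∘ η) x) (lift-suc (e ∘ η) y) ≡ c⁺ x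
    mono {zero} {suc y} _ = h (η y)
    mono {suc x} {suc y} (s≤s lt) = h′ lt

ramsey-pairs : ∀ {C} → Enum C → ∀ l → ∃ λ N → ∀ (g : Fin N → Fin N → C) →
  Σ[ η ∈ (Fin l → Fin N) ] Increasing η × Σ[ c ∈ C ] (∀ {x y} → x <ᶠ y → g (η x) (η y) ≡ c)
ramsey-pairs {C} E l with pigeonhole-enum E l
... | (M , ph) with end-homogeneous E M
... | (N , eh) = N , go
  where
  go : (g : Fin N → Fin N → C) →
    Σ[ η ∈ (Fin l → Fin N) ] Increasing η × Σ[ c ∈ C ] (∀ {x y} → x <ᶠ y → g (η x) (η y) ≡ c)
  go g with eh g
  ... | (η , η-inc , c , h) with ph c
  ... | (c₀ , e , e-inc , h₀) =
    η ∘ e , (λ lt → η-inc (e-inc lt)) , c₀ , λ {x} lt → trans (h (e-inc lt)) (h₀ x)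

-- The Hales–Jewett theorem

fill-letter : ∀ {A : Set} → A → Maybe A → A
fill-letter a nothing = a
fill-letter a (just b) = b

-- A combinatorial line is a word over Maybe A in which nothing marks the moving coordinates.
fill : ∀ {A : Set} {k} → A → Vec (Maybe A) k → Vec A k
fill a = Vec.map (fill-letter a)

Moving : ∀ {A : Set} {k} → Vec (Maybe A) k → Set
Moving {k = k} w = Σ[ i ∈ Fin k ] Vec.lookup w i ≡ nothing

Monochromatic : ∀ {A C : Set} {k} → (Vec A k → C) → Set
Monochromatic {A} {k = k} χ =
  Σ[ w ∈ Vec (Maybe A) k ] Moving w × (∀ a b → χ (fill a w) ≡ χ (fill b w))

fill-++ : ∀ {A : Set} {j k} (a : A) (v : Vec (Maybe A) j) (w : Vec (Maybe A) k) →
  fill a (v Vec.++ w) ≡ fill a v Vec.++ fill a w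
fill-++ a v w = Vecₚ.map-++ (fill-letter a) v w

fill-constant : ∀ {A : Set} {k} (a : A) (v : Vec A k) → fill a (Vec.map just v) ≡ v
fill-constant a [] = refl
fill-constant a (x ∷ v) = cong (x ∷_) (fill-constant a v)

moving-++ˡ : ∀ {A : Set} {j k} (v : Vec (Maybe A) j) (w : Vec (Maybe A) k) → Moving v → Moving (v Vec.++ w)
moving-++ˡ v w (i , eq) = i ↑ˡ _ , trans (Vecₚ.lookup-++ˡ v w i) eq

moving-++ʳ : ∀ {A : Set} {j k} (v : Vec (Maybe A) j) (w : Vec (Maybe A) k) → Moving w → Moving (v Vec.++ w)
moving-++ʳ {j = j} v w (i , eq) = j ↑ʳ i , trans (Vecₚ.lookup-++ʳ v w i) eq

-- The colour condition leaves out the last letter because the smaller alphabet of the induction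
-- says nothing about it; the distinctness of the colours bounds `r` by their number.
Focused : ∀ {m k} {C : Set} → (Vec (Fin (suc m)) k → C) → ℕ → Set
Focused {m} {k} {C} χ r =
  Σ[ z ∈ Vec (Fin (suc m)) k ]
  Σ[ w ∈ (Fin r → Vec (Maybe (Fin (suc m))) k) ]
  Σ[ c ∈ (Fin r → C) ]
    Inj c × (∀ i → Moving (w i)) ×
    (∀ i (a : Fin m) → χ (fill (inject₁ a) (w i)) ≡ c i) × (∀ i → fill (fromℕ m) (w i) ≡ z)

last-or-inject₁ : ∀ {m} (a : Fin (suc m)) → (a ≡ fromℕ m) ⊎ (∃ λ b → a ≡ inject₁ b)
last-or-inject₁ {zero} zero = inj₁ refl
last-or-inject₁ {suc m} zero = inj₂ (zero , refl)
last-or-inject₁ {suc m} (suc a) with last-or-inject₁ a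
... | inj₁ eq = inj₁ (cong suc eq)
... | inj₂ (b , eq) = inj₂ (suc b , cong suc eq)

constant-line : ∀ {m k} {C : Set} (χ : Vec (Fin (suc m)) k → C) (w : Vec (Maybe (Fin (suc m))) k) (c : C) →
  (∀ (a : Fin m) → χ (fill (inject₁ a) w) ≡ c) → χ (fill (fromℕ m) w) ≡ c →
  ∀ a b → χ (fill a w) ≡ χ (fill b w)
constant-line χ w c h h-last a b = trans (value a) (sym (value b))
  where
  value : ∀ a → χ (fill a w) ≡ c
  value a with last-or-inject₁ a
  ... | inj₁ refl = h-last
  ... | inj₂ (a′ , refl) = h a′

fill-map : ∀ {m k} (a : Fin m) (w : Vec (Maybe (Fin m)) k) →
  fill (inject₁ a) (Vec.map (Data.Maybe.map inject₁) w) ≡ Vec.map inject₁ (fill a w)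
fill-map a [] = refl
fill-map a (nothing ∷ w) = cong (inject₁ a ∷_) (fill-map a w)
fill-map a (just b ∷ w) = cong (inject₁ b ∷_) (fill-map a w)

moving-map : ∀ {A B : Set} {k} (f : A → B) (w : Vec (Maybe A) k) → Moving w → Moving (Vec.map (Data.Maybe.map f) w)
moving-map f w (i , eq) = i , trans (Vecₚ.lookup-map i (Data.Maybe.map f) w) (cong (Data.Maybe.map f) eq)

HalesJewett : ℕ → Set₁
HalesJewett m = ∀ {C} → Enum C → ∃ λ k → ∀ (χ : Vec (Fin m) k → C) → Monochromatic χ

-- Colour focusing: a further line through the common last point either has a new colour or completes an old line.
focus : ∀ {m} → HalesJewett (suc m) → ∀ {C} → Enum C → ∀ r →
  ∃ λ k → ∀ (χ : Vec (Fin (suc (suc m))) k → C) → Monochromatic χ ⊎ Focused χ r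
focus hj EC zero = 0 , λ χ → inj₂ ([] , (λ ()) , (λ ()) , (λ {x} → ⊥-elim (Finₚ.¬Fin0 x)) , (λ ()) , (λ ()) , λ ())
focus {m} hj {C} EC (suc r) with focus hj EC r
... | (k , ih) with hj (Vec-enum EC (size (Vec-enum (Fin-enum (suc (suc m))) k)))
... | (k′ , hj′) = k + k′ , go
  where
  A = Fin (suc (suc m))
  EV = Vec-enum (Fin-enum (suc (suc m))) k
  go : (χ : Vec A (k + k′) → C) → Monochromatic χ ⊎ Focused χ (suc r)
  -- A point `y` of the second factor is coloured by the whole function sending `x` to the colour of
  -- `x` followed by `y`, tabulated over the first factor. A line found for this colouring behaves
  -- in the same way behind every prefix.
  go χ with hj′ (λ y → tabulate (λ i → χ (from EV i Vec.++ Vec.map inject₁ y)))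
  ... | (v , v-mov , v-mono) = result
    where
    μ : Vec (Maybe A) k′
    μ = Vec.map (Data.Maybe.map inject₁) v
    μ-mov : Moving μ
    μ-mov = moving-map inject₁ v v-mov
    last = fromℕ (suc m)
    μ-mono : ∀ x (a b : Fin (suc m)) → χ (x Vec.++ fill (inject₁ a) μ) ≡ χ (x Vec.++ fill (inject₁ b) μ)
    μ-mono x a b = subst₂ (λ y z → χ (x Vec.++ y) ≡ χ (x Vec.++ z)) (sym (fill-map a v)) (sym (fill-map b v)) eq
      where
      col-at : ∀ (y : Vec (Fin (suc m)) k′) →
        Vec.lookup (tabulate (λ i → χ (from EV i Vec.++ Vec.map inject₁ y))) (to EV x) ≡ χ (x Vec.++ Vec.map inject₁ y)
      col-at y = trans (Vecₚ.lookup∘tabulate _ (to EV x)) (cong (λ z → χ (z Vec.++ Vec.map inject₁ y)) (from-to EV x))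
      eq : χ (x Vec.++ Vec.map inject₁ (fill a v)) ≡ χ (x Vec.++ Vec.map inject₁ (fill b v))
      eq = trans (sym (col-at (fill a v))) (trans (cong (λ t → Vec.lookup t (to EV x)) (v-mono a b)) (col-at (fill b v)))
    y₀ : Vec A k′
    y₀ = fill (inject₁ zero) μ
    χ′ : Vec A k → C
    χ′ x = χ (x Vec.++ y₀)
    from-line : ∀ (w : Vec (Maybe A) k) → Moving w → (∀ a b → χ′ (fill a w) ≡ χ′ (fill b w)) → Monochromatic χ
    from-line w mov mono = w Vec.++ Vec.map just y₀ , moving-++ˡ w _ mov ,
      λ a b → trans (cong χ (expand a)) (trans (mono a b) (sym (cong χ (expand b))))
      where
      expand : ∀ a → fill a (w Vec.++ Vec.map just y₀) ≡ fill a w Vec.++ y₀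
      expand a = trans (fill-++ a w (Vec.map just y₀)) (cong (fill a w Vec.++_) (fill-constant a y₀))
    result : Monochromatic χ ⊎ Focused χ (suc r)
    result with ih χ′
    ... | inj₁ (w , mov , mono) = inj₁ (from-line w mov mono)
    ... | inj₂ (z , w , c , c-inj , mov , near , end) with Finₚ.any? (λ i → dec-≡ EC (c i) (χ′ z))
    -- The focus has the colour of line `i`, so this line is monochromatic with its last point
    -- included.
    ...   | yes (i , eq) = inj₁ (from-line (w i) (mov i)
              (constant-line χ′ (w i) (c i) (near i) (trans (cong χ′ (end i)) (sym eq))))
    ...   | no new = inj₂ (z Vec.++ fill last μ , w⁺ , c⁺ , c⁺-inj , mov⁺ , near⁺ , end⁺)
      where
      w⁺ : Fin (suc r) → Vec (Maybe A) (k + k′)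
      -- The new line moves only in the second factor and takes the colour of the old focus; the old
      -- lines now move in both factors, so that all of them share the new end.
      w⁺ zero = Vec.map just z Vec.++ μ
      w⁺ (suc i) = w i Vec.++ μ
      c⁺ : Fin (suc r) → C
      c⁺ zero = χ′ z
      c⁺ (suc i) = c i
      c⁺-inj : Inj c⁺
      c⁺-inj {zero} {zero} _ = refl
      c⁺-inj {zero} {suc j} eq = ⊥-elim (new (j , sym eq))
      c⁺-inj {suc i} {zero} eq = ⊥-elim (new (i , eq))
      c⁺-inj {suc i} {suc j} eq = cong suc (c-inj eq)
      mov⁺ : ∀ i → Moving (w⁺ i)
      mov⁺ zero = moving-++ʳ (Vec.map just z) μ μ-mov
      mov⁺ (suc i) = moving-++ˡ (w i) μ (mov i)
      near⁺ : ∀ i (a : Fin (suc m)) → χ (fill (inject₁ a) (w⁺ i)) ≡ c⁺ i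
      near⁺ zero a = trans (cong χ (trans (fill-++ _ (Vec.map just z) μ) (cong (Vec._++ fill (inject₁ a) μ) (fill-constant _ z))))
                           (μ-mono z a zero)
      near⁺ (suc i) a = trans (cong χ (fill-++ _ (w i) μ)) (trans (μ-mono _ a zero) (near i a))
      end⁺ : ∀ i → fill last (w⁺ i) ≡ z Vec.++ fill last μ
      end⁺ zero = trans (fill-++ _ (Vec.map just z) μ) (cong (Vec._++ fill last μ) (fill-constant _ z))
      end⁺ (suc i) = trans (fill-++ _ (w i) μ) (cong (Vec._++ fill last μ) (end i))

hales-jewett : ∀ m → HalesJewett m
hales-jewett zero EC = 1 , λ χ → nothing ∷ [] , (zero , refl) , λ ()
hales-jewett (suc zero) EC = 1 , λ χ → nothing ∷ [] , (zero , refl) , λ { zero zero → refl }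
-- One line more than there are colours, which excludes a focused family.
hales-jewett (suc (suc m)) {C} EC with focus (hales-jewett (suc m)) EC (suc (size EC))
... | (k , h) = k , λ χ → [ id , (λ (_ , _ , c , c-inj , _) →
  ⊥-elim (no-injection ℕₚ.≤-refl (to EC ∘ c) (λ eq → c-inj (to-injective EC eq)))) ]′ (h χ)

-- Sparse hypergraphs with unavoidable edges

record Hypergraph (m : ℕ) : Set₁ where
  field
    V : Set
    E : Set
    V-enum : Enum V
    E-enum : Enum E
    inc : E → Fin m → V
    inc-injective : ∀ e → Inj (inc e)

  _∈ₑ_ : V → E → Set
  v ∈ₑ e = ∃ λ i → inc e i ≡ v

  data Walk : V → E → V → ℕ → Set where
    one  : ∀ {u e v} → u ∈ₑ e → v ∈ₑ e → u ≢ v → Walk u e v 1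
    step : ∀ {u e w e′ v r} → u ∈ₑ e → w ∈ₑ e → u ≢ w → e ≢ e′ → Walk w e′ v r → Walk u e v (suc r)

  -- The end edges may coincide, but then deleting both ends leaves a shorter closed walk,
  -- so this is the usual condition that there is no cycle of length between 2 and g.
  Girth> : ℕ → Set
  Girth> g = ∀ {u e v r} → Walk u e v r → 2 ≤ r → r ≤ g → u ≢ v

  Unavoidable : Set → Set
  Unavoidable C = ∀ (c : V → C) → Σ[ e ∈ E ] (∀ i j → c (inc e i) ≡ c (inc e j))

open Hypergraph public

-- All edge sizes `m` are treated together: the step from `g` to `suc g` uses edges with as many
-- vertices as the whole hypergraph built so far, however small the intended `m` is.
Sparse : ℕ → Set₁
Sparse g = ∀ m {C} → Enum C → Σ[ H ∈ Hypergraph m ] Girth> H g × Unavoidable H C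

walk-length>0 : ∀ {m} (H : Hypergraph m) {u e v r} → Walk H u e v r → 1 ≤ r
walk-length>0 H (one _ _ _) = s≤s z≤n
walk-length>0 H (step _ _ _ _ _) = s≤s z≤n

decided : ∀ {A B : Set} {P : A → Set} → (∀ a → Dec (P a)) → (∀ a → P a → B) → List A → List B
decided P? f [] = []
decided P? f (x ∷ xs) with P? x
... | yes p = f x p ∷ decided P? f xs
... | no _ = decided P? f xs

decided-complete : ∀ {A B : Set} {P : A → Set} (P? : ∀ a → Dec (P a)) (f : ∀ a → P a → B) {x xs} →
  x ∈ xs → P x → Σ[ p ∈ P x ] f x p ∈ decided P? f xs
decided-complete P? f {x} {y ∷ ys} (here refl) p with P? x
... | yes p′ = p′ , here refl
... | no ¬p = ⊥-elim (¬p p)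
decided-complete P? f {x} {y ∷ ys} (there x∈) p with P? y | decided-complete P? f x∈ p
... | yes _ | (p′ , q) = p′ , there q
... | no _ | r = r

complete-hypergraph : ∀ m M → Hypergraph m
complete-hypergraph m M = record
  { V = Fin M ; E = Fin (length edges) ; V-enum = Fin-enum M ; E-enum = Fin-enum _
  ; inc = λ e → proj₁ (lookup edges e) ; inc-injective = λ e → proj₂ (lookup edges e) }
  where
  edges : List (Σ (Fin m → Fin M) Inj)
  edges = decided (λ v → injective? (Fin-enum M) (Vec.lookup v)) (λ v p → Vec.lookup v , p)
                  (elems (Vec-enum (Fin-enum M) m))

edge-through : ∀ {m M} (f : Fin m → Fin M) → Inj f → ∃ λ e → ∀ i → inc (complete-hypergraph m M) e i ≡ f i
edge-through {m} {M} f f-inj with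
  decided-complete (λ v → injective? (Fin-enum M) (Vec.lookup v)) (λ v p → (Vec.lookup v , (λ {x} {y} → p {x} {y})))
    (complete (Vec-enum (Fin-enum M) m) (tabulate f))
    (λ {x} {y} eq → f-inj (trans (sym (Vecₚ.lookup∘tabulate f x)) (trans eq (Vecₚ.lookup∘tabulate f y))))
... | (p , q) = index q , λ i → trans (cong (λ e → proj₁ e i) (sym (Anyₚ.lookup-index q))) (Vecₚ.lookup∘tabulate f i)

-- The girth condition with bound 1 is vacuous, so the complete hypergraph and the pigeonhole
-- principle suffice.
sparse-1 : Sparse 1
sparse-1 m {C} EC with pigeonhole-enum EC m
... | (M , ph) = complete-hypergraph m M , (λ _ 2≤r r≤1 → ⊥-elim (ℕₚ.<-irrefl refl (ℕₚ.≤-trans 2≤r r≤1))) , unavoidable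
  where
  unavoidable : Unavoidable (complete-hypergraph m M) C
  unavoidable c with ph c
  ... | (c₀ , f , f-inc , h) with edge-through f (increasing⇒injective f f-inc)
  ... | (e , eq) = e , λ i j → trans (value i) (sym (value j))
    where
    value : ∀ i → c (inc (complete-hypergraph m M) e i) ≡ c₀
    value i = trans (cong c (eq i)) (h i)

-- Amalgamation of partite hypergraphs

record Partite (m N : ℕ) : Set₁ where
  field
    hyper : Hypergraph m
    part : V hyper → Fin N
    part-injective : ∀ e → Inj (part ∘ inc hyper e)

open Partite public

-- The Nešetřil-Rödl amalgamation: every edge of `G` carries a copy of `P`, and different copies can
-- meet only in part `p`, which is laid onto the vertices of `G`. An edge of `G` has one place for
-- each vertex of `P`, so the enumeration of `V H` also numbers the vertices of part `p`.
module Amalgam {m N} (P : Partite m N) (p : Fin N) (G : Hypergraph (size (V-enum (hyper P)))) where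
  private
    H = hyper P
  index-of : V H → Fin (size (V-enum H))
  index-of = to (V-enum H)

  V′ : Set
  V′ = V G ⊎ (E G × V H)

  copy : E G → V H → V′
  copy h v with part P v ≟ p
  ... | yes _ = inj₁ (inc G h (index-of v))
  ... | no _  = inj₂ (h , v)

  part′ : V′ → Fin N
  part′ (inj₁ _) = p
  part′ (inj₂ (_ , v)) = part P v

  part-copy : ∀ h v → part′ (copy h v) ≡ part P v
  part-copy h v with part P v ≟ p
  ... | yes eq = sym eq
  ... | no _ = refl

  copy-injective : ∀ h → Inj (copy h)
  copy-injective h {v} {w} eq with part P v ≟ p | part P w ≟ p
  ... | yes _ | yes _ = to-injective (V-enum H) (inc-injective G h (inj₁-injective eq))
  ... | no _ | no _ = cong proj₂ (inj₂-injective eq)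
  copy-injective h () | yes _ | no _
  copy-injective h () | no _ | yes _

  hyper′ : Hypergraph m
  hyper′ = record
    { V = V′ ; E = E G × E H
    ; V-enum = V-enum G ⊎-enum (E-enum G ×-enum V-enum H) ; E-enum = E-enum G ×-enum E-enum H
    ; inc = λ (h , e) i → copy h (inc H e i)
    ; inc-injective = λ (h , e) eq → inc-injective H e (copy-injective h eq) }

  amalgam : Partite m N
  amalgam = record
    { hyper = hyper′ ; part = part′
    ; part-injective = λ (h , e) {x} {y} eq → part-injective P e
        (trans (sym (part-copy h (inc H e x))) (trans eq (part-copy h (inc H e y)))) }

  copy-in-part : ∀ h {v} → part P v ≡ p → copy h v ≡ inj₁ (inc G h (index-of v))
  copy-in-part h {v} eq with part P v ≟ p
  ... | yes _ = refl
  ... | no ne = ⊥-elim (ne eq)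

  common⇒in-part : ∀ {h h′ v v′} → h ≢ h′ → copy h v ≡ copy h′ v′ → part P v ≡ p
  common⇒in-part {h} {h′} {v} {v′} ne eq with part P v ≟ p | part P v′ ≟ p
  ... | yes q | _ = q
  ... | no _ | no _ = ⊥-elim (ne (cong proj₁ (inj₂-injective eq)))
  common⇒in-part ne () | no _ | yes _

  -- A walk of the amalgam cut into maximal pieces inside one copy.
  data Runs : V′ → E G → E H → V′ → ℕ → Set where
    last : ∀ {h v e v′ r} → Walk H v e v′ r → Runs (copy h v) h e (copy h v′) r
    cons : ∀ {h v e v₀ r h′ v₁ e′ z s} → Walk H v e v₀ r → h ≢ h′ → copy h v₀ ≡ copy h′ v₁ →
           Runs (copy h′ v₁) h′ e′ z s → Runs (copy h v) h e z (r + s)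

  runs : ∀ {x h e z r} → Walk hyper′ x (h , e) z r → Runs x h e z r
  runs {h = h} {e} (one (i , refl) (j , refl) ne) =
    last (one (i , refl) (j , refl) (λ eq → ne (cong (copy h) eq)))
  runs {h = h} {e} (step {w = w} {e′ = h′ , e′} (i , refl) (j , eqw) ne ee W) = prepend (runs W) (sym eqw)
    where
    ne′ : ∀ {w′} → inc H e j ≡ w′ → inc H e i ≢ w′
    ne′ eq eq′ = ne (trans (cong (copy h) (trans eq′ (sym eq))) eqw)
    prepend : ∀ {z s} → Runs w h′ e′ z s → w ≡ copy h (inc H e j) → Runs (copy h (inc H e i)) h e z (suc s)
    prepend R eq with dec-≡ (E-enum G) h h′
    prepend (last {v = v} W′) eq | yes refl =
      last (step (i , refl) (j , q) (ne′ q) (λ q → ee (cong (h ,_) q)) W′)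
      where q = sym (copy-injective h eq)
    prepend (cons {v = v} W′ hh eqv R) eq | yes refl =
      cons (step (i , refl) (j , q) (ne′ q) (λ q → ee (cong (h ,_) q)) W′) hh eqv R
      where q = sym (copy-injective h eq)
    prepend (last W′) eq | no hh = cons (one (i , refl) (j , refl) (ne′ refl)) hh (sym eq) (last W′)
    prepend (cons W′ hh′ eqv R) eq | no hh =
      cons (one (i , refl) (j , refl) (ne′ refl)) hh (sym eq) (cons W′ hh′ eqv R)

  module _ {g} (1≤g : 1 ≤ g) (H-girth : Girth> H (suc g)) (G-girth : Girth> G g) where

    -- An edge has at most one vertex in part p.
    run-length : ∀ {v e v′ r} → Walk H v e v′ r → part P v ≡ p → part P v′ ≡ p → 2 ≤ r
    run-length {e = e} (one (i , refl) (j , refl) ne) a b =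
      ⊥-elim (ne (cong (inc H e) (part-injective P e (trans a (sym b)))))
    run-length (step _ _ _ _ W) _ _ = s≤s (walk-length>0 H W)

    root : E G → V H → V G
    root h v = inc G h (index-of v)

    run-ends : ∀ {h v e v′ r} → Walk H v e v′ r → part P v ≡ p → part P v′ ≡ p → r ≤ suc g → root h v ≢ root h v′
    run-ends {h} W a b le eq = H-girth W (run-length W a b) le (to-injective (V-enum H) (inc-injective G h eq))

    same-root : ∀ {h h′ v v′} → part P v ≡ p → copy h v ≡ copy h′ v′ → (part P v′ ≡ p) × (root h v ≡ root h′ v′)
    same-root {h} {h′} {v} {v′} a eq = b , inj₁-injective (trans (sym (copy-in-part h a)) (trans eq (copy-in-part h′ b)))
      where
      b : part P v′ ≡ p
      b = trans (sym (part-copy h′ v′)) (trans (cong part′ (sym eq)) (trans (part-copy h v) a))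

    closed⇒⊥ : ∀ {u h k} → Walk G u h u k → k ≤ g → ⊥
    closed⇒⊥ (one _ _ ne) _ = ne refl
    closed⇒⊥ W@(step _ _ _ _ W′) le = G-girth W (s≤s (walk-length>0 G W′)) le refl

    double-suc : ∀ {k s r} → 2 ≤ r → k + k ≤ s → suc k + suc k ≤ r + s
    double-suc {k} {s} {r} 2≤r le = subst (_≤ r + s) (cong suc (sym (ℕₚ.+-suc k k))) (ℕₚ.+-mono-≤ 2≤r le)

    -- A run between two vertices of part `p` becomes one step of `G` between their roots. It has at
    -- least two steps itself, so the shadow is at most half as long as the walk; this is why girth
    -- bound `g` for `G` is enough for `suc g` in the amalgam.
    shadow-in : ∀ {x h e z r v vz hz} → Runs x h e z r → x ≡ copy h v → part P v ≡ p →
      z ≡ copy hz vz → part P vz ≡ p → r ≤ suc g →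
      ∃ λ k → Walk G (root h v) h (root hz vz) k × k + k ≤ r
    shadow-in {h = h} {vz = vz} {hz} (last {v = w} {v′ = v′} W) x≡ a z≡ b le
      with copy-injective h x≡ | same-root b (sym z≡)
    ... | refl | (b′ , eq) = 1 ,
      one (_ , refl) (_ , sym eq) (λ q → run-ends W a b′ le (trans q eq)) , run-length W a b′
    shadow-in {h = h} (cons {v₀ = v₀} {r = r} {s = s} W hh eqv R) x≡ a z≡ b le
      with copy-injective h x≡
    ... | refl with same-root (common⇒in-part (hh ∘ sym) (sym eqv)) (sym eqv) | common⇒in-part (hh ∘ sym) (sym eqv)
    ... | (a₀ , eq) | a₁ with shadow-in R refl a₁ z≡ b (ℕₚ.≤-trans (ℕₚ.m≤n+m s r) le)
    ... | (k , Wk , kk) = suc k ,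
      step (_ , refl) (_ , sym eq) (λ q → run-ends W a a₀ (ℕₚ.≤-trans (ℕₚ.m≤m+n r s) le) (trans q eq)) hh Wk ,
      double-suc {k} {s} (run-length W a a₀) kk

    -- For closed walks that start outside part `p`. The final run enters the copy `hz` at a vertex
    -- `w` of part `p`; cutting this run off leaves a shadow that ends at the root of `w`, and the
    -- steps lost make the inequality strict. The first alternative is the case of a single run.
    shadow-off : ∀ {x h e z r v vz hz} → Runs x h e z r → x ≡ copy h v → part P v ≡ p →
      z ≡ copy hz vz → part P vz ≢ p → r ≤ suc g →
      h ≡ hz ⊎ (∃ λ k → ∃ λ w → part P w ≡ p × Walk G (root h v) h (root hz w) k × k + k < r)
    shadow-off {h = h} {hz = hz} (last W) x≡ a z≡ nb le with dec-≡ (E-enum G) h hz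
    ... | yes eq = inj₁ eq
    ... | no ne = ⊥-elim (nb (common⇒in-part (ne ∘ sym) (sym z≡)))
    shadow-off {h = h} {hz = hz} (cons {v₀ = v₀} {r = r} {v₁ = v₁} {s = s} W hh eqv R) x≡ a z≡ nb le
      with copy-injective h x≡
    ... | refl with same-root (common⇒in-part (hh ∘ sym) (sym eqv)) (sym eqv) | common⇒in-part (hh ∘ sym) (sym eqv)
    ... | (a₀ , eq) | a₁ with shadow-off R refl a₁ z≡ nb (ℕₚ.≤-trans (ℕₚ.m≤n+m s r) le)
    ... | inj₁ refl = inj₂ (1 , v₁ , a₁ ,
      one (_ , refl) (_ , sym eq) (λ q → run-ends W a a₀ (ℕₚ.≤-trans (ℕₚ.m≤m+n r s) le) (trans q eq)) ,
      ℕₚ.+-mono-≤ (run-length W a a₀) (runs-length R))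
      where
      runs-length : ∀ {x h e z r} → Runs x h e z r → 1 ≤ r
      runs-length (last W) = walk-length>0 H W
      runs-length (cons {r = r} {s = s} W _ _ _) = ℕₚ.≤-trans (walk-length>0 H W) (ℕₚ.m≤m+n r s)
    ... | inj₂ (k , w , wp , Wk , kk) = inj₂ (suc k , w , wp ,
      step (_ , refl) (_ , sym eq) (λ q → run-ends W a a₀ (ℕₚ.≤-trans (ℕₚ.m≤m+n r s) le) (trans q eq)) hh Wk ,
      subst (_≤ r + s) (cong (2 +_) (sym (ℕₚ.+-suc k k))) (ℕₚ.+-mono-≤ (run-length W a a₀) kk))

    half : ∀ {k r} → k + k ≤ r → r ≤ suc g → k ≤ g
    half {zero} _ _ = z≤n
    half {suc k} kk le = ℕₚ.≤-trans (ℕₚ.≤-trans (ℕₚ.m≤n+m (suc k) k) (ℕₚ.≤-pred kk′)) ℕₚ.≤-refl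
      where
      kk′ : suc (k + suc k) ≤ suc g
      kk′ = ℕₚ.≤-trans kk le

    girth : Girth> hyper′ (suc g)
    girth {x} {h , e} {z} {r} W 2≤r le x≡z = go (runs W) le 2≤r x≡z
      where
      go : ∀ {x h e z r} → Runs x h e z r → r ≤ suc g → 2 ≤ r → x ≢ z
      go {h = h} (last W) le 2≤r eq = H-girth W 2≤r le (copy-injective h eq)
      go {h = h} {r = r₀} R@(cons {v = v} {v₀ = v₀} {r = r} {h′ = h′} {v₁ = v₁} {s = s} W hh eqv R′) le 2≤r eq =
        -- A walk that starts in part `p` has a closed shadow. Otherwise it begins and ends in the
        -- same copy, and one further step inside the edge `h` of `G` closes the shadow of what lies
        -- between.
        case part P v ≟ p of λ
          { (yes a) → let (k , Wk , kk) = shadow-in R refl a (sym eq) a le in closed⇒⊥ Wk (half kk le)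
          ; (no na) → off (shadow-off R′ refl a₁ (sym eq) na (ℕₚ.≤-trans (ℕₚ.m≤n+m s r) le)) }
        where
        a₁ = common⇒in-part (hh ∘ sym) (sym eqv)
        eq₀ = proj₂ (same-root a₁ (sym eqv))
        bound : ∀ {k} → k + k < s → suc k ≤ g
        bound {k} kk with ℕₚ.≤-trans (ℕₚ.+-mono-≤ (walk-length>0 H W) kk) le
        ... | s≤s q = ℕₚ.≤-trans (s≤s (ℕₚ.m≤m+n k k)) q
        off : h′ ≡ h ⊎ (∃ λ k → ∃ λ w → part P w ≡ p × Walk G (root h′ v₁) h′ (root h w) k × k + k < s) → ⊥
        off (inj₁ h′≡h) = hh (sym h′≡h)
        off (inj₂ (k , w , wp , Wk , kk)) with dec-≡ (V-enum G) (root h w) (root h′ v₁)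
        ... | yes q = closed⇒⊥ (subst (λ y → Walk G y _ (root h w) k) (sym q) Wk) (ℕₚ.≤-trans (ℕₚ.n≤1+n k) (bound kk))
        ... | no q = closed⇒⊥ (step (_ , refl) (_ , sym eq₀) q hh Wk) (bound kk)

module SparseStep (g : ℕ) (1≤g : 1 ≤ g) (sparse-g : Sparse g) (m : ℕ) {C : Set} (EC : Enum C)
  (N : ℕ) (ph : ∀ (f : Fin N → Maybe C) → Homogeneous f m) where
  private
    base : Hypergraph m
    base = complete-hypergraph m N

  -- The starting picture: each injective choice of `m` parts is spanned by an edge, and all edges
  -- are disjoint, so that there is no cycle at all.
  disjoint-edges : Partite m N
  disjoint-edges = record
    { hyper = record
        { V = E base × Fin m ; E = E base ; V-enum = E-enum base ×-enum Fin-enum m ; E-enum = E-enum base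
        ; inc = λ e i → e , i ; inc-injective = λ e eq → cong proj₂ eq }
    ; part = λ (e , i) → inc base e i ; part-injective = inc-injective base }

  private
    P₀ = disjoint-edges
    H₀ = hyper P₀

  disjoint-edges-girth : Girth> H₀ (suc g)
  disjoint-edges-girth (one _ _ _) (s≤s ()) _ _
  disjoint-edges-girth (step _ (_ , refl) _ ne W) _ _ _ = ne (sym (start W))
    where
    start : ∀ {e′ i v r} {e : E base} → Walk H₀ (e , i) e′ v r → e′ ≡ e
    start (one (_ , refl) _ _) = refl
    start (step (_ , refl) _ _ _ _) = refl

  record Stage (ps : List (Fin N)) : Set₁ where
    field
      P : Partite m N
      P-girth : Girth> (hyper P) (suc g)
      embed : ∀ (c : V (hyper P) → C) → Σ[ f ∈ (V H₀ → V (hyper P)) ]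
        (∀ v → part P (f v) ≡ part P₀ v) ×
        (∀ e → ∃ λ e′ → ∀ i → inc (hyper P) e′ i ≡ f (inc H₀ e i)) ×
        (∀ {p v w} → p ∈ ps → part P₀ v ≡ p → part P₀ w ≡ p → c (f v) ≡ c (f w))

  stage : ∀ ps → Stage ps
  stage [] = record { P = P₀ ; P-girth = disjoint-edges-girth
                    ; embed = λ c → id , (λ _ → refl) , (λ e → e , λ _ → refl) , λ () }
  stage (p ∷ ps) with stage ps
  ... | S with sparse-g (size (V-enum (hyper (Stage.P S)))) EC
  ... | (G , G-girth , G-unavoidable) = record
      { P = amalgam ; P-girth = girth 1≤g P-girth G-girth ; embed = embed′ }
    where
    open Stage S
    open Amalgam P p G
    embed′ : ∀ (c : V′ → C) → Σ[ f ∈ (V H₀ → V′) ]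
        (∀ v → part′ (f v) ≡ part P₀ v) ×
        (∀ e → ∃ λ e′ → ∀ i → inc hyper′ e′ i ≡ f (inc H₀ e i)) ×
        (∀ {p′ v w} → p′ ∈ p ∷ ps → part P₀ v ≡ p′ → part P₀ w ≡ p′ → c (f v) ≡ c (f w))
    -- The edge of `G` is chosen before the earlier parts are looked at: it makes part `p`
    -- monochromatic, and the previous stage then applies inside the copy that it carries.
    embed′ c with G-unavoidable (c ∘ inj₁)
    ... | (h , h-mono) with embed (c ∘ copy h)
    ... | (f , f-part , f-edge , f-mono) = copy h ∘ f ,
      (λ v → trans (part-copy h (f v)) (f-part v)) ,
      (λ e → let (e′ , q) = f-edge e in (h , e′) , λ i → cong (copy h) (q i)) , mono
      where
      mono : ∀ {p′ v w} → p′ ∈ p ∷ ps → part P₀ v ≡ p′ → part P₀ w ≡ p′ → c (copy h (f v)) ≡ c (copy h (f w))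
      mono {v = v} {w} (here refl) a b =
        trans (cong c (copy-in-part h (trans (f-part v) a)))
          (trans (h-mono _ _) (sym (cong c (copy-in-part h (trans (f-part w) b)))))
      mono (there p∈) a b = f-mono p∈ a b

  result : Σ[ H ∈ Hypergraph m ] Girth> H (suc g) × Unavoidable H C
  result = hyper P , P-girth , unavoidable
    where
    open Stage (stage (allFin N))
    unavoidable : Unavoidable (hyper P) C
    unavoidable c = go (embed c)
      where
      go : Σ[ f ∈ (V H₀ → V (hyper P)) ]
        (∀ v → part P (f v) ≡ part P₀ v) ×
        (∀ e → ∃ λ e′ → ∀ i → inc (hyper P) e′ i ≡ f (inc H₀ e i)) ×
        (∀ {p v w} → p ∈ allFin N → part P₀ v ≡ p → part P₀ w ≡ p → c (f v) ≡ c (f w)) →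
        Σ[ e ∈ E (hyper P) ] (∀ i j → c (inc (hyper P) e i) ≡ c (inc (hyper P) e j))
      go (f , f-part , f-edge , f-mono) = proj₁ (f-edge e) ,
        λ i j → trans (value i) (trans (just-injective (trans (just-value i) (sym (just-value j)))) (sym (value j)))
        where
        colour-of-part : (p : Fin N) → Dec (∃ λ v → part P₀ v ≡ p) → Maybe C
        colour-of-part p (yes (v , _)) = just (c (f v))
        -- A part that meets no edge has no colour; `nothing` serves as an additional colour in the
        -- pigeonhole.
        colour-of-part p (no _) = nothing
        hit? : ∀ p → Dec (∃ λ v → part P₀ v ≡ p)
        hit? p = ∃? (V-enum H₀) (λ v → part P₀ v ≟ p)
        colour-correct : ∀ v → (d : Dec (∃ λ w → part P₀ w ≡ part P₀ v)) → colour-of-part (part P₀ v) d ≡ just (c (f v))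
        colour-correct v (yes (w , eq)) = cong just (f-mono (∈-allFin _) eq refl)
        colour-correct v (no ¬p) = ⊥-elim (¬p (v , refl))
        found : Homogeneous (λ p → colour-of-part p (hit? p)) m
        found = ph (λ p → colour-of-part p (hit? p))
        c₀ : Maybe C
        c₀ = proj₁ found
        η : Fin m → Fin N
        η = proj₁ (proj₂ found)
        e : E base
        e = proj₁ (edge-through η (increasing⇒injective η (proj₁ (proj₂ (proj₂ found)))))
        e-η : ∀ i → inc base e i ≡ η i
        e-η = proj₂ (edge-through η (increasing⇒injective η (proj₁ (proj₂ (proj₂ found)))))
        just-value : ∀ i → just (c (f (e , i))) ≡ c₀
        just-value i = trans (sym (colour-correct (e , i) (hit? (inc base e i))))
          (trans (cong (λ p → colour-of-part p (hit? p)) (e-η i)) (proj₂ (proj₂ (proj₂ found)) i))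
        value : ∀ i → c (inc (hyper P) (proj₁ (f-edge e)) i) ≡ c (f (e , i))
        value i = cong c (proj₂ (f-edge e) i)

sparse : ∀ g → Sparse (suc g)
sparse zero = sparse-1
sparse (suc g) m EC = 
  let (N , ph) = pigeonhole-enum (Maybe-enum EC) m in
  SparseStep.result (suc g) (s≤s z≤n) (sparse g) m EC N ph

-- Unavoidable products of edges

module _ {m : ℕ} (H G : Hypergraph m) where
  disjoint-sum : Hypergraph m
  disjoint-sum = record
    { V = V H ⊎ V G ; E = E H ⊎ E G
    ; V-enum = V-enum H ⊎-enum V-enum G ; E-enum = E-enum H ⊎-enum E-enum G
    ; inc = [ (λ e i → inj₁ (inc H e i)) , (λ e i → inj₂ (inc G e i)) ]′
    ; inc-injective = λ { (inj₁ e) eq → inc-injective H e (inj₁-injective eq)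
                        ; (inj₂ e) eq → inc-injective G e (inj₂-injective eq) } }

  walk-left : ∀ {x e z r} → Walk disjoint-sum x (inj₁ e) z r →
    ∃ λ u → ∃ λ v → x ≡ inj₁ u × z ≡ inj₁ v × Walk H u e v r
  walk-left (one (i , refl) (j , refl) ne) = _ , _ , refl , refl , one (i , refl) (j , refl) (λ eq → ne (cong inj₁ eq))
  walk-left (step {e′ = inj₁ e′} (i , refl) (j , refl) ne ee W) with walk-left W
  ... | (u , v , refl , refl , W′) =
    _ , _ , refl , refl , step (i , refl) (j , refl) (λ eq → ne (cong inj₁ eq)) (λ eq → ee (cong inj₁ eq)) W′
  walk-left (step {e′ = inj₂ e′} _ (j , refl) _ _ (one (_ , ()) _ _))
  walk-left (step {e′ = inj₂ e′} _ (j , refl) _ _ (step (_ , ()) _ _ _ _))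

  walk-right : ∀ {x e z r} → Walk disjoint-sum x (inj₂ e) z r →
    ∃ λ u → ∃ λ v → x ≡ inj₂ u × z ≡ inj₂ v × Walk G u e v r
  walk-right (one (i , refl) (j , refl) ne) = _ , _ , refl , refl , one (i , refl) (j , refl) (λ eq → ne (cong inj₂ eq))
  walk-right (step {e′ = inj₂ e′} (i , refl) (j , refl) ne ee W) with walk-right W
  ... | (u , v , refl , refl , W′) =
    _ , _ , refl , refl , step (i , refl) (j , refl) (λ eq → ne (cong inj₂ eq)) (λ eq → ee (cong inj₂ eq)) W′
  walk-right (step {e′ = inj₁ e′} _ (j , refl) _ _ (one (_ , ()) _ _))
  walk-right (step {e′ = inj₁ e′} _ (j , refl) _ _ (step (_ , ()) _ _ _ _))

  disjoint-sum-girth : ∀ {g} → Girth> H g → Girth> G g → Girth> disjoint-sum g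
  disjoint-sum-girth gH gG {e = inj₁ e} W 2≤r r≤g eq with walk-left W
  ... | (u , v , refl , refl , W′) = gH W′ 2≤r r≤g (inj₁-injective eq)
  disjoint-sum-girth gH gG {e = inj₂ e} W 2≤r r≤g eq with walk-right W
  ... | (u , v , refl , refl , W′) = gG W′ 2≤r r≤g (inj₂-injective eq)

points : ∀ {m N} (H : Hypergraph m) → Vec (E H) N → Vec (Fin m) N → Vec (V H) N
points H = zipWith (inc H)

ProductUnavoidable : ∀ {m} → Hypergraph m → ℕ → Set → Set
ProductUnavoidable {m} H N C = ∀ (c : Vec (V H) N → C) →
  Σ[ es ∈ Vec (E H) N ] (∀ is js → c (points H es is) ≡ c (points H es js))

points-left : ∀ {m N} (H G : Hypergraph m) (es : Vec (E H) N) is →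
  points (disjoint-sum H G) (Vec.map inj₁ es) is ≡ Vec.map inj₁ (points H es is)
points-left H G [] [] = refl
points-left H G (e ∷ es) (i ∷ is) = cong (inj₁ (inc H e i) ∷_) (points-left H G es is)

-- The new coordinate is coloured by entire functions on the power already treated, so that one edge
-- of `G` serves all continuations. As all coordinates must range over a single hypergraph, `G` is
-- added as a disjoint summand, which creates no cycles. Edges are nonempty, so a coordinate can be
-- fixed at `zero` meanwhile.
sparse-product : ∀ g m {C} → Enum C → ∀ N →
  Σ[ H ∈ Hypergraph (suc m) ] Girth> H (suc g) × ProductUnavoidable H N C
sparse-product g m EC zero with sparse g (suc m) EC
... | (H , H-girth , _) = H , H-girth , λ c → [] , λ { [] [] → refl }
sparse-product g m {C} EC (suc N) with sparse-product g m EC N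
... | (H , H-girth , H-prod) with sparse g (suc m) (Vec-enum EC (size (Vec-enum (V-enum H) N)))
... | (G , G-girth , G-unav) = disjoint-sum H G , disjoint-sum-girth H G H-girth G-girth , prod
  where
  EV = Vec-enum (V-enum H) N
  prod : ProductUnavoidable (disjoint-sum H G) (suc N) C
  prod c = go (G-unav (λ y → tabulate (λ k → c (inj₂ y ∷ Vec.map inj₁ (from EV k)))))
    where
    go : Σ[ e ∈ E G ] (∀ i j → tabulate (λ k → c (inj₂ (inc G e i) ∷ Vec.map inj₁ (from EV k))) ≡
                               tabulate (λ k → c (inj₂ (inc G e j) ∷ Vec.map inj₁ (from EV k)))) →
      Σ[ es ∈ Vec (E H ⊎ E G) (suc N) ]
        (∀ is js → c (points (disjoint-sum H G) es is) ≡ c (points (disjoint-sum H G) es js))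
    go (e , e-mono) with H-prod (λ x → c (inj₂ (inc G e zero) ∷ Vec.map inj₁ x))
    ... | (es , es-mono) = inj₂ e ∷ Vec.map inj₁ es , λ is js → trans (normal is) (sym (normal js))
      where
      first : ∀ i j x → c (inj₂ (inc G e i) ∷ Vec.map inj₁ x) ≡ c (inj₂ (inc G e j) ∷ Vec.map inj₁ x)
      first i j x = trans (sym (at i)) (trans (cong (λ t → Vec.lookup t (to EV x)) (e-mono i j)) (at j))
        where
        at : ∀ i → Vec.lookup (tabulate (λ k → c (inj₂ (inc G e i) ∷ Vec.map inj₁ (from EV k)))) (to EV x) ≡
                   c (inj₂ (inc G e i) ∷ Vec.map inj₁ x)
        at i = trans (Vecₚ.lookup∘tabulate _ (to EV x)) (cong (λ z → c (inj₂ (inc G e i) ∷ Vec.map inj₁ z)) (from-to EV x))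
      base = replicate N zero
      normal : ∀ is → c (points (disjoint-sum H G) (inj₂ e ∷ Vec.map inj₁ es) is) ≡
                      c (inj₂ (inc G e zero) ∷ Vec.map inj₁ (points H es base))
      normal (i ∷ is) = trans (cong (λ z → c (inj₂ (inc G e i) ∷ z)) (points-left H G es is))
        (trans (first i zero (points H es is)) (es-mono is base))

-- The partite construction

record Typed (r t : ℕ) : Set₁ where
  field
    Vertex : Set
    vertex-enum : Enum Vertex
    Edge : Fin r → Vertex → Vertex → Set
    edge? : ∀ β x y → Dec (Edge β x y)
    edge-sym : ∀ {β x y} → Edge β x y → Edge β y x
    edge-irrefl : ∀ {β x} → ¬ Edge β x x
    edge-unique : ∀ {β β′ x y} → Edge β x y → Edge β′ x y → β ≡ β′
    clique-free : ∀ {β} (f : Fin t → Vertex) → ¬ (∀ {i j} → i ≢ j → Edge β (f i) (f j))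

open Typed public

-- The copy need not be induced. `π` assigns the types their colours; only a type without edges in
-- `L` can have the value `nothing`.
TypeHomogeneousCopy : ∀ {r t q} (L F : Typed r t) → (Vertex F → Vertex F → Fin q) → Set
TypeHomogeneousCopy {r} {q = q} L F χ =
  Σ[ ψ ∈ (Vertex L → Vertex F) ] Inj ψ × (∀ {β x y} → Edge L β x y → Edge F β (ψ x) (ψ y)) ×
  Σ[ π ∈ (Fin r → Maybe (Fin q)) ] (∀ {β x y} → Edge L β x y → just (χ (ψ x) (ψ y)) ≡ π β)

record PartiteTyped (r t N : ℕ) : Set₁ where
  field
    typed : Typed r t
    partₜ : Vertex typed → Fin N
    part-distinct : ∀ {β x y} → Edge typed β x y → partₜ x ≢ partₜ y

open PartiteTyped public

-- The partite step for the pair of parts (a, b) and type β: the edges of that kind are the letters of a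
-- Hales–Jewett cube whose points span the new parts a and b, and each line carries a copy of P.
module PartiteStep {r t N} (P : PartiteTyped r (3 + t) N) {a b : Fin N} (a≢b : a ≢ b) (β : Fin r) where
  private
    L = typed P
    W = Vertex L
    pos = partₜ P

  BetweenParts : W × W → Set
  BetweenParts (u , v) = pos u ≡ a × pos v ≡ b × Edge L β u v

  letters : List (Σ (W × W) BetweenParts)
  letters = decided {P = BetweenParts} (λ (u , v) → (pos u ≟ a) ×-dec (pos v ≟ b) ×-dec edge? L β u v) _,_
                    (elems (vertex-enum L ×-enum vertex-enum L))

  M : ℕ
  M = length letters

  src tgt : Fin M → W
  src f = proj₁ (proj₁ (lookup letters f))
  tgt f = proj₂ (proj₁ (lookup letters f))

  letter-between : ∀ f → BetweenParts (src f , tgt f)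
  letter-between f = proj₂ (lookup letters f)

  letter-complete : ∀ {u v} → BetweenParts (u , v) → ∃ λ f → src f ≡ u × tgt f ≡ v
  letter-complete {u} {v} p with decided-complete {P = BetweenParts}
    (λ (u , v) → (pos u ≟ a) ×-dec (pos v ≟ b) ×-dec edge? L β u v) _,_
    (complete (vertex-enum L ×-enum vertex-enum L) (u , v)) p
  ... | (p′ , q) = index q , cong (proj₁ ∘ proj₁) (sym (Anyₚ.lookup-index q)) ,
                             cong (proj₂ ∘ proj₁) (sym (Anyₚ.lookup-index q))

  place : (Fin M → W) → W → Maybe (Fin M) → W
  place s v nothing = v
  place s v (just f) = s f

  place-letter : ∀ (s : Fin M → W) f {k} (w : Vec (Maybe (Fin M)) k) → Vec.map (place s (s f)) w ≡ Vec.map s (fill f w)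
  place-letter s f [] = refl
  place-letter s f (nothing ∷ w) = cong (s f ∷_) (place-letter s f w)
  place-letter s f (just g ∷ w) = cong (s g ∷_) (place-letter s f w)

  module Cube (k : ℕ) where
    Line = Vec (Maybe (Fin M)) k
    V′ = Vec W k ⊎ Vec W k ⊎ (Line × W)

    V′-enum : Enum V′
    V′-enum = Vec-enum (vertex-enum L) k ⊎-enum Vec-enum (vertex-enum L) k ⊎-enum
              (Vec-enum (Maybe-enum (Fin-enum M)) k ×-enum vertex-enum L)

    -- On a moving coordinate a vertex of part `a` or `b` shows itself, on a fixed one the source or
    -- target of the prescribed edge. Hence the edge that is letter `f` lands on the cube point
    -- `fill f w`. All other vertices are copied separately for each line.
    copy : Line → W → V′
    copy w v = by-part (pos v ≟ a) (pos v ≟ b)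
      where
      by-part : Dec (pos v ≡ a) → Dec (pos v ≡ b) → V′
      by-part (yes _) _ = inj₁ (Vec.map (place src v) w)
      by-part (no _) (yes _) = inj₂ (inj₁ (Vec.map (place tgt v) w))
      by-part (no _) (no _) = inj₂ (inj₂ (w , v))

    copy-a : ∀ w {v} → pos v ≡ a → copy w v ≡ inj₁ (Vec.map (place src v) w)
    copy-a w {v} eq with pos v ≟ a
    ... | yes _ = refl
    ... | no ne = ⊥-elim (ne eq)

    copy-b : ∀ w {v} → pos v ≡ b → copy w v ≡ inj₂ (inj₁ (Vec.map (place tgt v) w))
    copy-b w {v} eq with pos v ≟ a | pos v ≟ b
    ... | yes eq′ | _ = ⊥-elim (a≢b (trans (sym eq′) eq))
    ... | no _ | yes _ = refl
    ... | no _ | no ne = ⊥-elim (ne eq)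

    copy-off : ∀ w {v} → pos v ≢ a → pos v ≢ b → copy w v ≡ inj₂ (inj₂ (w , v))
    copy-off w {v} na nb with pos v ≟ a | pos v ≟ b
    ... | yes eq | _ = ⊥-elim (na eq)
    ... | no _ | yes eq = ⊥-elim (nb eq)
    ... | no _ | no _ = refl

    part′ : V′ → Fin N
    part′ (inj₁ _) = a
    part′ (inj₂ (inj₁ _)) = b
    part′ (inj₂ (inj₂ (_ , v))) = pos v

    data Location (v : W) : Set where
      in-a : pos v ≡ a → Location v
      in-b : pos v ≡ b → Location v
      off  : pos v ≢ a → pos v ≢ b → Location v

    locate : ∀ v → Location v
    locate v with pos v ≟ a | pos v ≟ b
    ... | yes p | _ = in-a p
    ... | no _ | yes p = in-b p
    ... | no p | no q = off p q

    part-copy : ∀ w v → part′ (copy w v) ≡ pos v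
    part-copy w v with locate v
    ... | in-a p = trans (cong part′ (copy-a w p)) (sym p)
    ... | in-b p = trans (cong part′ (copy-b w p)) (sym p)
    ... | off p q = cong part′ (copy-off w p q)

    copy-part : ∀ {w w′ u u′} → copy w u ≡ copy w′ u′ → pos u ≡ pos u′
    copy-part {w} {w′} {u} {u′} eq = trans (sym (part-copy w u)) (trans (cong part′ eq) (part-copy w′ u′))

    place-at : ∀ {s : Fin M → W} {w w′ : Line} {u u′} → Vec.map (place s u) w ≡ Vec.map (place s u′) w′ →
      ∀ i → place s u (Vec.lookup w i) ≡ place s u′ (Vec.lookup w′ i)
    place-at {s} {w} {w′} {u} {u′} eq i =
      trans (sym (Vecₚ.lookup-map i (place s u) w)) (trans (cong (λ z → Vec.lookup z i) eq) (Vecₚ.lookup-map i (place s u′) w′))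

    at-a : ∀ {w w′ u u′} → pos u ≡ a → copy w u ≡ copy w′ u′ →
      ∀ i → place src u (Vec.lookup w i) ≡ place src u′ (Vec.lookup w′ i)
    at-a {w} {w′} p eq = place-at (inj₁-injective (trans (sym (copy-a w p))
      (trans eq (copy-a w′ (trans (sym (copy-part eq)) p)))))

    at-b : ∀ {w w′ u u′} → pos u ≡ b → copy w u ≡ copy w′ u′ →
      ∀ i → place tgt u (Vec.lookup w i) ≡ place tgt u′ (Vec.lookup w′ i)
    at-b {w} {w′} p eq = place-at (inj₁-injective (inj₂-injective (trans (sym (copy-b w p))
      (trans eq (copy-b w′ (trans (sym (copy-part eq)) p))))))

    at-off : ∀ {w w′ u u′} → pos u ≢ a → pos u ≢ b → copy w u ≡ copy w′ u′ → (w ≡ w′) × (u ≡ u′)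
    at-off {w} {w′} p q eq = cong proj₁ pair , cong proj₂ pair
      where
      pair = inj₂-injective (inj₂-injective (trans (sym (copy-off w p q))
        (trans eq (copy-off w′ (λ z → p (trans (copy-part eq) z)) (λ z → q (trans (copy-part eq) z))))))

    copy-injective : ∀ {w} → Moving w → Inj (copy w)
    copy-injective {w} (i , mov) {u} {v} eq with locate u
    ... | in-a p = subst (λ z → place src u z ≡ place src v z) mov (at-a p eq i)
    ... | in-b p = subst (λ z → place tgt u z ≡ place tgt v z) mov (at-b p eq i)
    ... | off p q = proj₂ (at-off p q eq)

    -- Compare the two lines first at a moving coordinate of w, then, if w′ is fixed there, at one of w′.
    transfer-ab : ∀ {w w′ u u′ v v′ θ} → Moving w → Moving w′ → pos u ≡ a → pos v ≡ b →
      copy w u ≡ copy w′ u′ → copy w v ≡ copy w′ v′ → Edge L θ u′ v′ → Edge L θ u v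
    transfer-ab {w} {w′} {u} {u′} {v} {v′} {θ} (i , mi) (j , mj) pu pv equ eqv e =
      first (Vec.lookup w′ i) (subst (λ z → place src u z ≡ place src u′ (Vec.lookup w′ i)) mi (at-a pu equ i))
                              (subst (λ z → place tgt v z ≡ place tgt v′ (Vec.lookup w′ i)) mi (at-b pv eqv i))
      where
      second : ∀ z → place src u z ≡ u′ → place tgt v z ≡ v′ → Edge L β u v → Edge L θ u v
      second nothing p q _ = subst₂ (Edge L θ) (sym p) (sym q) e
      second (just f) p q e′ = subst (λ τ → Edge L τ u v) (edge-unique L
        (subst₂ (Edge L β) p q (proj₂ (proj₂ (letter-between f)))) e) e′
      first : ∀ z → u ≡ place src u′ z → v ≡ place tgt v′ z → Edge L θ u v
      first nothing p q = subst₂ (Edge L θ) (sym p) (sym q) e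
      first (just f) p q = second (Vec.lookup w j)
        (subst (λ z → place src u (Vec.lookup w j) ≡ place src u′ z) mj (at-a pu equ j))
        (subst (λ z → place tgt v (Vec.lookup w j) ≡ place tgt v′ z) mj (at-b pv eqv j))
        (subst₂ (Edge L β) (sym p) (sym q) (proj₂ (proj₂ (letter-between f))))

    -- Any two copies agree on the edges between vertices that they share. Otherwise their union
    -- might give a pair two types or assemble a clique from several copies.
    transfer : ∀ {w w′ u u′ v v′ θ} → Moving w → Moving w′ →
      copy w u ≡ copy w′ u′ → copy w v ≡ copy w′ v′ → Edge L θ u′ v′ → Edge L θ u v
    transfer {w} {w′} {u} {u′} {v} {v′} {θ} mw mw′ equ eqv e with locate u | locate v
    ... | in-a p | in-b q = transfer-ab mw mw′ p q equ eqv e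
    ... | in-b p | in-a q = edge-sym L (transfer-ab mw mw′ q p eqv equ (edge-sym L e))
    ... | in-a p | in-a q = ⊥-elim (part-distinct P e (trans (sym (copy-part equ)) (trans p (trans (sym q) (copy-part eqv)))))
    ... | in-b p | in-b q = ⊥-elim (part-distinct P e (trans (sym (copy-part equ)) (trans p (trans (sym q) (copy-part eqv)))))
    ... | off p q | _ with at-off p q equ
    ...   | refl , refl with copy-injective mw eqv
    ...     | refl = e
    transfer mw mw′ equ eqv e | _ | off p q with at-off p q eqv
    ... | refl , refl with copy-injective mw equ
    ...   | refl = e

    Edge′ : Fin r → V′ → V′ → Set
    Edge′ θ x y = ∃ λ w → Moving w × ∃ λ u → ∃ λ v → x ≡ copy w u × y ≡ copy w v × Edge L θ u v

    moving? : ∀ (w : Line) → Dec (Moving w)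
    moving? w = Finₚ.any? λ i → dec-≡ (Maybe-enum (Fin-enum M)) (Vec.lookup w i) nothing

    edge′? : ∀ θ x y → Dec (Edge′ θ x y)
    edge′? θ x y = ∃? (Vec-enum (Maybe-enum (Fin-enum M)) k) λ w → moving? w ×-dec
      ∃? (vertex-enum L) λ u → ∃? (vertex-enum L) λ v →
      dec-≡ V′-enum x (copy w u) ×-dec dec-≡ V′-enum y (copy w v) ×-dec edge? L θ u v

    edge′-distinct : ∀ {θ x y} → Edge′ θ x y → part′ x ≢ part′ y
    edge′-distinct (w , _ , u , v , refl , refl , e) eq =
      part-distinct P e (trans (sym (part-copy w u)) (trans eq (part-copy w v)))

    edge′-unique : ∀ {θ θ′ x y} → Edge′ θ x y → Edge′ θ′ x y → θ ≡ θ′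
    edge′-unique (w , mw , u , v , refl , refl , e) (w′ , mw′ , u′ , v′ , p , q , e′) =
      edge-unique L e (transfer mw mw′ p q e′)

    -- A clique has at most one vertex in each of the parts `a` and `b`, and at least three
    -- vertices, so one lies elsewhere. That vertex belongs to a single copy, which therefore
    -- contains the whole clique, and `transfer` moves it into `P`.
    clique′-free : ∀ {θ} (f : Fin (3 + t) → V′) → ¬ (∀ {i j} → i ≢ j → Edge′ θ (f i) (f j))
    clique′-free {θ} f cl = from-off off-vertex
      where
      Off : V′ → Set
      Off x = part′ x ≢ a × part′ x ≢ b
      off-vertex : ∃ λ i → Off (f i)
      off-vertex with Finₚ.any? (λ i → ¬? (part′ (f i) ≟ a) ×-dec ¬? (part′ (f i) ≟ b))
      ... | yes p = p
      ... | no ¬p = ⊥-elim (two (side i₀) (side i₁) (side i₂))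
        where
        i₀ i₁ i₂ : Fin (3 + t)
        i₀ = zero
        i₁ = suc zero
        i₂ = suc (suc zero)
        side : ∀ i → part′ (f i) ≡ a ⊎ part′ (f i) ≡ b
        side i with part′ (f i) ≟ a | part′ (f i) ≟ b
        ... | yes p | _ = inj₁ p
        ... | no _ | yes p = inj₂ p
        ... | no p | no q = ⊥-elim (¬p (i , p , q))
        clash : ∀ {i j c} → i ≢ j → part′ (f i) ≡ c → part′ (f j) ≡ c → ⊥
        clash ne p q = edge′-distinct (cl ne) (trans p (sym q))
        two : (part′ (f i₀) ≡ a ⊎ part′ (f i₀) ≡ b) → (part′ (f i₁) ≡ a ⊎ part′ (f i₁) ≡ b) →
              (part′ (f i₂) ≡ a ⊎ part′ (f i₂) ≡ b) → ⊥
        two (inj₁ p) (inj₁ q) _ = clash (λ ()) p q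
        two (inj₂ p) (inj₂ q) _ = clash (λ ()) p q
        two (inj₁ p) (inj₂ q) (inj₁ s) = clash (λ ()) p s
        two (inj₁ p) (inj₂ q) (inj₂ s) = clash (λ ()) q s
        two (inj₂ p) (inj₁ q) (inj₂ s) = clash (λ ()) p s
        two (inj₂ p) (inj₁ q) (inj₁ s) = clash (λ ()) q s
      other : ∀ (i : Fin (3 + t)) → ∃ λ j → i ≢ j
      other zero = suc zero , λ ()
      other (suc _) = zero , λ ()
      from-off : (∃ λ i → Off (f i)) → ⊥
      from-off (k₀ , na , nb) with other k₀
      ... | (j₀ , ne₀) with cl ne₀
      ... | (w , mw , u , _ , equ , _ , _) = clique-free L (proj₁ ∘ lift) edges
        where
        nua : pos u ≢ a
        nua p = na (trans (cong part′ equ) (trans (part-copy w u) p))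
        nub : pos u ≢ b
        nub p = nb (trans (cong part′ equ) (trans (part-copy w u) p))
        lift : ∀ j → ∃ λ v → f j ≡ copy w v
        lift j with k₀ ≟ j
        ... | yes refl = u , equ
        ... | no ne with cl ne
        ...   | (w′ , _ , u′ , v′ , p , q , _) with at-off nua nub (trans (sym equ) p)
        ...     | refl , refl = v′ , q
        edges : ∀ {i j} → i ≢ j → Edge L θ (proj₁ (lift i)) (proj₁ (lift j))
        edges {i} {j} ne with cl ne
        ... | (w′ , mw′ , u′ , v′ , p , q , e) =
          transfer mw mw′ (trans (sym (proj₂ (lift i))) p) (trans (sym (proj₂ (lift j))) q) e

    result : PartiteTyped r (3 + t) N
    result = record
      { typed = record
          { Vertex = V′ ; vertex-enum = V′-enum ; Edge = Edge′ ; edge? = edge′?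
          ; edge-sym = λ (w , mw , u , v , p , q , e) → w , mw , v , u , q , p , edge-sym L e
          ; edge-irrefl = λ e → edge′-distinct e refl
          ; edge-unique = edge′-unique ; clique-free = clique′-free }
      ; partₜ = part′ ; part-distinct = edge′-distinct }

    -- A word of letters names a vertex of the new part `a` and one of the new part `b`, so a
    -- colouring of pairs is a colouring of the cube. A monochromatic line carries a copy in which
    -- all edges of this kind agree.
    homogeneous-copy : ∀ {q} → (∀ (χ : Vec (Fin M) k → Fin q) → Monochromatic χ) → (χ : V′ → V′ → Fin q) →
      ∃ λ w → Moving w × (∀ {u v u′ v′} → BetweenParts (u , v) → BetweenParts (u′ , v′) →
        χ (copy w u) (copy w v) ≡ χ (copy w u′) (copy w v′))
    homogeneous-copy hj χ with hj (λ z → χ (inj₁ (Vec.map src z)) (inj₂ (inj₁ (Vec.map tgt z))))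
    ... | (w , mw , mono) = w , mw , same
      where
      value : ∀ f → χ (copy w (src f)) (copy w (tgt f)) ≡
                    χ (inj₁ (Vec.map src (fill f w))) (inj₂ (inj₁ (Vec.map tgt (fill f w))))
      value f = cong₂ χ (trans (copy-a w (proj₁ (letter-between f))) (cong inj₁ (place-letter src f w)))
        (trans (copy-b w (proj₁ (proj₂ (letter-between f)))) (cong (inj₂ ∘ inj₁) (place-letter tgt f w)))
      same : ∀ {u v u′ v′} → BetweenParts (u , v) → BetweenParts (u′ , v′) →
        χ (copy w u) (copy w v) ≡ χ (copy w u′) (copy w v′)
      same p p′ with letter-complete p | letter-complete p′
      ... | (f , refl , refl) | (f′ , refl , refl) = trans (value f) (trans (mono f f′) (sym (value f′)))

module PartiteConstruction {r t q : ℕ} (L : Typed r (3 + t)) (N : ℕ)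
  (ramsey : ∀ (g : Fin N → Fin N → Vec (Maybe (Fin q)) r) →
    Σ[ η ∈ (Fin (size (vertex-enum L)) → Fin N) ] Increasing η × Σ[ c ∈ Vec (Maybe (Fin q)) r ]
      (∀ {x y} → x <ᶠ y → g (η x) (η y) ≡ c)) where
  private
    l = size (vertex-enum L)
    ix = to (vertex-enum L)
    W₀ = Vec (Fin N) l × Vertex L

  -- A disjoint copy of `L` for every map of its vertices to the parts, injective or not; edges that
  -- would fall inside a part are left out.
  placements : PartiteTyped r (3 + t) N
  placements = record
    { typed = record
        { Vertex = W₀ ; vertex-enum = Vec-enum (Fin-enum N) l ×-enum vertex-enum L
        ; Edge = λ β (η , x) (η′ , y) → η ≡ η′ × Edge L β x y × Vec.lookup η (ix x) ≢ Vec.lookup η′ (ix y)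
        ; edge? = λ β (η , x) (η′ , y) → dec-≡ (Vec-enum (Fin-enum N) l) η η′ ×-dec edge? L β x y ×-dec
            ¬? (Vec.lookup η (ix x) ≟ Vec.lookup η′ (ix y))
        ; edge-sym = λ (p , e , ne) → sym p , edge-sym L e , ne ∘ sym
        ; edge-irrefl = λ (_ , e , _) → edge-irrefl L e
        ; edge-unique = λ (_ , e , _) (_ , e′ , _) → edge-unique L e e′
        ; clique-free = λ f cl → clique-free L (proj₂ ∘ f) (λ ne → proj₁ (proj₂ (cl ne))) }
    ; partₜ = λ (η , x) → Vec.lookup η (ix x)
    ; part-distinct = λ (_ , _ , ne) → ne }

  private
    P₀ = placements
    T₀ = typed P₀

  Triple : Set
  Triple = (Fin N × Fin N) × Fin r

  OfKind : Triple → W₀ → W₀ → Set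
  OfKind ((a , b) , β) u v = partₜ P₀ u ≡ a × partₜ P₀ v ≡ b × Edge T₀ β u v

  HomogeneousOn : List Triple → (P : PartiteTyped r (3 + t) N) →
    (Vertex (typed P) → Vertex (typed P) → Fin q) → Set
  HomogeneousOn ts P χ = Σ[ f ∈ (W₀ → Vertex (typed P)) ]
    (∀ v → partₜ P (f v) ≡ partₜ P₀ v) ×
    (∀ {β u v} → Edge T₀ β u v → Edge (typed P) β (f u) (f v)) ×
    (∀ {τ u v u′ v′} → τ ∈ ts → OfKind τ u v → OfKind τ u′ v′ → χ (f u) (f v) ≡ χ (f u′) (f v′))

  record Stage (ts : List Triple) : Set₁ where
    field
      P : PartiteTyped r (3 + t) N
      embed : ∀ χ → HomogeneousOn ts P χ

  stage : ∀ ts → Stage ts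
  stage [] = record { P = P₀ ; embed = λ χ → id , (λ _ → refl) , (λ e → e) , λ () }
  stage (((a , b) , β) ∷ ts) with stage ts | a ≟ b
  ... | S | yes refl = record { P = Stage.P S ; embed = embed′ }
    where
    embed′ : ∀ χ → HomogeneousOn (((a , a) , β) ∷ ts) (Stage.P S) χ
    embed′ χ with Stage.embed S χ
    ... | (f , f-part , f-edge , f-mono) = f , f-part , (λ {θ} {u} {v} → f-edge {θ} {u} {v}) ,
      λ { (here refl) (p , p′ , e) _ → ⊥-elim (part-distinct P₀ e (trans p (sym p′)))
        ; (there τ∈) p p′ → f-mono τ∈ p p′ }
  ... | S | no a≢b with hales-jewett (PartiteStep.M (Stage.P S) a≢b β) (Fin-enum q)
  ... | (k , hj) = record { P = result ; embed = embed′ }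
    where
    open Stage S
    open PartiteStep P a≢b β
    open Cube k
    embed′ : ∀ χ → HomogeneousOn (((a , b) , β) ∷ ts) (Cube.result k) χ
    embed′ χ with homogeneous-copy hj χ
    ... | (w , mw , same) with embed (λ x y → χ (copy w x) (copy w y))
    ... | (f , f-part , f-edge , f-mono) = copy w ∘ f ,
      (λ v → trans (part-copy w (f v)) (f-part v)) ,
      (λ {_} {u} {v} e → w , mw , f u , f v , refl , refl , f-edge e) ,
      λ { {u = u} {v} {u′} {v′} (here refl) (p , p′ , e) (s , s′ , e′) →
            same (trans (f-part u) p , trans (f-part v) p′ , f-edge e)
                 (trans (f-part u′) s , trans (f-part v′) s′ , f-edge e′)
        ; (there τ∈) p p′ → f-mono τ∈ p p′ }

  all-triples : Enum Triple
  all-triples = (Fin-enum N ×-enum Fin-enum N) ×-enum Fin-enum r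

  final : Stage (elems all-triples)
  final = stage (elems all-triples)

  result : Typed r (3 + t)
  result = typed (Stage.P final)

  homogeneous : ∀ (χ : Vertex result → Vertex result → Fin q) → (∀ x y → χ x y ≡ χ y x) →
    TypeHomogeneousCopy L result χ
  homogeneous χ χ-sym = go (Stage.embed final χ)
    where
    go : HomogeneousOn (elems all-triples) (Stage.P final) χ → TypeHomogeneousCopy L result χ
    -- The colour of an edge now depends on its type and its two parts. A pair of parts is coloured
    -- by the list of these colours over all types, and Ramsey's theorem for pairs removes the
    -- dependence on the parts.
    go (f , f-part , f-edge , f-mono) = by-ramsey (ramsey (λ a b → tabulate (λ β → kind-colour ((a , b) , β) (kind? _))))
      where
      kind? : ∀ τ → Dec (∃ λ (uv : W₀ × W₀) → OfKind τ (proj₁ uv) (proj₂ uv))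
      kind? ((a , b) , β) = ∃? (vertex-enum T₀ ×-enum vertex-enum T₀) λ (u , v) →
        (partₜ P₀ u ≟ a) ×-dec (partₜ P₀ v ≟ b) ×-dec edge? T₀ β u v
      kind-colour : ∀ τ → Dec (∃ λ (uv : W₀ × W₀) → OfKind τ (proj₁ uv) (proj₂ uv)) → Maybe (Fin q)
      kind-colour τ (yes ((u , v) , _)) = just (χ (f u) (f v))
      kind-colour τ (no _) = nothing
      kind-correct : ∀ {τ u v} (d : Dec (∃ λ (uv : W₀ × W₀) → OfKind τ (proj₁ uv) (proj₂ uv))) → OfKind τ u v →
        kind-colour τ d ≡ just (χ (f u) (f v))
      kind-correct {τ} (yes (_ , p)) p′ = cong just (f-mono (complete all-triples τ) p p′)
      kind-correct {u = u} {v} (no ¬p) p = ⊥-elim (¬p ((u , v) , p))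
      by-ramsey : Σ[ η ∈ (Fin l → Fin N) ] Increasing η × Σ[ c ∈ Vec (Maybe (Fin q)) r ]
        (∀ {x y} → x <ᶠ y → tabulate (λ β → kind-colour ((η x , η y) , β) (kind? _)) ≡ c) → TypeHomogeneousCopy L result χ
      by-ramsey (η , η-inc , c , mono) = ψ , ψ-inj , (λ e → f-edge (lift e)) , Vec.lookup c , colour
        where
        η̂ = tabulate η
        ψ : Vertex L → Vertex result
        ψ x = f (η̂ , x)
        η-at : ∀ x → Vec.lookup η̂ (ix x) ≡ η (ix x)
        η-at x = Vecₚ.lookup∘tabulate η (ix x)
        separate : ∀ {x y} → Vec.lookup η̂ (ix x) ≡ Vec.lookup η̂ (ix y) → x ≡ y
        separate {x} {y} eq = to-injective (vertex-enum L) (increasing⇒injective η η-inc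
          (trans (sym (η-at x)) (trans eq (η-at y))))
        ψ-inj : Inj ψ
        ψ-inj {x} {y} eq = separate (trans (sym (f-part _)) (trans (cong (partₜ (Stage.P final)) eq) (f-part _)))
        lift : ∀ {β x y} → Edge L β x y → Edge T₀ β (η̂ , x) (η̂ , y)
        lift {β} {x} e = refl , e , λ eq → edge-irrefl L (subst (Edge L β x) (sym (separate eq)) e)
        ordered : ∀ {β x y} → Edge L β x y → ix x <ᶠ ix y → just (χ (ψ x) (ψ y)) ≡ Vec.lookup c β
        ordered {β} {x} {y} e lt = trans (sym (kind-correct (kind? ((η (ix x) , η (ix y)) , β)) (η-at x , η-at y , lift e)))
          (trans (sym (Vecₚ.lookup∘tabulate (λ β → kind-colour ((η (ix x) , η (ix y)) , β) (kind? _)) β))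
                 (cong (λ z → Vec.lookup z β) (mono lt)))
        colour : ∀ {β x y} → Edge L β x y → just (χ (ψ x) (ψ y)) ≡ Vec.lookup c β
        colour {β} {x} {y} e with ℕₚ.<-cmp (toℕ (ix x)) (toℕ (ix y))
        ... | tri< lt _ _ = ordered e lt
        ... | tri> _ _ gt = trans (cong just (χ-sym _ _)) (ordered (edge-sym L e) gt)
        ... | tri≈ _ ≈ _ = ⊥-elim (edge-irrefl L (subst (Edge L β x)
                (sym (to-injective (vertex-enum L) (Finₚ.toℕ-injective ≈))) e))

typed-ramsey : ∀ {r t} (L : Typed r (3 + t)) q → Σ[ F ∈ Typed r (3 + t) ]
  (∀ (χ : Vertex F → Vertex F → Fin q) → (∀ x y → χ x y ≡ χ y x) → TypeHomogeneousCopy L F χ)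
typed-ramsey {r} L q =
  let (N , ramsey) = ramsey-pairs (Vec-enum (Maybe-enum (Fin-enum q)) r) (size (vertex-enum L)) in
  PartiteConstruction.result {q = q} L N ramsey , PartiteConstruction.homogeneous {q = q} L N ramsey

-- Cycles, colourings and Ramsey-minimal subgraphs

module Cycle (m : ℕ) where
  ℓ = suc m

  at : ℕ → Fin ℓ
  at k = k mod ℓ

  next prev : Fin ℓ → Fin ℓ
  next i = at (suc (toℕ i))
  prev i = at (toℕ i + m)

  toℕ-at : ∀ k → toℕ (at k) ≡ k % ℓ
  toℕ-at k = Finₚ.toℕ-fromℕ< (m%n<n k ℓ)

  at-toℕ : ∀ i → at (toℕ i) ≡ i
  at-toℕ i = Finₚ.toℕ-injective (trans (toℕ-at (toℕ i)) (m<n⇒m%n≡m (Finₚ.toℕ<n i)))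

  at-+ : ∀ j k → at (toℕ (at j) + k) ≡ at (j + k)
  at-+ j k = Finₚ.toℕ-injective (trans (toℕ-at (toℕ (at j) + k)) (trans eq (sym (toℕ-at (j + k)))))
    where
    open ≡-Reasoning
    eq : (toℕ (at j) + k) % ℓ ≡ (j + k) % ℓ
    eq = begin
      (toℕ (at j) + k) % ℓ              ≡⟨ cong (λ z → (z + k) % ℓ) (toℕ-at j) ⟩
      (j % ℓ + k) % ℓ                   ≡⟨ %-distribˡ-+ (j % ℓ) k ℓ ⟩
      (j % ℓ % ℓ + k % ℓ) % ℓ           ≡⟨ cong (λ z → (z + k % ℓ) % ℓ) (m%n%n≡m%n j ℓ) ⟩
      (j % ℓ + k % ℓ) % ℓ               ≡⟨ sym (%-distribˡ-+ j k ℓ) ⟩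
      (j + k) % ℓ                       ∎

  at-suc : ∀ k → next (at k) ≡ at (suc k)
  at-suc k = trans (cong at (ℕₚ.+-comm 1 (toℕ (at k)))) (trans (at-+ k 1) (cong at (ℕₚ.+-comm k 1)))

  next-prev : ∀ i → next (prev i) ≡ i
  next-prev i = trans (at-suc (toℕ i + m)) (trans (Finₚ.toℕ-injective eq) (at-toℕ i))
    where
    eq : toℕ (at (suc (toℕ i + m))) ≡ toℕ (at (toℕ i))
    eq = trans (toℕ-at (suc (toℕ i + m))) (trans (cong (_% ℓ) (sym (ℕₚ.+-suc (toℕ i) m)))
      (trans ([m+n]%n≡m%n (toℕ i) ℓ) (sym (toℕ-at (toℕ i)))))

  prev-next : ∀ i → prev (next i) ≡ i
  prev-next i = trans (at-+ (suc (toℕ i)) m) (trans (sym (at-suc (toℕ i + m))) (next-prev i))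

  next-injective : Inj next
  next-injective {i} {j} eq = trans (sym (prev-next i)) (trans (cong prev eq) (prev-next j))

  shift-≢ : ∀ (i : Fin ℓ) {δ} → 0 < δ → δ < ℓ → at (toℕ i + δ) ≢ i
  shift-≢ i {δ} 0<δ δ<ℓ eq with toℕ i + δ <? ℓ
  ... | yes lt = ℕₚ.<⇒≢ (ℕₚ.m<m+n (toℕ i) 0<δ)
    (sym (trans (sym (m<n⇒m%n≡m lt)) (trans (sym (toℕ-at (toℕ i + δ))) (cong toℕ eq))))
  ... | no ge = ℕₚ.<⇒≢ small (trans (sym value) (cong toℕ eq))
    where
    ℓ≤ : ℓ ≤ toℕ i + δ
    ℓ≤ = ℕₚ.≮⇒≥ ge
    small : toℕ i + δ ∸ ℓ < toℕ i
    small = ℕₚ.+-cancelʳ-< ℓ _ _ (subst (_< toℕ i + ℓ) (sym (ℕₚ.m∸n+n≡m ℓ≤)) (ℕₚ.+-monoʳ-< (toℕ i) δ<ℓ))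
    value : toℕ (at (toℕ i + δ)) ≡ toℕ i + δ ∸ ℓ
    value = trans (toℕ-at (toℕ i + δ)) (trans (sym (m≤n⇒[n∸m]%m≡n%m ℓ≤))
      (m<n⇒m%n≡m (ℕₚ.<-trans small (Finₚ.toℕ<n i))))

  at-distinct : ∀ {j k} → j < k → k < j + ℓ → at j ≢ at k
  at-distinct {j} {k} j<k k<j+ℓ eq = shift-≢ (at j) {k ∸ j} (ℕₚ.m<n⇒0<n∸m j<k)
    (ℕₚ.+-cancelˡ-< j _ _ (subst (_< j + ℓ) (sym j+) k<j+ℓ))
    (trans (at-+ j (k ∸ j)) (trans (cong at j+) (sym eq)))
    where
    j+ : j + (k ∸ j) ≡ k
    j+ = ℕₚ.m+[n∸m]≡n (ℕₚ.<⇒≤ j<k)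

  next^ : ∀ (i : Fin ℓ) k → at (toℕ i + suc k) ≡ next (at (toℕ i + k))
  next^ i k = trans {j = at (suc (toℕ i + k))} (cong at (ℕₚ.+-suc (toℕ i) k)) (sym (at-suc (toℕ i + k)))

  at-0 : ∀ (i : Fin ℓ) → at (toℕ i + 0) ≡ i
  at-0 i = trans (cong at (ℕₚ.+-identityʳ (toℕ i))) (at-toℕ i)

  next-1 : ∀ (i : Fin ℓ) → at (toℕ i + 1) ≡ next i
  next-1 i = trans {j = next (at (toℕ i + 0))} (next^ i 0) (cong next (at-0 i))

  next-2 : ∀ (i : Fin ℓ) → at (toℕ i + 2) ≡ next (next i)
  next-2 i = trans {j = next (at (toℕ i + 1))} (next^ i 1) (cong next (next-1 i))

  next-3 : ∀ (i : Fin ℓ) → at (toℕ i + 3) ≡ next (next (next i))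
  next-3 i = trans {j = next (at (toℕ i + 2))} (next^ i 2) (cong next (next-2 i))

  next≢ : 2 ≤ ℓ → ∀ i → next i ≢ i
  next≢ 2≤ℓ i eq = shift-≢ i {1} (s≤s z≤n) 2≤ℓ (trans (next-1 i) eq)

  next²≢ : 3 ≤ ℓ → ∀ i → next (next i) ≢ i
  next²≢ 3≤ℓ i eq = shift-≢ i {2} (s≤s z≤n) 3≤ℓ (trans (next-2 i) eq)

  next³≢ : 4 ≤ ℓ → ∀ i → next (next (next i)) ≢ i
  next³≢ 4≤ℓ i eq = shift-≢ i {3} (s≤s z≤n) 4≤ℓ (trans (next-3 i) eq)

  constant-on-cycle : ∀ {A : Set} (f : Fin ℓ → A) → (∀ i → f i ≡ f (next i)) → ∀ i → f i ≡ f zero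
  constant-on-cycle f h i = trans (cong f (sym (at-toℕ i))) (go (toℕ i))
    where
    go : ∀ k → f (at k) ≡ f zero
    go zero = refl
    go (suc k) = trans (cong f (sym (at-suc k))) (trans (sym (h (at k))) (go k))

∨-true : ∀ a {b} → (a ∨ b) ≡ true → a ≡ true ⊎ b ≡ true
∨-true true _ = inj₁ refl
∨-true false eq = inj₂ eq

∧-true : ∀ a {b} → (a ∧ b) ≡ true → a ≡ true × b ≡ true
∧-true true eq = refl , eq

∨-trueˡ : ∀ {a} b → a ≡ true → (a ∨ b) ≡ true
∨-trueˡ b refl = refl

∨-trueʳ : ∀ a {b} → b ≡ true → (a ∨ b) ≡ true
∨-trueʳ true _ = refl
∨-trueʳ false eq = eq

≡ᵇ-true : ∀ j k → (j Data.Nat.≡ᵇ k) ≡ true → j ≡ k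
≡ᵇ-true j k eq = ℕₚ.≡ᵇ⇒≡ j k (subst T (sym eq) tt)

≡ᵇ-refl : ∀ j → (j Data.Nat.≡ᵇ j) ≡ true
≡ᵇ-refl zero = refl
≡ᵇ-refl (suc j) = ≡ᵇ-refl j

not-≟ : ∀ {k} {i j : Fin k} → i ≢ j → not ⌊ i ≟ j ⌋ ≡ true
not-≟ {i = i} {j} ne with i ≟ j
... | yes eq = ⊥-elim (ne eq)
... | no _ = refl

adj⇒≢ : ∀ (G : Graph) {u v} → adj G u v ≡ true → u ≢ v
adj⇒≢ G {u} eq refl with trans (sym eq) (adj-irref G u)
... | ()

K-adj : ∀ {t} {i j : Fin t} → i ≢ j → adj (K t) i j ≡ true
K-adj = not-≟

cyclic-arc : ∀ {ℓ} → Fin ℓ → Fin ℓ → Bool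
cyclic-arc {ℓ} i j = (toℕ j Data.Nat.≡ᵇ suc (toℕ i)) ∨ ((suc (toℕ i) Data.Nat.≡ᵇ ℓ) ∧ (toℕ j Data.Nat.≡ᵇ 0))

module _ {m : ℕ} where
  open Cycle m

  arc⇒next : ∀ i j → cyclic-arc i j ≡ true → j ≡ next i
  arc⇒next i j p with ∨-true (toℕ j Data.Nat.≡ᵇ suc (toℕ i)) p
  ... | inj₁ q = trans (sym (at-toℕ j)) (cong at (≡ᵇ-true (toℕ j) (suc (toℕ i)) q))
  ... | inj₂ q with ∧-true (suc (toℕ i) Data.Nat.≡ᵇ ℓ) q
  ...   | (a , b) = Finₚ.toℕ-injective (trans (≡ᵇ-true (toℕ j) 0 b) (sym (trans (toℕ-at (suc (toℕ i)))
            (trans (cong (_% ℓ) (≡ᵇ-true (suc (toℕ i)) ℓ a)) (n%n≡0 ℓ)))))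

  next-arc : ∀ i → cyclic-arc i (next i) ≡ true
  next-arc i with ℕₚ.m≤n⇒m<n∨m≡n (Finₚ.toℕ<n i)
  ... | inj₁ lt = ∨-trueˡ _ (subst (λ z → (z Data.Nat.≡ᵇ suc (toℕ i)) ≡ true)
                    (sym (trans (toℕ-at (suc (toℕ i))) (m<n⇒m%n≡m lt))) (≡ᵇ-refl (suc (toℕ i))))
  ... | inj₂ eq = ∨-trueʳ (toℕ (next i) Data.Nat.≡ᵇ suc (toℕ i)) (cong₂ _∧_
        (subst (λ z → (z Data.Nat.≡ᵇ ℓ) ≡ true) (sym eq) (≡ᵇ-refl ℓ))
        (subst (λ z → (z Data.Nat.≡ᵇ 0) ≡ true)
           (sym (trans (toℕ-at (suc (toℕ i))) (trans (cong (_% ℓ) eq) (n%n≡0 ℓ)))) refl))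

  C-adj⇒next : ∀ {i j} → adj (C ℓ) i j ≡ true → j ≡ next i ⊎ i ≡ next j
  C-adj⇒next {i} {j} eq with ∨-true (cyclic-arc i j) (proj₁ (∧-true (cyclic-arc i j ∨ cyclic-arc j i) eq))
  ... | inj₁ p = inj₁ (arc⇒next i j p)
  ... | inj₂ p = inj₂ (arc⇒next j i p)

  C-adj-next : 2 ≤ ℓ → ∀ i → adj (C ℓ) i (next i) ≡ true
  C-adj-next 2≤ℓ i = cong₂ _∧_ (∨-trueˡ (cyclic-arc (next i) i) (next-arc i)) (not-≟ (next≢ 2≤ℓ i ∘ sym))

  cycle-copy : ∀ (G : Graph) {q} (c : Colouring G q) k (f : Fin ℓ → Fin (n G)) → Inj f →
    (∀ i → adj G (f i) (f (next i)) ≡ true × col c (f i) (f (next i)) ≡ k) → MonoCopy (C ℓ) G c k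
  cycle-copy G c k f f-inj h = f , f-inj , edges
    where
    edges : ∀ x y → adj (C ℓ) x y ≡ true → adj G (f x) (f y) ≡ true × col c (f x) (f y) ≡ k
    edges x y a with C-adj⇒next {x} {y} a
    ... | inj₁ refl = h x
    ... | inj₂ refl = trans (adj-sym G _ _) (proj₁ (h y)) , trans (col-sym c _ _) (proj₂ (h y))

clique-copy : ∀ {t} (G : Graph) {q} (c : Colouring G q) k (f : Fin t → Fin (n G)) →
  (∀ {i j} → i ≢ j → adj G (f i) (f j) ≡ true × col c (f i) (f j) ≡ k) → MonoCopy (K t) G c k
clique-copy {t} G c k f h = f , f-inj , λ x y a → h (adj⇒≢ (K t) a)
  where
  f-inj : Inj f
  f-inj {x} {y} eq with x ≟ y
  ... | yes p = p
  ... | no ne = ⊥-elim (adj⇒≢ G (proj₁ (h ne)) eq)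

mono-resp : ∀ (H G : Graph) {q} {c c′ : Colouring G q} {k} → (∀ u v → col c u v ≡ col c′ u v) →
  MonoCopy H G c k → MonoCopy H G c′ k
mono-resp H G eq (f , f-inj , h) = f , f-inj , λ x y a → proj₁ (h x y a) , trans (sym (eq _ _)) (proj₂ (h x y a))

mono? : ∀ (H G : Graph) {q} (c : Colouring G q) k → Dec (MonoCopy H G c k)
mono? H G c k = ∃-function? (Fin-enum (n G))
  (λ {f} {g} eq (f-inj , h) → (λ {x} {y} e → f-inj (trans (eq x) (trans e (sym (eq y))))) ,
     λ x y a → subst₂ (λ u v → adj G u v ≡ true × col c u v ≡ k) (eq x) (eq y) (h x y a))
  (λ f → injective? (Fin-enum (n G)) f ×-dec ∀? (Fin-enum (n H)) λ x → ∀? (Fin-enum (n H)) λ y →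
     (adj H x y Data.Bool.≟ true) →-dec ((adj G (f x) (f y) Data.Bool.≟ true) ×-dec (col c (f x) (f y) ≟ k)))

-- The search for colourings runs over arbitrary matrices; reading only one triangle turns each of
-- them into a colouring and keeps the symmetric ones.
symmetrise : ∀ {m} {A : Set} → (Fin m → Fin m → A) → Fin m → Fin m → A
symmetrise s u v with toℕ u ≤? toℕ v
... | yes _ = s u v
... | no _ = s v u

symmetrise-sym : ∀ {m} {A : Set} (s : Fin m → Fin m → A) u v → symmetrise s u v ≡ symmetrise s v u
symmetrise-sym s u v with toℕ u ≤? toℕ v | toℕ v ≤? toℕ u
... | yes p | yes q = cong₂ s eq (sym eq)
  where eq = Finₚ.toℕ-injective (ℕₚ.≤-antisym p q)
... | yes _ | no _ = refl
... | no _ | yes _ = refl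
... | no p | no q = ⊥-elim (q (ℕₚ.<⇒≤ (ℕₚ.≰⇒> p)))

symmetrise-either : ∀ {m} {A : Set} (s : Fin m → Fin m → A) u v → symmetrise s u v ≡ s u v ⊎ symmetrise s u v ≡ s v u
symmetrise-either s u v with toℕ u ≤? toℕ v
... | yes _ = inj₁ refl
... | no _ = inj₂ refl

symmetrise-id : ∀ {m} {A : Set} (s : Fin m → Fin m → A) → (∀ u v → s u v ≡ s v u) → ∀ u v → s u v ≡ symmetrise s u v
symmetrise-id s s-sym u v with symmetrise-either s u v
... | inj₁ eq = sym eq
... | inj₂ eq = trans (s-sym u v) (sym eq)

symmetrise-resp : ∀ {m} {A : Set} {s s′ : Fin m → Fin m → A} → (∀ u v → s u v ≡ s′ u v) →
  ∀ u v → symmetrise s u v ≡ symmetrise s′ u v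
symmetrise-resp eq u v with toℕ u ≤? toℕ v
... | yes _ = eq u v
... | no _ = eq v u

colouring : ∀ (G : Graph) {q} → (Fin (n G) → Fin (n G) → Fin q) → Colouring G q
colouring G s = record { col = symmetrise s ; col-sym = symmetrise-sym s }

GoodColouring : ∀ q → (Fin q → Graph) → Graph → Set
GoodColouring q Hs G = Σ[ c ∈ Colouring G q ] (∀ k → ¬ MonoCopy (Hs k) G c k)

-- Finite search yields more than decidability: when the Ramsey property fails, a good colouring is
-- at hand as data, from which the pattern on a neighbourhood is read off.
ramsey-or-good : ∀ q (Hs : Fin q → Graph) G → IsRamsey q Hs G ⊎ GoodColouring q Hs G
ramsey-or-good q Hs G with ∃-matrix? (Fin-enum q)
  {P = λ s → ∀ k → ¬ MonoCopy (Hs k) G (colouring G s) k}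
  (λ {s} {s′} eq h k M → h k (mono-resp (Hs k) G {c = colouring G s′} {c′ = colouring G s} (λ u v → sym (symmetrise-resp eq u v)) M))
  (λ s → ∀? (Fin-enum q) λ k → ¬? (mono? (Hs k) G (colouring G s) k))
... | yes (s , h) = inj₂ (colouring G s , h)
... | no none = inj₁ ramsey
  where
  ramsey : IsRamsey q Hs G
  ramsey c with Finₚ.any? (λ k → mono? (Hs k) G c k)
  ... | yes p = p
  ... | no ¬p = ⊥-elim (none (col c , λ k M → ¬p (k , mono-resp (Hs k) G {c = colouring G (col c)} {c′ = c}
          (λ u v → sym (symmetrise-id (col c) (col-sym c) u v)) M)))

good⇒¬ramsey : ∀ {q} {Hs : Fin q → Graph} {G} → GoodColouring q Hs G → ¬ IsRamsey q Hs G
good⇒¬ramsey (c , h) R = let (k , M) = R c in h k M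

ramsey? : ∀ q (Hs : Fin q → Graph) G → Dec (IsRamsey q Hs G)
ramsey? q Hs G with ramsey-or-good q Hs G
... | inj₁ R = yes R
... | inj₂ good = no (good⇒¬ramsey {Hs = Hs} good)

Subgraph : Graph → Graph → Set
Subgraph H G = Σ[ f ∈ (Fin (n H) → Fin (n G)) ] Inj f × (∀ x y → adj H x y ≡ true → adj G (f x) (f y) ≡ true)

subgraph-trans : ∀ {F G H} → Subgraph F G → Subgraph G H → Subgraph F H
subgraph-trans (f , fi , fe) (g , gi , ge) = g ∘ f , (λ eq → fi (gi eq)) , λ x y a → ge _ _ (fe x y a)

pull-back : ∀ {q} {H G} → Subgraph H G → Colouring G q → Colouring H q
pull-back (f , _) c = record { col = λ u v → col c (f u) (f v) ; col-sym = λ u v → col-sym c (f u) (f v) }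

ramsey-monotone : ∀ {q Hs H G} → Subgraph H G → IsRamsey q Hs H → IsRamsey q Hs G
ramsey-monotone S@(f , fi , fe) R c with R (pull-back S c)
... | (k , g , gi , h) = k , f ∘ g , (λ eq → gi (fi eq)) , λ x y a → fe _ _ (proj₁ (h x y a)) , proj₂ (h x y a)

restrict : (G : Graph) (b : Fin (n G) → Fin (n G) → Bool) → (∀ u v → b u v ≡ b v u) → Graph
restrict G b b-sym = record
  { n = n G ; adj = λ u v → adj G u v ∧ b u v
  ; adj-sym = λ u v → cong₂ _∧_ (adj-sym G u v) (b-sym u v)
  ; adj-irref = λ v → cong (_∧ b v v) (adj-irref G v) }

is-pair : ∀ {m} → Fin m × Fin m → Fin m → Fin m → Bool
is-pair (u , v) x y = (⌊ x ≟ u ⌋ ∧ ⌊ y ≟ v ⌋) ∨ (⌊ x ≟ v ⌋ ∧ ⌊ y ≟ u ⌋)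

is-pair-sym : ∀ {m} (p : Fin m × Fin m) x y → is-pair p x y ≡ is-pair p y x
is-pair-sym (u , v) x y = trans (Data.Bool.Properties.∨-comm (⌊ x ≟ u ⌋ ∧ ⌊ y ≟ v ⌋) _)
  (cong₂ _∨_ (Data.Bool.Properties.∧-comm ⌊ x ≟ v ⌋ _) (Data.Bool.Properties.∧-comm ⌊ x ≟ u ⌋ _))

⌊≟⌋-true : ∀ {m} {x y : Fin m} → ⌊ x ≟ y ⌋ ≡ true → x ≡ y
⌊≟⌋-true {x = x} {y} eq with x ≟ y
... | yes p = p

is-pair-true : ∀ {m} {u v x y : Fin m} → is-pair (u , v) x y ≡ true → (x ≡ u × y ≡ v) ⊎ (x ≡ v × y ≡ u)
is-pair-true {u = u} {v} {x} {y} eq with ∨-true (⌊ x ≟ u ⌋ ∧ ⌊ y ≟ v ⌋) eq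
... | inj₁ p = let (a , b) = ∧-true ⌊ x ≟ u ⌋ p in inj₁ (⌊≟⌋-true a , ⌊≟⌋-true b)
... | inj₂ p = let (a , b) = ∧-true ⌊ x ≟ v ⌋ p in inj₂ (⌊≟⌋-true a , ⌊≟⌋-true b)

is-pair-refl : ∀ {m} (u v : Fin m) → is-pair (u , v) u v ≡ true
is-pair-refl u v with u ≟ u | v ≟ v
... | yes _ | yes _ = refl
... | no ne | _ = ⊥-elim (ne refl)
... | yes _ | no ne = ⊥-elim (ne refl)

false-or-true : ∀ b → b ≡ false ⊎ b ≡ true
false-or-true false = inj₁ refl
false-or-true true = inj₂ refl

record Vertex-deleted (G : Graph) (v : Fin (n G)) : Set where
  field
    rest : Graph
    smaller : n G ≡ suc (n rest)
    emb : Fin (n rest) → Fin (n G)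
    emb-injective : Inj emb
    emb-≢ : ∀ x → emb x ≢ v
    emb-onto : ∀ {u} → u ≢ v → ∃ λ x → emb x ≡ u
    emb-adj : ∀ x y → adj rest x y ≡ adj G (emb x) (emb y)

delete-vertex : ∀ G v → Vertex-deleted G v
delete-vertex record { n = suc m ; adj = a ; adj-sym = s ; adj-irref = r } v = record
  { rest = record { n = m ; adj = λ x y → a (punchIn v x) (punchIn v y)
                  ; adj-sym = λ x y → s _ _ ; adj-irref = λ x → r _ }
  ; smaller = refl
  ; emb = punchIn v
  ; emb-injective = λ {x} {y} → Finₚ.punchIn-injective v x y
  ; emb-≢ = λ x → Finₚ.punchInᵢ≢i v x
  ; emb-onto = λ {u} ne → punchOut (ne ∘ sym) , Finₚ.punchIn-punchOut (ne ∘ sym)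
  ; emb-adj = λ x y → refl }

module MinimalSubgraph {q : ℕ} (Hs : Fin q → Graph) where
  private
    Ramsey = IsRamsey q Hs

    monotone : ∀ {H G} → Subgraph H G → Ramsey H → Ramsey G
    monotone {H} {G} = ramsey-monotone {Hs = Hs} {H} {G}

  -- `ps` are the pairs already examined. By monotonicity a pair that is critical or absent remains
  -- so when further edges are removed, hence one pass over all pairs suffices.
  record Thinned (G : Graph) (ps : List (Fin (n G) × Fin (n G))) : Set where
    field
      kept : Fin (n G) → Fin (n G) → Bool
      kept-sym : ∀ u v → kept u v ≡ kept v u

    thin : Graph
    thin = restrict G kept kept-sym

    without : Fin (n G) × Fin (n G) → Graph
    without p = restrict thin (λ x y → not (is-pair p x y)) (λ x y → cong not (is-pair-sym p x y))

    field
      still-ramsey : Ramsey thin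
      critical : ∀ {p} → p ∈ ps → adj thin (proj₁ p) (proj₂ p) ≡ true → ¬ Ramsey (without p)

  thinning : ∀ G → Ramsey G → ∀ ps → Thinned G ps
  thinning G R [] = record
    { kept = λ _ _ → true ; kept-sym = λ _ _ → refl
    ; still-ramsey = monotone (id , id , λ x y a → cong₂ _∧_ a refl) R ; critical = λ () }
  thinning G R (p ∷ ps) with thinning G R ps
  ... | S with ramsey? q Hs (Thinned.without S p)
  ...   | no ¬R = record
          { kept = kept ; kept-sym = kept-sym ; still-ramsey = still-ramsey
          ; critical = λ { (here refl) _ → ¬R ; (there p∈) → critical p∈ } }
    where open Thinned S
  ...   | yes R′ = record
          { kept = kept⁻ ; kept-sym = λ u v → cong₂ _∧_ (kept-sym u v) (cong not (is-pair-sym p u v))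
          ; still-ramsey = monotone (id , id , λ x y a → assoc (adj G x y) (kept x y) a) R′
          ; critical = λ { (here refl) a → ⊥-elim (absurd a)
                         ; {p′} (there p∈) a R″ → critical p∈ (weaken (adj G (proj₁ p′) (proj₂ p′)) _ a)
                             (monotone (id , id , λ x y b →
                               weaken₂ (adj G x y) (kept x y) (not (is-pair p x y)) (not (is-pair p′ x y)) b) R″) } }
    where
    open Thinned S
    kept⁻ : Fin (n G) → Fin (n G) → Bool
    kept⁻ x y = kept x y ∧ not (is-pair p x y)
    assoc : ∀ a b {c} → (a ∧ b) ∧ c ≡ true → a ∧ (b ∧ c) ≡ true
    assoc true true eq = eq
    weaken : ∀ a b {c} → a ∧ (b ∧ c) ≡ true → a ∧ b ≡ true
    weaken true true _ = refl
    weaken₂ : ∀ a b c d → (a ∧ (b ∧ c)) ∧ d ≡ true → (a ∧ b) ∧ d ≡ true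
    weaken₂ true true true d eq = eq
    absurd : ¬ (adj G (proj₁ p) (proj₂ p) ∧ (kept (proj₁ p) (proj₂ p) ∧ not (is-pair p (proj₁ p) (proj₂ p))) ≡ true)
    absurd a with ∧-true (adj G (proj₁ p) (proj₂ p)) a
    ... | (_ , b) with ∧-true (kept (proj₁ p) (proj₂ p)) b
    ... | (_ , c) with trans (sym c) (cong not (is-pair-refl (proj₁ p) (proj₂ p)))
    ... | ()

  minimal-if : ∀ G (S : Thinned G (elems (Fin-enum (n G) ×-enum Fin-enum (n G)))) →
    (∀ v → ¬ Ramsey (Vertex-deleted.rest (delete-vertex (Thinned.thin S) v))) → IsRamseyMinimal q Hs (Thinned.thin S)
  minimal-if G S no-vertex = still-ramsey , λ { H (f , f-inj , f-adj , inj₁ not-onto) R → vertex-case H f f-inj f-adj not-onto R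
                                              ; H (f , f-inj , f-adj , inj₂ (u , v , a , missing)) R →
      critical (complete (Fin-enum (n G) ×-enum Fin-enum (n G)) (u , v)) a
        (monotone {H = H} (f , f-inj , λ x y b → cong₂ _∧_ (f-adj x y b) (avoid H f missing x y b)) R) }
    where
    open Thinned S
    avoid : ∀ H (f : Fin (n H) → Fin (n G)) {u v} → ¬ (∃ λ x → ∃ λ y → (f x ≡ u) × (f y ≡ v) × (adj H x y ≡ true)) →
      ∀ x y → adj H x y ≡ true → not (is-pair (u , v) (f x) (f y)) ≡ true
    avoid H f {u} {v} missing x y b with false-or-true (is-pair (u , v) (f x) (f y))
    ... | inj₁ eq = cong not eq
    ... | inj₂ eq with is-pair-true {u = u} {v} {f x} {f y} eq
    ...   | inj₁ (p , p′) = ⊥-elim (missing (x , y , p , p′ , b))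
    ...   | inj₂ (p , p′) = ⊥-elim (missing (y , x , p′ , p , trans (adj-sym H y x) b))
    vertex-case : ∀ H (f : Fin (n H) → Fin (n G)) → Inj f → (∀ x y → adj H x y ≡ true → adj thin (f x) (f y) ≡ true) →
      ¬ Surjective _≡_ _≡_ f → ¬ Ramsey H
    vertex-case H f f-inj f-adj not-onto R with Finₚ.all? (λ v → Finₚ.any? (λ x → f x ≟ v))
    ... | yes all = not-onto (λ v → proj₁ (all v) , λ eq → trans (cong f eq) (proj₂ (all v)))
    ... | no ¬all with Finₚ.¬∀⟶∃¬ _ _ (λ v → Finₚ.any? (λ x → f x ≟ v)) ¬all
    ...   | (v , missed) = no-vertex v (monotone {H = H} ((λ x → proj₁ (pre x)) ,
              (λ {x} {y} eq → f-inj (trans (sym (proj₂ (pre x))) (trans (cong emb eq) (proj₂ (pre y))))) ,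
              (λ x y b → trans (emb-adj _ _)
                (trans (cong₂ (adj thin) (proj₂ (pre x)) (proj₂ (pre y))) (f-adj x y b)))) R)
      where
      open Vertex-deleted (delete-vertex thin v)
      pre : ∀ x → ∃ λ y → emb y ≡ f x
      pre x = emb-onto (λ eq → missed (x , eq))

  -- Thinning can leave isolated vertices behind, and removing one gives a proper subgraph too.
  -- After each deletion the thinning starts again, with `k` bounding the number of vertices.
  minimal-subgraph : ∀ k G → n G ≤ k → Ramsey G → Σ[ G′ ∈ Graph ] Subgraph G′ G × IsRamseyMinimal q Hs G′
  minimal-subgraph k G le R with thinning G R (elems (Fin-enum (n G) ×-enum Fin-enum (n G)))
  ... | S with Finₚ.any? (λ v → ramsey? q Hs (Vertex-deleted.rest (delete-vertex (Thinned.thin S) v)))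
  ...   | no none = Thinned.thin S , (id , id , λ x y a → proj₁ (∧-true (adj G x y) a)) ,
                    minimal-if G S (λ v R′ → none (v , R′))
  ...   | yes (v , R′) with k
  ...     | zero = ⊥-elim (Finₚ.¬Fin0 (subst Fin (ℕₚ.n≤0⇒n≡0 le) v))
  ...     | suc k′ with minimal-subgraph k′ rest (ℕₚ.≤-pred (subst (_≤ suc k′) smaller le)) R′
    where open Vertex-deleted (delete-vertex (Thinned.thin S) v)
  ...       | (G′ , sub , min) = G′ , subgraph-trans {G′} {thin} {G} (subgraph-trans {G′} {rest} {thin} sub
                (emb , emb-injective , λ x y a → trans (sym (emb-adj x y)) a))
                (id , id , λ x y a → proj₁ (∧-true (adj G x y) a)) , min
    where
    open Thinned S
    open Vertex-deleted (delete-vertex thin v)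

count : ∀ {m} → (Fin m → Bool) → ℕ
count {m} b = Data.Nat.ListAction.sum (Data.List.tabulate {n = m} (λ u → if b u then 1 else 0))

record Listing {m : ℕ} (b : Fin m → Bool) (k : ℕ) : Set where
  field
    entry : Fin k → Fin m
    entry-injective : Inj entry
    entry-true : ∀ i → b (entry i) ≡ true
    entry-onto : ∀ {u} → b u ≡ true → ∃ λ i → entry i ≡ u

open Listing public

listing : ∀ {m} (b : Fin m → Bool) → Listing b (count b)
listing {zero} b = record
  { entry = λ () ; entry-injective = λ {x} → ⊥-elim (Finₚ.¬Fin0 x)
  ; entry-true = λ () ; entry-onto = λ {u} → ⊥-elim (Finₚ.¬Fin0 u) }
listing {suc m} b with listing (b ∘ suc) | b zero in eq
... | S | true = record
  { entry = lift-suc (entry S)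
  ; entry-injective = λ { {zero} {zero} _ → refl ; {suc x} {suc y} e → cong suc (entry-injective S (Finₚ.suc-injective e)) }
  ; entry-true = λ { zero → eq ; (suc x) → entry-true S x }
  ; entry-onto = λ { {zero} _ → zero , refl ; {suc u} h → let (i , p) = entry-onto S h in suc i , cong suc p } }
... | S | false = record
  { entry = suc ∘ entry S
  ; entry-injective = λ e → entry-injective S (Finₚ.suc-injective e)
  ; entry-true = entry-true S
  ; entry-onto = λ { {zero} h → ⊥-elim (contra (trans (sym eq) h)) ; {suc u} h → let (i , p) = entry-onto S h in i , cong suc p } }
  where
  contra : ¬ (false ≡ true)
  contra ()

deg-count : ∀ G v → deg G v ≡ count (adj G v)
deg-count G v = cong Data.Nat.ListAction.sum (Listₚ.map-tabulate id (λ u → if adj G v u then 1 else 0))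

neighbours : ∀ G v → Listing (adj G v) (deg G v)
neighbours G v = subst (Listing (adj G v)) (sym (deg-count G v)) (listing (adj G v))

deg-≤ : ∀ G v {d} (f : ∀ {x} → adj G v x ≡ true → Fin d) →
  (∀ {x y} (a : adj G v x ≡ true) (b : adj G v y ≡ true) → f a ≡ f b → x ≡ y) → deg G v ≤ d
deg-≤ G v f f-inj = Finₚ.injective⇒≤ {f = λ i → f (entry-true N i)}
  (λ {i} {j} eq → entry-injective N (f-inj (entry-true N i) (entry-true N j) eq))
  where N = neighbours G v

minimum : ∀ {m} (f : Fin (suc m) → ℕ) → ∃ λ v → ∀ u → f v ≤ f u
minimum {zero} f = zero , λ { zero → ℕₚ.≤-refl }
minimum {suc m} f with minimum (f ∘ suc)
... | (v , h) with f zero ≤? f (suc v)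
...   | yes le = zero , λ { zero → ℕₚ.≤-refl ; (suc u) → ℕₚ.≤-trans le (h u) }
...   | no gt = suc v , λ { zero → ℕₚ.<⇒≤ (ℕₚ.≰⇒> gt) ; (suc u) → h u }

min-degree : ∀ G → Fin (n G) → ∃ λ d → MinDeg G d
min-degree G v = go (n G) (deg G) v
  where
  go : ∀ m (f : Fin m → ℕ) → Fin m → ∃ λ d → (∃ λ v → f v ≡ d) × (∀ v → d ≤ f v)
  go (suc m) f _ = let (v , h) = minimum f in f v , (v , refl) , h

-- Patterns and the lower bound

∀-function? : ∀ {A m} → Enum A → {P : (Fin m → A) → Set} →
  (∀ {f g} → f ≗ g → P f → P g) → (∀ f → Dec (P f)) → Dec (∀ f → P f)
∀-function? {m = m} e resp P? =
  Dec.map′ (λ h f → resp (λ i → Vecₚ.lookup∘tabulate f i) (h (tabulate f))) (λ h v → h (Vec.lookup v))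
           (∀? (Vec-enum e m) (λ v → P? (Vec.lookup v)))

-- Colours j ↑ˡ q₂ forbid the cycle, colours q₁ ↑ʳ β forbid the clique.
ColourView : ∀ q₁ q₂ → Fin (q₁ + q₂) → Set
ColourView q₁ q₂ k = (∃ λ j → k ≡ j ↑ˡ q₂) ⊎ (∃ λ β → k ≡ q₁ ↑ʳ β)

colour-view : ∀ q₁ q₂ k → ColourView q₁ q₂ k
colour-view q₁ q₂ k with splitAt q₁ k in eq
... | inj₁ j = inj₁ (j , sym (Finₚ.splitAt⁻¹-↑ˡ eq))
... | inj₂ β = inj₂ (β , sym (Finₚ.splitAt⁻¹-↑ʳ eq))

cycle≢clique-colour : ∀ {q₁ q₂} {j : Fin q₁} {β : Fin q₂} → j ↑ˡ q₂ ≢ q₁ ↑ʳ β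
cycle≢clique-colour {q₁} {q₂} {j} {β} eq
  with trans (sym (Finₚ.splitAt-↑ˡ q₁ j q₂)) (trans (cong (splitAt q₁) eq) (Finₚ.splitAt-↑ʳ q₁ q₂ β))
... | ()

𝒯-cycle : ∀ q₁ q₂ ℓ t j → 𝒯 q₁ q₂ ℓ t (j ↑ˡ q₂) ≡ C ℓ
𝒯-cycle q₁ q₂ ℓ t j = cong [ (λ _ → C ℓ) , (λ _ → K t) ]′ (Finₚ.splitAt-↑ˡ q₁ j q₂)

𝒯-clique : ∀ q₁ q₂ ℓ t β → 𝒯 q₁ q₂ ℓ t (q₁ ↑ʳ β) ≡ K t
𝒯-clique q₁ q₂ ℓ t β = cong [ (λ _ → C ℓ) , (λ _ → K t) ]′ (Finₚ.splitAt-↑ʳ q₁ q₂ β)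

clique-type : ∀ q₁ {q₂} → Fin (q₁ + q₂) → Maybe (Fin q₂)
clique-type q₁ k = [ (λ _ → nothing) , just ]′ (splitAt q₁ k)

clique-type-↑ʳ : ∀ q₁ {q₂} (β : Fin q₂) → clique-type q₁ (q₁ ↑ʳ β) ≡ just β
clique-type-↑ʳ q₁ {q₂} β = cong [ (λ _ → nothing) , just ]′ (Finₚ.splitAt-↑ʳ q₁ q₂ β)

clique-type⁻¹ : ∀ q₁ {q₂} (k : Fin (q₁ + q₂)) {β} → clique-type q₁ k ≡ just β → k ≡ q₁ ↑ʳ β
clique-type⁻¹ q₁ k eq with splitAt q₁ k in s | eq
... | inj₂ β | refl = sym (Finₚ.splitAt⁻¹-↑ʳ s)

module _ (q₁ q₂ s d : ℕ) where
  TypeClique : ∀ {k} → (Fin d → Fin d → Maybe (Fin q₂)) → Fin q₂ → (Fin k → Fin d) → Set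
  TypeClique τ β f = ∀ i j → i ≢ j → τ (f i) (f j) ≡ just β

  Conflict : (Fin d → Fin d → Maybe (Fin q₂)) → (Fin d → Fin (q₁ + q₂)) → Set
  Conflict τ c =
    (∃ λ j → ∃ λ a → ∃ λ b → a ≢ b × c a ≡ j ↑ˡ q₂ × c b ≡ j ↑ˡ q₂) ⊎
    (∃ λ β → Σ[ f ∈ (Fin s → Fin d) ] TypeClique τ β f × (∀ i → c (f i) ≡ q₁ ↑ʳ β))

  -- The typed graphs on d vertices to which a further vertex cannot be joined,
  -- when at every two vertices each cycle colour is blocked and t = s + 1.
  IsPattern : (Fin d → Fin d → Maybe (Fin q₂)) → Set
  IsPattern τ = (∀ a b → τ a b ≡ τ b a) ×
                (∀ β (f : Fin (suc s) → Fin d) → ¬ TypeClique τ β f) ×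
                (∀ c → Conflict τ c)

  Pattern : Set
  Pattern = ∃ IsPattern

  private
    Fd = Fin-enum d
    Fc = Fin-enum (q₁ + q₂)

    clique-resp : ∀ {k τ τ′ β} {f f′ : Fin k → Fin d} → (∀ a b → τ a b ≡ τ′ a b) → f ≗ f′ →
      TypeClique τ β f → TypeClique τ′ β f′
    clique-resp {τ = τ} {f = f} {f′} eq eqf h i j ne =
      trans (sym (trans (cong₂ τ (eqf i) (eqf j)) (eq (f′ i) (f′ j)))) (h i j ne)

    clique? : ∀ {k} τ β (f : Fin k → Fin d) → Dec (TypeClique τ β f)
    clique? {k} τ β f = ∀? (Fin-enum k) λ i → ∀? (Fin-enum k) λ j →
      ¬? (i ≟ j) →-dec dec-≡ (Maybe-enum (Fin-enum q₂)) (τ (f i) (f j)) (just β)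

    conflict-resp : ∀ {τ τ′ c c′} → (∀ a b → τ a b ≡ τ′ a b) → c ≗ c′ → Conflict τ c → Conflict τ′ c′
    conflict-resp eq eqc (inj₁ (j , a , b , ne , p , p′)) = inj₁ (j , a , b , ne , trans (sym (eqc a)) p , trans (sym (eqc b)) p′)
    conflict-resp eq eqc (inj₂ (β , f , h , p)) = inj₂ (β , f , clique-resp eq (λ _ → refl) h , λ i → trans (sym (eqc (f i))) (p i))

    conflict? : ∀ τ c → Dec (Conflict τ c)
    conflict? τ c =
      (∃? (Fin-enum q₁) λ j → ∃? Fd λ a → ∃? Fd λ b → ¬? (a ≟ b) ×-dec (c a ≟ j ↑ˡ q₂) ×-dec (c b ≟ j ↑ˡ q₂)) ⊎-dec
      (∃? (Fin-enum q₂) λ β → ∃-function? Fd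
        (λ eqf (h , p) → clique-resp {τ = τ} (λ _ _ → refl) eqf h , λ i → trans (cong c (sym (eqf i))) (p i))
        (λ f → clique? τ β f ×-dec ∀? (Fin-enum s) λ i → c (f i) ≟ q₁ ↑ʳ β))

  -- Needed in order that the least order of a pattern can be found by search.
  pattern? : Dec Pattern
  pattern? = ∃-matrix? (Maybe-enum (Fin-enum q₂))
    (λ eq (τ-sym , free , conf) →
      (λ a b → trans (sym (eq a b)) (trans (τ-sym a b) (eq b a))) ,
      (λ β f h → free β f (clique-resp (λ a b → sym (eq a b)) (λ _ → refl) h)) ,
      (λ c → conflict-resp eq (λ _ → refl) (conf c)))
    (λ τ → (∀? Fd λ a → ∀? Fd λ b → dec-≡ (Maybe-enum (Fin-enum q₂)) (τ a b) (τ b a)) ×-dec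
      (∀? (Fin-enum q₂) λ β → ∀-function? Fd (λ eqf h h′ → h (clique-resp {τ = τ} (λ _ _ → refl) (λ i → sym (eqf i)) h′))
        (λ f → ¬? (clique? τ β f))) ×-dec
      ∀-function? Fc (λ {c} {c′} eqc → conflict-resp {τ = τ} (λ _ _ → refl) eqc) (conflict? τ))

least : ∀ {P : ℕ → Set} → (∀ d → Dec (P d)) → ∀ d → P d → ∃ λ k → P k × (∀ d → P d → k ≤ d)
least {P} P? d p = go d 0 (λ ()) (subst P (sym (ℕₚ.+-identityʳ d)) p)
  where
  go : ∀ fuel k → (∀ {e} → e < k → ¬ P e) → P (fuel + k) → ∃ λ k → P k × (∀ d → P d → k ≤ d)
  go fuel k below p with P? k
  ... | yes pk = k , pk , λ e pe → ℕₚ.≮⇒≥ (λ lt → below lt pe)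
  go zero k below p | no npk = ⊥-elim (npk p)
  go (suc fuel) k below p | no npk = go fuel (suc k) below′ (subst P (sym (ℕₚ.+-suc fuel k)) p)
    where
    below′ : ∀ {e} → e < suc k → ¬ P e
    below′ (s≤s le) pe with ℕₚ.m≤n⇒m<n∨m≡n le
    ... | inj₁ lt = below lt pe
    ... | inj₂ refl = npk pe

module NeighbourhoodPattern (q₁ q₂ m s : ℕ) (3≤ℓ : 3 ≤ suc m)
  (G : Graph) (G-ramsey : IsRamsey (q₁ + suc q₂) (𝒯 q₁ (suc q₂) (suc m) (suc s)) G) (v : Fin (n G))
  (D : Vertex-deleted G v) (c : Colouring (Vertex-deleted.rest D) (q₁ + suc q₂))
  (c-good : ∀ k → ¬ MonoCopy (𝒯 q₁ (suc q₂) (suc m) (suc s) k) (Vertex-deleted.rest D) c k)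
  (δ : ℕ) (N : Listing (adj G v) δ) where
  private
    q = q₁ + suc q₂
  open Vertex-deleted D
  open Cycle m

  entry≢v : ∀ a → entry N a ≢ v
  entry≢v a eq = adj⇒≢ G (entry-true N a) (sym eq)

  pre : ∀ {u} → u ≢ v → Fin (n rest)
  pre ne = proj₁ (emb-onto ne)

  τ : Fin δ → Fin δ → Maybe (Fin (suc q₂))
  τ a b = if adj rest (pre (entry≢v a)) (pre (entry≢v b))
          then clique-type q₁ (col c (pre (entry≢v a)) (pre (entry≢v b))) else nothing

  τ-just : ∀ {a b β} → τ a b ≡ just β → adj rest (pre (entry≢v a)) (pre (entry≢v b)) ≡ true ×
    col c (pre (entry≢v a)) (pre (entry≢v b)) ≡ q₁ ↑ʳ β
  τ-just {a} {b} eq with adj rest (pre (entry≢v a)) (pre (entry≢v b))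
  ... | true = refl , clique-type⁻¹ q₁ _ eq

  τ-free : ∀ β (f : Fin (suc s) → Fin δ) → ¬ TypeClique q₁ (suc q₂) s δ τ β f
  τ-free β f h = c-good (q₁ ↑ʳ β) (subst (λ H → MonoCopy H rest c (q₁ ↑ʳ β)) (sym (𝒯-clique q₁ (suc q₂) _ _ β))
    (clique-copy rest c (q₁ ↑ʳ β) (λ i → pre (entry≢v (f i))) (λ ne → τ-just {f _} {f _} (h _ _ ne))))

  module _ (x : Fin δ → Fin q) where
    star : ∀ y b → adj G v y ≡ b → Fin q
    star y true eq = x (proj₁ (entry-onto N eq))
    -- Not an edge, so any colour will do.
    star y false eq = q₁ ↑ʳ zero

    star-entry : ∀ a b (eq : adj G v (entry N a) ≡ b) → star (entry N a) b eq ≡ x a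
    star-entry a true eq = cong x (entry-injective N (proj₂ (entry-onto N eq)))
    star-entry a false eq with trans (sym eq) (entry-true N a)
    ... | ()

    raw : ∀ y z → Dec (y ≡ v) → Dec (z ≡ v) → Fin q
    raw y z (yes _) _ = star z (adj G v z) refl
    raw y z (no _) (yes _) = star y (adj G v y) refl
    raw y z (no p) (no p′) = col c (pre p) (pre p′)

    raw-star : ∀ {z} (d : Dec (v ≡ v)) (d′ : Dec (z ≡ v)) → raw v z d d′ ≡ star z (adj G v z) refl
    raw-star (yes _) _ = refl
    raw-star (no ne) _ = ⊥-elim (ne refl)

    raw-star′ : ∀ {z} → z ≢ v → (d : Dec (z ≡ v)) (d′ : Dec (v ≡ v)) → raw z v d d′ ≡ star z (adj G v z) refl
    raw-star′ ne (yes eq) _ = ⊥-elim (ne eq)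
    raw-star′ ne (no _) (yes _) = refl
    raw-star′ ne (no _) (no ne′) = ⊥-elim (ne′ refl)

    raw-emb : ∀ y z (d : Dec (emb y ≡ v)) (d′ : Dec (emb z ≡ v)) → raw (emb y) (emb z) d d′ ≡ col c y z
    raw-emb y z (yes eq) _ = ⊥-elim (emb-≢ y eq)
    raw-emb y z (no _) (yes eq) = ⊥-elim (emb-≢ z eq)
    raw-emb y z (no p) (no p′) = cong₂ (col c) (emb-injective (proj₂ (emb-onto p))) (emb-injective (proj₂ (emb-onto p′)))

    extended : Colouring G q
    extended = colouring G (λ y z → raw y z (y ≟ v) (z ≟ v))

    extended-entry : ∀ a → col extended v (entry N a) ≡ x a
    extended-entry a = trans via-star (star-entry a _ refl)
      where
      via-star : col extended v (entry N a) ≡ star (entry N a) (adj G v (entry N a)) refl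
      via-star with symmetrise-either (λ y z → raw y z (y ≟ v) (z ≟ v)) v (entry N a)
      ... | inj₁ eq = trans eq (raw-star (v ≟ v) (entry N a ≟ v))
      ... | inj₂ eq = trans eq (raw-star′ (entry≢v a) (entry N a ≟ v) (v ≟ v))

    extended-emb : ∀ y z → col extended (emb y) (emb z) ≡ col c y z
    extended-emb y z with symmetrise-either (λ y z → raw y z (y ≟ v) (z ≟ v)) (emb y) (emb z)
    ... | inj₁ eq = trans eq (raw-emb y z (emb y ≟ v) (emb z ≟ v))
    ... | inj₂ eq = trans eq (trans (raw-emb z y (emb z ≟ v) (emb y ≟ v)) (col-sym c z y))

    -- A forbidden copy in the extended colouring must contain `v`, because `c` is good. In a cycle
    -- the two edges at `v` share its colour; in a clique the remaining vertices form a clique of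
    -- the same type.
    conflict : Conflict q₁ (suc q₂) s δ τ x
    conflict with G-ramsey extended
    ... | (k , f , f-inj , h) with Finₚ.any? (λ i → f i ≟ v)
    ... | no avoids = ⊥-elim (c-good k ((λ i → proj₁ (back i)) ,
        (λ {i} {j} eq → f-inj (trans (sym (proj₂ (back i))) (trans (cong emb eq) (proj₂ (back j))))) ,
        λ i j a → trans (emb-adj _ _) (trans (cong₂ (adj G) (proj₂ (back i)) (proj₂ (back j))) (proj₁ (h i j a))) ,
                  trans (sym (extended-emb _ _)) (trans (cong₂ (col extended) (proj₂ (back i)) (proj₂ (back j))) (proj₂ (h i j a)))))
      where
      back : ∀ i → ∃ λ y → emb y ≡ f i
      back i = emb-onto (λ eq → avoids (i , eq))
    ... | yes (i₀ , fi₀) with colour-view q₁ (suc q₂) k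
    ...   | inj₁ (j , refl) = inj₁ (cycle-conflict
              (subst (λ H → Σ[ M ∈ MonoCopy H G extended (j ↑ˡ suc q₂) ] ∃ λ i → proj₁ M i ≡ v)
                     (𝒯-cycle q₁ (suc q₂) (suc m) (suc s) j) ((f , f-inj , h) , i₀ , fi₀)))
      where
      cycle-conflict : Σ[ M ∈ MonoCopy (C (suc m)) G extended (j ↑ˡ suc q₂) ] (∃ λ i → proj₁ M i ≡ v) →
        ∃ λ j → ∃ λ a → ∃ λ b → a ≢ b × x a ≡ j ↑ˡ suc q₂ × x b ≡ j ↑ˡ suc q₂
      cycle-conflict ((g , g-inj , e) , i , refl) = j , idx (next i) after , idx (prev i) before , distinct ,
        value (next i) after (proj₂ (e _ _ arc⁺)) , value (prev i) before (proj₂ (e _ _ arc⁻))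
        where
        2≤ℓ : 2 ≤ suc m
        2≤ℓ = ℕₚ.≤-trans (s≤s (s≤s z≤n)) 3≤ℓ
        arc⁺ : adj (C (suc m)) i (next i) ≡ true
        arc⁺ = C-adj-next 2≤ℓ i
        arc⁻ : adj (C (suc m)) i (prev i) ≡ true
        arc⁻ = trans (adj-sym (C (suc m)) i (prev i))
          (subst (λ z → adj (C (suc m)) (prev i) z ≡ true) (next-prev i) (C-adj-next 2≤ℓ (prev i)))
        after : adj G (g i) (g (next i)) ≡ true
        after = proj₁ (e _ _ arc⁺)
        before : adj G (g i) (g (prev i)) ≡ true
        before = proj₁ (e _ _ arc⁻)
        idx : ∀ y → adj G (g i) (g y) ≡ true → Fin δ
        idx y a = proj₁ (entry-onto N a)
        value : ∀ y (a : adj G (g i) (g y) ≡ true) → col extended (g i) (g y) ≡ j ↑ˡ suc q₂ → x (idx y a) ≡ j ↑ˡ suc q₂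
        value y a eq = trans (sym (extended-entry _)) (trans (cong (col extended (g i)) (proj₂ (entry-onto N a))) eq)
        -- On a cycle with at least three vertices the successor and the predecessor of a vertex
        -- differ.
        distinct : idx (next i) after ≢ idx (prev i) before
        distinct eq = next²≢ 3≤ℓ i (trans (cong next (g-inj (trans (sym (proj₂ (entry-onto N after)))
          (trans (cong (entry N) eq) (proj₂ (entry-onto N before)))))) (next-prev i))
    ...   | inj₂ (β , refl) = inj₂ (β , clique-conflict
              (subst (λ H → Σ[ M ∈ MonoCopy H G extended (q₁ ↑ʳ β) ] ∃ λ i → proj₁ M i ≡ v)
                     (𝒯-clique q₁ (suc q₂) (suc m) (suc s) β) ((f , f-inj , h) , i₀ , fi₀)))
      where
      clique-conflict : Σ[ M ∈ MonoCopy (K (suc s)) G extended (q₁ ↑ʳ β) ] (∃ λ i → proj₁ M i ≡ v) →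
        Σ[ f ∈ (Fin s → Fin δ) ] TypeClique q₁ (suc q₂) s δ τ β f × (∀ i → x (f i) ≡ q₁ ↑ʳ β)
      clique-conflict ((g , g-inj , e) , i₀ , refl) = (λ i → proj₁ (idx i)) , types , λ i →
        trans (sym (extended-entry _)) (trans (cong (col extended (g i₀)) (proj₂ (idx i))) (proj₂ (hub i)))
        where
        hub : ∀ i → adj G (g i₀) (g (punchIn i₀ i)) ≡ true × col extended (g i₀) (g (punchIn i₀ i)) ≡ q₁ ↑ʳ β
        hub i = e _ _ (K-adj (Finₚ.punchInᵢ≢i i₀ i ∘ sym))
        idx : ∀ i → ∃ λ a → entry N a ≡ g (punchIn i₀ i)
        idx i = entry-onto N (proj₁ (hub i))
        emb-idx : ∀ i → emb (pre (entry≢v (proj₁ (idx i)))) ≡ g (punchIn i₀ i)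
        emb-idx i = trans (proj₂ (emb-onto _)) (proj₂ (idx i))
        types : ∀ i j → i ≢ j → τ (proj₁ (idx i)) (proj₁ (idx j)) ≡ just β
        types i j ne with e _ _ (K-adj (λ eq → ne (Finₚ.punchIn-injective i₀ i j eq)))
        ... | (a , k) rewrite trans (emb-adj (pre (entry≢v (proj₁ (idx i)))) (pre (entry≢v (proj₁ (idx j)))))
                (trans (cong₂ (adj G) (emb-idx i) (emb-idx j)) a) =
          trans (cong (clique-type q₁) (trans (sym (extended-emb _ _)) (trans (cong₂ (col extended) (emb-idx i) (emb-idx j)) k)))
                (clique-type-↑ʳ q₁ β)

  link-pattern : Pattern q₁ (suc q₂) s δ
  link-pattern = τ , τ-sym , τ-free , conflict
    where
    τ-sym : ∀ a b → τ a b ≡ τ b a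
    τ-sym a b = cong₂ (λ b k → if b then clique-type q₁ k else nothing) (adj-sym rest _ _) (col-sym c _ _)

pattern-of-minimal : ∀ q₁ q₂ m s → 3 ≤ suc m → ∀ G →
  IsRamseyMinimal (q₁ + suc q₂) (𝒯 q₁ (suc q₂) (suc m) (suc s)) G → ∀ v → Pattern q₁ (suc q₂) s (deg G v)
pattern-of-minimal q₁ q₂ m s 3≤ℓ G (R , minimal) v = go (ramsey-or-good q Hs rest)
  where
  q = q₁ + suc q₂
  Hs = 𝒯 q₁ (suc q₂) (suc m) (suc s)
  D = delete-vertex G v
  open Vertex-deleted D
  go : IsRamsey q Hs rest ⊎ GoodColouring q Hs rest → Pattern q₁ (suc q₂) s (deg G v)
  go (inj₂ (c , c-good)) =
    NeighbourhoodPattern.link-pattern q₁ q₂ m s 3≤ℓ G R v D c c-good (deg G v) (neighbours G v)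
  go (inj₁ R′) = ⊥-elim (minimal rest (emb , emb-injective , (λ x y a → trans (sym (emb-adj x y)) a) ,
          inj₁ (λ onto → emb-≢ (proj₁ (onto v)) (proj₂ (onto v) refl))) R′)

-- The typed graph of a pattern

module _ {r t : ℕ} (A B : Typed r (suc t)) where
  private
    E⊎ : Fin r → Vertex A ⊎ Vertex B → Vertex A ⊎ Vertex B → Set
    E⊎ β (inj₁ x) (inj₁ y) = Edge A β x y
    E⊎ β (inj₂ x) (inj₂ y) = Edge B β x y
    E⊎ β _ _ = ⊥

    e? : ∀ β x y → Dec (E⊎ β x y)
    e? β (inj₁ x) (inj₁ y) = edge? A β x y
    e? β (inj₂ x) (inj₂ y) = edge? B β x y
    e? β (inj₁ _) (inj₂ _) = no λ ()
    e? β (inj₂ _) (inj₁ _) = no λ ()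

    e-sym : ∀ {β} x y → E⊎ β x y → E⊎ β y x
    e-sym (inj₁ x) (inj₁ y) = edge-sym A
    e-sym (inj₂ x) (inj₂ y) = edge-sym B

    e-irrefl : ∀ {β} x → ¬ E⊎ β x x
    e-irrefl (inj₁ x) = edge-irrefl A
    e-irrefl (inj₂ x) = edge-irrefl B

    e-unique : ∀ {β β′} x y → E⊎ β x y → E⊎ β′ x y → β ≡ β′
    e-unique (inj₁ x) (inj₁ y) = edge-unique A
    e-unique (inj₂ x) (inj₂ y) = edge-unique B

    fromₗ : ∀ {β x} y → E⊎ β (inj₁ x) y → ∃ λ z → y ≡ inj₁ z
    fromₗ (inj₁ z) _ = z , refl

    fromᵣ : ∀ {β x} y → E⊎ β (inj₂ x) y → ∃ λ z → y ≡ inj₂ z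
    fromᵣ (inj₂ z) _ = z , refl

    free : ∀ {β} (f : Fin (suc t) → Vertex A ⊎ Vertex B) → ¬ (∀ {i j} → i ≢ j → E⊎ β (f i) (f j))
    free {β} f cl = by-first (f zero) refl
      where
      by-first : ∀ z → f zero ≡ z → ⊥
      by-first (inj₁ a) eq = clique-free A (proj₁ ∘ all) (λ {i} {j} ne → subst₂ (E⊎ β) (proj₂ (all i)) (proj₂ (all j)) (cl ne))
        where
        all : ∀ i → ∃ λ z → f i ≡ inj₁ z
        all zero = a , eq
        all (suc i) = fromₗ {β} {a} (f (suc i)) (subst (λ z → E⊎ β z (f (suc i))) eq (cl (λ ())))
      by-first (inj₂ a) eq = clique-free B (proj₁ ∘ all) (λ {i} {j} ne → subst₂ (E⊎ β) (proj₂ (all i)) (proj₂ (all j)) (cl ne))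
        where
        all : ∀ i → ∃ λ z → f i ≡ inj₂ z
        all zero = a , eq
        all (suc i) = fromᵣ {β} {a} (f (suc i)) (subst (λ z → E⊎ β z (f (suc i))) eq (cl (λ ())))

  typed-sum : Typed r (suc t)
  typed-sum = record
    { Vertex = Vertex A ⊎ Vertex B ; vertex-enum = vertex-enum A ⊎-enum vertex-enum B
    ; Edge = E⊎ ; edge? = e? ; edge-sym = λ {_} {x} {y} → e-sym x y ; edge-irrefl = λ {_} {x} → e-irrefl x
    ; edge-unique = λ {_} {_} {x} {y} → e-unique x y ; clique-free = free }

-- The pendant cliques keep the clique colours away from the edges inside a block.
module Pendants {r t d : ℕ} (τ : Fin d → Fin d → Maybe (Fin r)) (τ-sym : ∀ a b → τ a b ≡ τ b a)
  (τ-free : ∀ β (f : Fin (3 + t) → Fin d) → ¬ (∀ i j → i ≢ j → τ (f i) (f j) ≡ just β)) where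
  private
    -- Forbidden cliques have `3 + t` vertices. The `suc t` pendants of one type fall one vertex
    -- short of this together with their base vertex, and reach it together with an edge inside the
    -- block that replaces the base vertex.
    W = Fin d ⊎ (Fin d × Fin r × Fin (suc t))

    Eₚ : Fin r → W → W → Set
    Eₚ β (inj₁ a) (inj₁ b) = τ a b ≡ just β
    Eₚ β (inj₁ a) (inj₂ (b , θ , i)) = a ≡ b × θ ≡ β
    Eₚ β (inj₂ (b , θ , i)) (inj₁ a) = a ≡ b × θ ≡ β
    Eₚ β (inj₂ (a , θ , i)) (inj₂ (b , θ′ , j)) = a ≡ b × θ ≡ β × θ′ ≡ β × i ≢ j

    τ-irrefl : ∀ {a β} → τ a a ≢ just β
    τ-irrefl {a} {β} eq = τ-free β (λ _ → a) (λ _ _ _ → eq)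

    e? : ∀ β x y → Dec (Eₚ β x y)
    e? β (inj₁ a) (inj₁ b) = dec-≡ (Maybe-enum (Fin-enum r)) (τ a b) (just β)
    e? β (inj₁ a) (inj₂ (b , θ , i)) = (a ≟ b) ×-dec (θ ≟ β)
    e? β (inj₂ (b , θ , i)) (inj₁ a) = (a ≟ b) ×-dec (θ ≟ β)
    e? β (inj₂ (a , θ , i)) (inj₂ (b , θ′ , j)) = (a ≟ b) ×-dec (θ ≟ β) ×-dec (θ′ ≟ β) ×-dec ¬? (i ≟ j)

    e-sym : ∀ {β} x y → Eₚ β x y → Eₚ β y x
    e-sym (inj₁ a) (inj₁ b) e = trans (τ-sym b a) e
    e-sym (inj₁ a) (inj₂ _) e = e
    e-sym (inj₂ _) (inj₁ a) e = e
    e-sym (inj₂ _) (inj₂ _) (p , p′ , p″ , ne) = sym p , p″ , p′ , ne ∘ sym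

    e-irrefl : ∀ {β} x → ¬ Eₚ β x x
    e-irrefl (inj₁ a) e = τ-irrefl e
    e-irrefl (inj₂ _) (_ , _ , _ , ne) = ne refl

    e-unique : ∀ {β β′} x y → Eₚ β x y → Eₚ β′ x y → β ≡ β′
    e-unique (inj₁ a) (inj₁ b) e e′ = just-injective (trans (sym e) e′)
    e-unique (inj₁ a) (inj₂ _) (_ , p) (_ , p′) = trans (sym p) p′
    e-unique (inj₂ _) (inj₁ a) (_ , p) (_ , p′) = trans (sym p) p′
    e-unique (inj₂ _) (inj₂ _) (_ , p , _) (_ , p′ , _) = trans (sym p) p′

    -- A clique with a pendant vertex consists of pendants of one type at one base vertex and
    -- possibly that vertex. `code` numbers these `2 + t` candidates, too few for a forbidden
    -- clique.
    code : W → Fin (2 + t)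
    code (inj₁ _) = zero
    code (inj₂ (_ , _ , i)) = suc i

    code-injective : ∀ {β} z x y → code x ≡ code y → Eₚ β x y → (∀ {a} → x ≡ inj₁ a → Eₚ β (inj₂ z) x) →
      (∀ {a} → y ≡ inj₁ a → Eₚ β (inj₂ z) y) → ⊥
    code-injective z (inj₁ a) (inj₁ b) eq e h h′ with h refl | h′ refl
    ... | (refl , _) | (refl , _) = τ-irrefl e
    code-injective z (inj₂ _) (inj₂ _) eq (_ , _ , _ , ne) _ _ = ne (Finₚ.suc-injective eq)

    inj₁? : (x : W) → (∃ λ a → x ≡ inj₁ a) ⊎ (∃ λ z → x ≡ inj₂ z)
    inj₁? (inj₁ a) = inj₁ (a , refl)
    inj₁? (inj₂ z) = inj₂ (z , refl)

    inj₂? : (x : W) → Dec (∃ λ z → x ≡ inj₂ z)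
    inj₂? (inj₁ a) = no λ { (_ , ()) }
    inj₂? (inj₂ z) = yes (z , refl)

    free : ∀ {β} (f : Fin (3 + t) → W) → ¬ (∀ {i j} → i ≢ j → Eₚ β (f i) (f j))
    free {β} f cl with Finₚ.any? (λ i → inj₂? (f i))
    ... | no none = τ-free β (proj₁ ∘ all) (λ i j ne → subst₂ (Eₚ β) (proj₂ (all i)) (proj₂ (all j)) (cl ne))
      where
      all : ∀ i → ∃ λ a → f i ≡ inj₁ a
      all i with inj₁? (f i)
      ... | inj₁ p = p
      ... | inj₂ p = ⊥-elim (none (i , p))
    ... | yes (i₀ , z , eq₀) = no-injection ℕₚ.≤-refl (code ∘ f) inj
      where
      to-z : ∀ i {a} → f i ≡ inj₁ a → Eₚ β (inj₂ z) (f i)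
      to-z i eq = subst (λ w → Eₚ β w (f i)) eq₀ (cl (λ { refl → case trans (sym eq₀) eq of λ () }))
      inj : Inj (code ∘ f)
      inj {x} {y} eq with x ≟ y
      ... | yes p = p
      ... | no ne = ⊥-elim (code-injective z (f x) (f y) eq (cl ne) (to-z x) (to-z y))

  pendants : Typed r (3 + t)
  pendants = record
    { Vertex = W ; vertex-enum = Fin-enum d ⊎-enum (Fin-enum d ×-enum Fin-enum r ×-enum Fin-enum (suc t))
    ; Edge = Eₚ ; edge? = e? ; edge-sym = λ {_} {x} {y} → e-sym x y ; edge-irrefl = λ {_} {x} → e-irrefl x
    ; edge-unique = λ {_} {_} {x} {y} → e-unique x y ; clique-free = free }

-- If a type received a cycle colour, its cycle would be monochromatic. The cycles can be added
-- because length at least 4 excludes triangles, hence all forbidden cliques.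
module TypedCycles (r t m : ℕ) (4≤ℓ : 4 ≤ suc m) where
  open Cycle m

  triangle-free : ∀ {x y z} → adj (C ℓ) x y ≡ true → adj (C ℓ) y z ≡ true → adj (C ℓ) x z ≡ true → ⊥
  triangle-free {x} {y} {z} xy yz xz =
    go (C-adj⇒next {i = x} {y} xy) (C-adj⇒next {i = y} {z} yz) (C-adj⇒next {i = x} {z} xz)
    where
    3≤ℓ : 3 ≤ ℓ
    3≤ℓ = ℕₚ.≤-trans (ℕₚ.n≤1+n 3) 4≤ℓ
    ne-xy = adj⇒≢ (C ℓ) {x} {y} xy
    ne-yz = adj⇒≢ (C ℓ) {y} {z} yz
    ne-xz = adj⇒≢ (C ℓ) {x} {z} xz
    go : (y ≡ next x ⊎ x ≡ next y) → (z ≡ next y ⊎ y ≡ next z) → (z ≡ next x ⊎ x ≡ next z) → ⊥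
    go (inj₁ p) (inj₁ q) (inj₁ s) = ne-yz (trans p (sym s))
    go (inj₁ p) (inj₁ q) (inj₂ s) = next³≢ 4≤ℓ x (sym (trans s (cong next (trans q (cong next p)))))
    go (inj₁ p) (inj₂ q) _ = ne-xz (next-injective (trans (sym p) q))
    go (inj₂ p) (inj₁ q) _ = ne-xz (trans p (sym q))
    go (inj₂ p) (inj₂ q) (inj₂ s) = ne-yz (next-injective (trans (sym p) s))
    go (inj₂ p) (inj₂ q) (inj₁ s) = next³≢ 4≤ℓ z (sym (trans s (cong next (trans p (cong next q)))))

  typed-cycles : Typed r (3 + t)
  typed-cycles = record
    { Vertex = Fin r × Fin ℓ ; vertex-enum = Fin-enum r ×-enum Fin-enum ℓ
    ; Edge = λ β (θ , x) (θ′ , y) → θ ≡ β × θ′ ≡ β × adj (C ℓ) x y ≡ true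
    ; edge? = λ β (θ , x) (θ′ , y) → (θ ≟ β) ×-dec (θ′ ≟ β) ×-dec (adj (C ℓ) x y Data.Bool.≟ true)
    ; edge-sym = λ {_} {x} {y} (p , p′ , a) → p′ , p , trans (adj-sym (C ℓ) (proj₂ y) (proj₂ x)) a
    ; edge-irrefl = λ {_} {x} (_ , _ , a) → adj⇒≢ (C ℓ) {proj₂ x} a refl
    ; edge-unique = λ (p , _) (p′ , _) → trans (sym p) p′
    ; clique-free = λ f cl → triangle-free {proj₂ (f zero)} {proj₂ (f (suc zero))} {proj₂ (f (suc (suc zero)))}
        (proj₂ (proj₂ (cl (λ ())))) (proj₂ (proj₂ (cl (λ ())))) (proj₂ (proj₂ (cl (λ ())))) }

-- A recolouring of the types that identifies θ and θ′ makes the clique of (θ , θ′) monochromatic.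
module MixedCliques (r t : ℕ) where
  private
    T′ : ℕ
    T′ = 3 + t
    W : Set
    W = Fin r × Fin r × Fin T′

    -- Type `θ′` forms a spanning star with centre `zero`, type `θ` a complete graph on the other
    -- vertices. On three or more vertices neither is the whole clique.
    mixed-type : Fin r → Fin r → Fin T′ → Fin T′ → Fin r
    mixed-type θ θ′ zero _ = θ′
    mixed-type θ θ′ (suc _) zero = θ′
    mixed-type θ θ′ (suc _) (suc _) = θ

    mixed-type-sym : ∀ θ θ′ k k′ → mixed-type θ θ′ k k′ ≡ mixed-type θ θ′ k′ k
    mixed-type-sym θ θ′ zero zero = refl
    mixed-type-sym θ θ′ zero (suc _) = refl
    mixed-type-sym θ θ′ (suc _) zero = refl
    mixed-type-sym θ θ′ (suc _) (suc _) = refl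

  MixedEdge : Fin r → W → W → Set
  MixedEdge β (θ , θ′ , k) (φ , φ′ , k′) = θ ≡ φ × θ′ ≡ φ′ × θ ≢ θ′ × k ≢ k′ × mixed-type θ θ′ k k′ ≡ β

  mixed-edge : ∀ {θ θ′ k k′} → θ ≢ θ′ → k ≢ k′ → ∃ λ β → (β ≡ θ ⊎ β ≡ θ′) × MixedEdge β (θ , θ′ , k) (θ , θ′ , k′)
  mixed-edge {k = zero} ne ne′ = _ , inj₂ refl , refl , refl , ne , ne′ , refl
  mixed-edge {k = suc _} {zero} ne ne′ = _ , inj₂ refl , refl , refl , ne , ne′ , refl
  mixed-edge {k = suc _} {suc _} ne ne′ = _ , inj₁ refl , refl , refl , ne , ne′ , refl

  private
    free : ∀ {β} (f : Fin T′ → W) → ¬ (∀ {i j} → i ≢ j → MixedEdge β (f i) (f j))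
    free {β} f cl = by-type (β ≟ θ′)
      where
      θ = proj₁ (f zero)
      θ′ = proj₁ (proj₂ (f zero))
      k : Fin T′ → Fin T′
      k i = proj₂ (proj₂ (f i))
      θ≢θ′ : θ ≢ θ′
      θ≢θ′ = proj₁ (proj₂ (proj₂ (cl {zero} {suc zero} (λ ()))))
      same : ∀ i → proj₁ (f i) ≡ θ × proj₁ (proj₂ (f i)) ≡ θ′
      same zero = refl , refl
      same (suc i) = let (p , p′ , _) = cl {suc i} {zero} (λ ()) in p , p′
      k-distinct : ∀ {i j} → i ≢ j → k i ≢ k j
      k-distinct ne = proj₁ (proj₂ (proj₂ (proj₂ (cl ne))))
      type : ∀ {i j} → i ≢ j → mixed-type θ θ′ (k i) (k j) ≡ β
      type {i} {j} ne = trans (cong₂ (λ a b → mixed-type a b (k i) (k j)) (sym (proj₁ (same i))) (sym (proj₂ (same i))))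
                              (proj₂ (proj₂ (proj₂ (proj₂ (cl ne)))))
      one-zero : β ≡ θ′ → ∀ x y → mixed-type θ θ′ x y ≡ β → x ≡ zero ⊎ y ≡ zero
      one-zero eq zero _ _ = inj₁ refl
      one-zero eq (suc _) zero _ = inj₂ refl
      one-zero eq (suc _) (suc _) p = ⊥-elim (θ≢θ′ (trans p eq))
      no-zero : β ≢ θ′ → ∀ x y → mixed-type θ θ′ x y ≡ β → ∃ λ x′ → x ≡ suc x′
      no-zero ne zero y p = ⊥-elim (ne (sym p))
      no-zero ne (suc x) y p = x , refl
      other : ∀ (i : Fin T′) → ∃ λ j → i ≢ j
      other zero = suc zero , λ ()
      other (suc _) = zero , λ ()
      i₀ i₁ i₂ : Fin T′
      i₀ = zero
      i₁ = suc zero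
      i₂ = suc (suc zero)
      by-type : Dec (β ≡ θ′) → ⊥
      by-type (yes eq) = zeros (one-zero eq (k i₀) (k i₁) (type (λ ()))) (one-zero eq (k i₀) (k i₂) (type (λ ())))
                               (one-zero eq (k i₁) (k i₂) (type (λ ())))
        where
        clash : ∀ {i j} → i ≢ j → k i ≡ zero → k j ≡ zero → ⊥
        clash ne p q = k-distinct ne (trans p (sym q))
        zeros : (k i₀ ≡ zero ⊎ k i₁ ≡ zero) → (k i₀ ≡ zero ⊎ k i₂ ≡ zero) → (k i₁ ≡ zero ⊎ k i₂ ≡ zero) → ⊥
        zeros (inj₁ p) _ (inj₁ q) = clash {i₀} {i₁} (λ ()) p q
        zeros (inj₁ p) _ (inj₂ q) = clash {i₀} {i₂} (λ ()) p q
        zeros (inj₂ p) (inj₁ q) _ = clash {i₁} {i₀} (λ ()) p q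
        zeros (inj₂ p) (inj₂ q) _ = clash {i₁} {i₂} (λ ()) p q
      by-type (no ne) = no-injection ℕₚ.≤-refl (λ i → proj₁ (positive i)) inj
        where
        positive : ∀ i → ∃ λ x → k i ≡ suc x
        positive i = no-zero ne (k i) (k (proj₁ (other i))) (type (proj₂ (other i)))
        inj : Inj (λ i → proj₁ (positive i))
        inj {x} {y} eq with x ≟ y
        ... | yes p = p
        ... | no x≢y = ⊥-elim (k-distinct x≢y (trans (proj₂ (positive x)) (trans (cong suc eq) (sym (proj₂ (positive y))))))

  mixed-cliques : Typed r T′
  mixed-cliques = record
    { Vertex = W ; vertex-enum = Fin-enum r ×-enum Fin-enum r ×-enum Fin-enum T′
    ; Edge = MixedEdge
    ; edge? = λ β (θ , θ′ , k) (φ , φ′ , k′) →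
        (θ ≟ φ) ×-dec (θ′ ≟ φ′) ×-dec ¬? (θ ≟ θ′) ×-dec ¬? (k ≟ k′) ×-dec (mixed-type θ θ′ k k′ ≟ β)
    ; edge-sym = λ { {_} {θ , θ′ , k} {_ , _ , k′} (refl , refl , ne , ne′ , p) →
        refl , refl , ne , ne′ ∘ sym , trans (mixed-type-sym θ θ′ k′ k) p }
    ; edge-irrefl = λ (_ , _ , _ , ne , _) → ne refl
    ; edge-unique = λ (_ , _ , _ , _ , p) (_ , _ , _ , _ , p′) → trans (sym p) p′
    ; clique-free = free }

-- Cycle colours on complete graphs and on sparse hypergraphs

-- Merging equal consecutive hyperedges turns the cycle into a walk of at most `ℓ` steps back to its
-- start. If two or more steps remained, the girth would be violated; the first and the last
-- hyperedge may coincide, which `Girth>` allows.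
module OneHyperedge {m′ : ℕ} (m : ℕ) (U : Hypergraph m′) {g : ℕ} (ℓ≤g : suc m ≤ g) (U-girth : Girth> U g)
  (u : Fin (suc m) → V U) (u-injective : Inj u) (e : Fin (suc m) → E U)
  (u∈e : ∀ i → _∈ₑ_ U (u i) (e i)) (u⁺∈e : ∀ i → _∈ₑ_ U (u (Cycle.next m i)) (e i)) where
  open Cycle m
  private
    ū : ℕ → V U
    ū k = u (at k)
    ē : ℕ → E U
    ē k = e (at k)

    ū⁺∈ē : ∀ k → _∈ₑ_ U (ū (suc k)) (ē k)
    ū⁺∈ē k = subst (λ i → _∈ₑ_ U (u i) (ē k)) (at-suc k) (u⁺∈e (at k))

    distinct : ∀ {j k} → j < k → k < j + ℓ → ū j ≢ ū k
    distinct j<k k< eq = at-distinct j<k k< (u-injective eq)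

    closed : ū 0 ≡ ū ℓ
    closed = cong u (Finₚ.toℕ-injective (trans (toℕ-at 0) (sym (trans (toℕ-at ℓ) (n%n≡0 ℓ)))))

  -- From k on, the cycle stays in one edge up to position k′, where a walk to the end starts unless k′ = ℓ.
  record From (k : ℕ) : Set where
    field
      k′ : ℕ
      k<k′ : k < k′
      k′≤ℓ : k′ ≤ ℓ
      same : ∀ i → k ≤ i → i < k′ → ē i ≡ ē k
      member : _∈ₑ_ U (ū k′) (ē k)
      onwards : k′ ≡ ℓ ⊎ (k′ < ℓ × ē k ≢ ē k′ × ∃ λ r → Walk U (ū k′) (ē k′) (ū ℓ) r × r + k′ ≤ ℓ)

  from-position : ∀ j k → k + suc j ≡ ℓ → From k
  from-position zero k eq = record
    { k′ = suc k ; k<k′ = ℕₚ.≤-refl ; k′≤ℓ = ℕₚ.≤-reflexive k+1≡ℓ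
    ; same = λ i k≤i i<k′ → cong ē (ℕₚ.≤-antisym (ℕₚ.≤-pred i<k′) k≤i)
    ; member = ū⁺∈ē k ; onwards = inj₁ k+1≡ℓ }
    where
    k+1≡ℓ : suc k ≡ ℓ
    k+1≡ℓ = trans (ℕₚ.+-comm 1 k) eq
  from-position (suc j) k eq with from-position j (suc k) (trans (sym (ℕₚ.+-suc k (suc j))) eq) | dec-≡ (E-enum U) (ē k) (ē (suc k))
  ... | F | yes q = record
    { k′ = k′ ; k<k′ = ℕₚ.<-trans ℕₚ.≤-refl k<k′ ; k′≤ℓ = k′≤ℓ ; same = same′
    ; member = subst (_∈ₑ_ U (ū k′)) (sym q) member
    ; onwards = [ inj₁ , (λ (lt , ne , rest) → inj₂ (lt , ne ∘ trans (sym q) , rest)) ]′ onwards }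
    where
    open From F
    same′ : ∀ i → k ≤ i → i < k′ → ē i ≡ ē k
    same′ i k≤i i<k′ with ℕₚ.m≤n⇒m<n∨m≡n k≤i
    ... | inj₁ k<i = trans (same i k<i i<k′) (sym q)
    ... | inj₂ refl = refl
  ... | F | no ne = record
    { k′ = suc k ; k<k′ = ℕₚ.≤-refl ; k′≤ℓ = ℕₚ.<⇒≤ k+1<ℓ
    ; same = λ i k≤i i<k′ → cong ē (ℕₚ.≤-antisym (ℕₚ.≤-pred i<k′) k≤i)
    ; member = ū⁺∈ē k ; onwards = inj₂ (k+1<ℓ , ne , walk onwards) }
    where
    open From F
    k+1<ℓ : suc k < ℓ
    k+1<ℓ = ℕₚ.<-≤-trans k<k′ k′≤ℓ
    k′<ℓ+ : k′ < suc k + ℓ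
    k′<ℓ+ = ℕₚ.≤-<-trans k′≤ℓ (ℕₚ.m<n+m ℓ (s≤s z≤n))
    walk : (k′ ≡ ℓ ⊎ (k′ < ℓ × ē (suc k) ≢ ē k′ × ∃ λ r → Walk U (ū k′) (ē k′) (ū ℓ) r × r + k′ ≤ ℓ)) →
      ∃ λ r → Walk U (ū (suc k)) (ē (suc k)) (ū ℓ) r × r + suc k ≤ ℓ
    walk (inj₁ eq) = 1 , one (u∈e (at (suc k))) (subst (λ i → _∈ₑ_ U (ū i) (ē (suc k))) eq member)
      (subst (λ i → ū (suc k) ≢ ū i) eq (distinct k<k′ k′<ℓ+)) , k+1<ℓ
    walk (inj₂ (_ , ne′ , r , W , le)) = suc r ,
      step (u∈e (at (suc k))) member (distinct k<k′ k′<ℓ+) ne′ W ,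
      ℕₚ.≤-trans (subst (_≤ r + k′) (ℕₚ.+-suc r (suc k)) (ℕₚ.+-monoʳ-≤ r k<k′)) le

  one-edge : ∀ i → e i ≡ e zero
  one-edge i = trans (cong e (sym (at-toℕ i))) (go onwards)
    where
    open From (from-position m 0 refl)
    go : (k′ ≡ ℓ ⊎ (k′ < ℓ × ē 0 ≢ ē k′ × ∃ λ r → Walk U (ū k′) (ē k′) (ū ℓ) r × r + k′ ≤ ℓ)) → ē (toℕ i) ≡ e zero
    go (inj₁ eq) = trans (same (toℕ i) z≤n (subst (toℕ i <_) (sym eq) (Finₚ.toℕ<n i))) (cong e (at-toℕ zero))
    go (inj₂ (k′<ℓ , ne , r , W , le)) = ⊥-elim (U-girth
      (step (u∈e (at 0)) member (distinct k<k′ k′<ℓ) ne W) (s≤s (walk-length>0 U W))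
      (ℕₚ.≤-trans (ℕₚ.≤-trans (subst (_≤ r + k′) (ℕₚ.+-comm r 1) (ℕₚ.+-monoʳ-≤ r k<k′)) le) ℓ≤g) closed)

module CycleColourings (q₁ q₂ m : ℕ) (2≤ℓ : 2 ≤ suc m) where
  open Cycle m

  MonoCycle : ∀ {k} → (Fin k → Fin k → Fin (q₁ + suc q₂)) → Fin q₁ → (Fin ℓ → Fin k) → Set
  MonoCycle κ j f = Inj f × (∀ i → κ (f i) (f (next i)) ≡ j ↑ˡ suc q₂)

  CycleFree : ∀ k → (Fin k → Fin k → Fin (q₁ + suc q₂)) → Set
  CycleFree k κ = (∀ u v → κ u v ≡ κ v u) × (∀ u v → u ≢ v → ∃ λ j → κ u v ≡ j ↑ˡ suc q₂) ×
                  (∀ j f → ¬ MonoCycle κ j f)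

  private
    Fc = Fin-enum (q₁ + suc q₂)

    mono-cycle? : ∀ {k} (κ : Fin k → Fin k → Fin (q₁ + suc q₂)) j f → Dec (MonoCycle κ j f)
    mono-cycle? {k} κ j f = injective? (Fin-enum k) f ×-dec ∀? (Fin-enum ℓ) λ i → κ (f i) (f (next i)) ≟ j ↑ˡ suc q₂

    mono-cycle-resp : ∀ {k} (κ : Fin k → Fin k → Fin (q₁ + suc q₂)) {j f g} → f ≗ g → MonoCycle κ j f → MonoCycle κ j g
    mono-cycle-resp κ eq (inj , h) = (λ {x} {y} e → inj (trans (eq x) (trans e (sym (eq y))))) ,
      λ i → trans (sym (cong₂ κ (eq i) (eq (next i)))) (h i)

    mono-cycle-resp₂ : ∀ {k} {κ κ′ : Fin k → Fin k → Fin (q₁ + suc q₂)} {j f} → (∀ u v → κ u v ≡ κ′ u v) →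
      MonoCycle κ j f → MonoCycle κ′ j f
    mono-cycle-resp₂ eq (inj , h) = inj , λ i → trans (sym (eq _ _)) (h i)

    mono-exists? : ∀ {k} (κ : Fin k → Fin k → Fin (q₁ + suc q₂)) → Dec (∃ λ j → ∃ (MonoCycle κ j))
    mono-exists? {k} κ = ∃? (Fin-enum q₁) λ j → ∃-function? (Fin-enum k) (mono-cycle-resp κ) (mono-cycle? κ j)

  cycle-free? : ∀ k → Dec (∃ (CycleFree k))
  cycle-free? k = ∃-matrix? Fc
    (λ eq (s , w , h) → (λ u v → trans (sym (eq u v)) (trans (s u v) (eq v u))) ,
      (λ u v ne → let (j , p) = w u v ne in j , trans (sym (eq u v)) p) ,
      λ j f M → h j f (mono-cycle-resp₂ (λ u v → sym (eq u v)) M))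
    (λ κ → (∀? (Fin-enum k) λ u → ∀? (Fin-enum k) λ v → κ u v ≟ κ v u) ×-dec
      (∀? (Fin-enum k) λ u → ∀? (Fin-enum k) λ v → ¬? (u ≟ v) →-dec ∃? (Fin-enum q₁) λ j → κ u v ≟ j ↑ˡ suc q₂) ×-dec
      Dec.map′ (λ ne j f M → ne (j , f , M)) (λ h (j , f , M) → h j f M) (¬? (mono-exists? κ)))

  not-always : ∃ λ R → ¬ ∃ (CycleFree R)
  not-always with ramsey-pairs Fc ℓ
  ... | (R , ramsey) = R , λ (κ , κ-sym , κ-cycle , h) → go κ κ-sym κ-cycle h (ramsey κ)
    where
    go : ∀ κ → (∀ u v → κ u v ≡ κ v u) → (∀ u v → u ≢ v → ∃ λ j → κ u v ≡ j ↑ˡ suc q₂) →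
      (∀ j f → ¬ MonoCycle κ j f) →
      Σ[ η ∈ (Fin ℓ → Fin R) ] Increasing η × Σ[ c ∈ Fin (q₁ + suc q₂) ] (∀ {x y} → x <ᶠ y → κ (η x) (η y) ≡ c) → ⊥
    go κ κ-sym κ-cycle h (η , η-inc , c , mono) = h (proj₁ first) η (η-inj , λ i → trans (edge i) c-first)
      where
      η-inj = increasing⇒injective η η-inc
      edge : ∀ i → κ (η i) (η (next i)) ≡ c
      edge i with ℕₚ.<-cmp (toℕ i) (toℕ (next i))
      ... | tri< lt _ _ = mono lt
      ... | tri≈ _ ≈ _ = ⊥-elim (next≢ 2≤ℓ i (sym (Finₚ.toℕ-injective ≈)))
      ... | tri> _ _ gt = trans (κ-sym _ _) (mono gt)
      first : ∃ λ j → κ (η zero) (η (next zero)) ≡ j ↑ˡ suc q₂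
      first = κ-cycle _ _ (λ eq → next≢ 2≤ℓ zero (sym (η-inj eq)))
      c-first : c ≡ proj₁ first ↑ˡ suc q₂
      c-first = trans (sym (edge zero)) (proj₂ first)

  small : ∀ {k} → k < ℓ → k ≤ 1 → ∃ (CycleFree k)
  small {k} k<ℓ k≤1 = (λ _ _ → q₁ ↑ʳ zero) , (λ _ _ → refl) , (λ u v ne → ⊥-elim (ne (unique k≤1 u v))) ,
    λ j f (inj , _) → no-injection k<ℓ f inj
    where
    unique : ∀ {k} → k ≤ 1 → (u v : Fin k) → u ≡ v
    unique (s≤s z≤n) zero zero = refl

  extremal : ∃ λ w → ∃ (CycleFree (suc w)) × ¬ ∃ (CycleFree (2 + w))
  extremal with least (λ k → ¬? (cycle-free? k)) (proj₁ not-always) (proj₂ not-always)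
  ... | (zero , no-κ , _) = ⊥-elim (no-κ (small (s≤s z≤n) z≤n))
  ... | (suc zero , no-κ , _) = ⊥-elim (no-κ (small 2≤ℓ ℕₚ.≤-refl))
  ... | (suc (suc w) , no-κ , is-least) = w ,
    Dec.decidable-stable (cycle-free? (suc w)) (λ no-κ′ → ℕₚ.<-irrefl refl (is-least (suc w) no-κ′)) , no-κ

  join-vertex : ∀ {k} → (Fin k → Fin k → Fin (q₁ + suc q₂)) → Fin q₁ → Fin (suc k) → Fin (suc k) → Fin (q₁ + suc q₂)
  join-vertex κ j zero _ = j ↑ˡ suc q₂
  join-vertex κ j (suc _) zero = j ↑ˡ suc q₂
  join-vertex κ j (suc u) (suc v) = κ u v

  -- Join a new vertex in colour `j` throughout. As the larger complete graph has no good colouring,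
  -- a monochromatic cycle appears; it contains the new vertex because `κ` has no such cycle, and
  -- therefore its colour is `j`.
  through-new-vertex : ∀ {k} → ¬ ∃ (CycleFree (suc k)) → ∀ κ → CycleFree k κ → ∀ j →
    Σ[ f ∈ (Fin ℓ → Fin (suc k)) ] Inj f × (∃ λ i → f i ≡ zero) ×
    (∀ i u v → f i ≡ suc u → f (next i) ≡ suc v → κ u v ≡ j ↑ˡ suc q₂)
  through-new-vertex {k} none κ (κ-sym , κ-cycle , κ-free) j with mono-exists? (join-vertex κ j)
  ... | no ¬M = ⊥-elim (none (join-vertex κ j , sym⁺ , cycle⁺ , λ j′ f M → ¬M (j′ , f , M)))
    where
    sym⁺ : ∀ u v → join-vertex κ j u v ≡ join-vertex κ j v u
    sym⁺ zero zero = refl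
    sym⁺ zero (suc _) = refl
    sym⁺ (suc _) zero = refl
    sym⁺ (suc u) (suc v) = κ-sym u v
    cycle⁺ : ∀ u v → u ≢ v → ∃ λ j′ → join-vertex κ j u v ≡ j′ ↑ˡ suc q₂
    cycle⁺ zero _ _ = j , refl
    cycle⁺ (suc _) zero _ = j , refl
    cycle⁺ (suc u) (suc v) ne = κ-cycle u v (ne ∘ cong suc)
  ... | yes (j′ , f , f-inj , h) with Finₚ.any? (λ i → f i ≟ zero)
  ...   | no avoids = ⊥-elim (κ-free j′ (λ i → proj₁ (lower i))
            ((λ {x} {y} eq → f-inj (trans (proj₂ (lower x)) (trans (cong suc eq) (sym (proj₂ (lower y)))))) ,
             λ i → trans (sym (cong₂ (join-vertex κ j) (proj₂ (lower i)) (proj₂ (lower (next i))))) (h i)))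
    where
    lower : ∀ i → ∃ λ u → f i ≡ suc u
    lower i = go (f i) refl
      where
      go : ∀ x → f i ≡ x → ∃ λ u → f i ≡ suc u
      go zero eq = ⊥-elim (avoids (i , eq))
      go (suc u) eq = u , eq
  ...   | yes (i₀ , eq₀) = f , f-inj , (i₀ , eq₀) , λ i u v p p′ →
            trans (sym (cong₂ (join-vertex κ j) p p′)) (trans (h i)
              (trans (sym (h i₀)) (cong (λ z → join-vertex κ j z (f (next i₀))) eq₀)))

-- Blocks and stars

⌊⌋-cong : ∀ {P Q : Set} (P? : Dec P) (Q? : Dec Q) → (P → Q) → (Q → P) → ⌊ P? ⌋ ≡ ⌊ Q? ⌋
⌊⌋-cong (yes p) (yes q) _ _ = refl
⌊⌋-cong (no np) (no nq) _ _ = refl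
⌊⌋-cong (yes p) (no nq) f _ = ⊥-elim (nq (f p))
⌊⌋-cong (no np) (yes q) _ g = ⊥-elim (np (g q))

⌊⌋-true : ∀ {P : Set} (P? : Dec P) → ⌊ P? ⌋ ≡ true → P
⌊⌋-true (yes p) _ = p

true-⌊⌋ : ∀ {P : Set} (P? : Dec P) → P → ⌊ P? ⌋ ≡ true
true-⌊⌋ (yes _) _ = refl
true-⌊⌋ (no np) p = ⊥-elim (np p)

-- An enumeration may list an element several times; the vertices that are not of the form to x are isolated.
module FromRelation {W : Set} (e : Enum W) (A : W → W → Set) (A? : ∀ x y → Dec (A x y))
  (A-sym : ∀ {x y} → A x y → A y x) (A-irrefl : ∀ {x} → ¬ A x x) where

  Canonical : Fin (size e) → Set
  Canonical u = to e (from e u) ≡ u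

  Joined : Fin (size e) → Fin (size e) → Set
  Joined u v = Canonical u × Canonical v × A (from e u) (from e v)

  joined? : ∀ u v → Dec (Joined u v)
  joined? u v = (to e (from e u) ≟ u) ×-dec (to e (from e v) ≟ v) ×-dec A? (from e u) (from e v)

  joined-sym : ∀ {u v} → Joined u v → Joined v u
  joined-sym (p , p′ , a) = p′ , p , A-sym a

  graph : Graph
  graph = record
    { n = size e ; adj = λ u v → ⌊ joined? u v ⌋
    ; adj-sym = λ u v → ⌊⌋-cong (joined? u v) (joined? v u) joined-sym joined-sym
    ; adj-irref = λ v → irref v (joined? v v) }
    where
    irref : ∀ v (d : Dec (Joined v v)) → ⌊ d ⌋ ≡ false
    irref v (yes (_ , _ , a)) = ⊥-elim (A-irrefl a)
    irref v (no _) = refl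

  adj⇒joined : ∀ {u v} → adj graph u v ≡ true → Joined u v
  adj⇒joined {u} {v} = ⌊⌋-true (joined? u v)

  A⇒adj : ∀ {x y} → A x y → adj graph (to e x) (to e y) ≡ true
  A⇒adj {x} {y} a = true-⌊⌋ (joined? (to e x) (to e y))
    (cong (to e) (from-to e x) , cong (to e) (from-to e y) , subst₂ A (sym (from-to e x)) (sym (from-to e y)) a)

-- Every vertex of F is replaced by a copy of U (a block); a star is a new vertex with at most one neighbour in
-- each of d blocks. The first coordinate of a star only serves to duplicate it.
module Construction (q₁ q₂ m t d : ℕ) (4≤ℓ : 4 ≤ suc m) (F : Typed (suc q₂) (3 + t))
  {w : ℕ} (U : Hypergraph (suc w)) where
  open Cycle m public

  q : ℕ
  q = q₁ + suc q₂

  V₁ = Vertex F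
  VU = V U

  N₁ : ℕ
  N₁ = size (vertex-enum F)

  Star : Set
  Star = Vec VU (suc N₁) × Vec V₁ d

  W : Set
  W = (V₁ × VU) ⊎ Star

  W-enum : Enum W
  W-enum = (vertex-enum F ×-enum V-enum U) ⊎-enum (Vec-enum (V-enum U) (suc N₁) ×-enum Vec-enum (vertex-enum F) d)

  coord : Vec VU (suc N₁) → V₁ → VU
  coord X p = Vec.lookup X (suc (to (vertex-enum F) p))

  InOneEdge : VU → VU → Set
  InOneEdge x y = x ≢ y × ∃ λ e → _∈ₑ_ U x e × _∈ₑ_ U y e

  Sees : Star → V₁ × VU → Set
  Sees (X , φ) (p , x) = ∃ λ a → Vec.lookup φ a ≡ p × coord X p ≡ x

  A : W → W → Set
  A (inj₁ (p , x)) (inj₁ (p′ , x′)) = (p ≡ p′ × InOneEdge x x′) ⊎ (∃ λ β → Edge F β p p′)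
  A (inj₁ v) (inj₂ s) = Sees s v
  A (inj₂ s) (inj₁ v) = Sees s v
  A (inj₂ _) (inj₂ _) = ⊥

  NoCycle NoClique : (W → W → Fin q) → Set
  NoCycle χ = ∀ j (f : Fin ℓ → W) → Inj f → ¬ (∀ i → A (f i) (f (next i)) × χ (f i) (f (next i)) ≡ j ↑ˡ suc q₂)
  NoClique χ = ∀ β (f : Fin (3 + t) → W) → ¬ (∀ {i j} → i ≢ j → A (f i) (f j) × χ (f i) (f j) ≡ q₁ ↑ʳ β)

  in-one-edge? : ∀ x y → Dec (InOneEdge x y)
  in-one-edge? x y = ¬? (dec-≡ (V-enum U) x y) ×-dec ∃? (E-enum U) λ e → member? x e ×-dec member? y e
    where
    member? : ∀ x e → Dec (_∈ₑ_ U x e)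
    member? x e = Finₚ.any? λ i → dec-≡ (V-enum U) (inc U e i) x

  sees? : ∀ s v → Dec (Sees s v)
  sees? (X , φ) (p , x) = Finₚ.any? λ a → dec-≡ (vertex-enum F) (Vec.lookup φ a) p ×-dec dec-≡ (V-enum U) (coord X p) x

  A? : ∀ x y → Dec (A x y)
  A? (inj₁ (p , x)) (inj₁ (p′ , x′)) = (dec-≡ (vertex-enum F) p p′ ×-dec in-one-edge? x x′) ⊎-dec
                                       ∃? (Fin-enum (suc q₂)) λ β → edge? F β p p′
  A? (inj₁ v) (inj₂ s) = sees? s v
  A? (inj₂ s) (inj₁ v) = sees? s v
  A? (inj₂ _) (inj₂ _) = no λ ()

  A-sym : ∀ {x y} → A x y → A y x
  A-sym {inj₁ _} {inj₁ _} (inj₁ (eq , ne , e , a , b)) = inj₁ (sym eq , ne ∘ sym , e , b , a)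
  A-sym {inj₁ _} {inj₁ _} (inj₂ (β , e)) = inj₂ (β , edge-sym F e)
  A-sym {inj₁ _} {inj₂ _} a = a
  A-sym {inj₂ _} {inj₁ _} a = a

  A-irrefl : ∀ {x} → ¬ A x x
  A-irrefl {inj₁ _} (inj₁ (_ , ne , _)) = ne refl
  A-irrefl {inj₁ _} (inj₂ (β , e)) = edge-irrefl F e

  open FromRelation W-enum A A? A-sym A-irrefl public

  vertex : Fin (size W-enum) → W
  vertex = from W-enum

  vertex-injective : ∀ {u v} → Canonical u → Canonical v → vertex u ≡ vertex v → u ≡ v
  vertex-injective p p′ eq = trans (sym p) (trans (cong (to W-enum) eq) p′)

  -- A neighbour is determined by an index `a` at which `φ` names its block, since `X` fixes one
  -- vertex per block. Repeated blocks only lower the degree.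
  star-degree : ∀ G′ ((f , _) : Subgraph G′ graph) x {s} → vertex (f x) ≡ inj₂ s → deg G′ x ≤ d
  star-degree G′ (f , f-inj , f-adj) x {s} eq = deg-≤ G′ x (λ a → proj₁ (seen a)) same
    where
    seen : ∀ {y} → adj G′ x y ≡ true → ∃ λ a → ∃ λ v → vertex (f y) ≡ inj₁ v × Vec.lookup (proj₂ s) a ≡ proj₁ v ×
      coord (proj₁ s) (proj₁ v) ≡ proj₂ v
    seen {y} a = go (vertex (f y)) (subst (λ z → A z (vertex (f y))) eq (proj₂ (proj₂ (adj⇒joined (f-adj x y a)))))
      where
      go : ∀ z → A (inj₂ s) z → ∃ λ a → ∃ λ v → z ≡ inj₁ v × Vec.lookup (proj₂ s) a ≡ proj₁ v ×
        coord (proj₁ s) (proj₁ v) ≡ proj₂ v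
      go (inj₁ v) (a , p , p′) = a , v , refl , p , p′
    same : ∀ {y z} (a : adj G′ x y ≡ true) (b : adj G′ x z ≡ true) → proj₁ (seen a) ≡ proj₁ (seen b) → y ≡ z
    same {y} {z} a b i≡j with seen a | seen b | i≡j
    ... | (i , (p , u) , ey , py , uy) | (_ , (p′ , u′) , ez , pz , uz) | refl =
      f-inj (vertex-injective (proj₁ (proj₂ (adj⇒joined (f-adj x y a)))) (proj₁ (proj₂ (adj⇒joined (f-adj x z b))))
        (trans ey (trans (cong inj₁ (cong₂ _,_ p≡p′ (trans (sym uy) (trans (cong (coord (proj₁ s)) p≡p′) uz)))) (sym ez))))
      where
      p≡p′ : p ≡ p′
      p≡p′ = trans (sym py) pz

  -- The good colouring uses `κ` on the hyperedges and the types between blocks. A cycle in a cycle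
  -- colour cannot leave its block and, by the girth, not its hyperedge; a clique in a clique colour
  -- projects to a clique of one type in `F`.
  module WithoutStars {g} (ℓ≤g : ℓ ≤ g) (U-girth : Girth> U g)
    (κ : Fin (suc w) → Fin (suc w) → Fin q)
    (κ-ok : CycleColourings.CycleFree q₁ q₂ m (ℕₚ.≤-trans (s≤s (s≤s z≤n)) 4≤ℓ) (suc w) κ)
    (G′ : Graph) (sub : Subgraph G′ graph) (avoids : ∀ x {s} → vertex (proj₁ sub x) ≢ inj₂ s) where
    private
      f = proj₁ sub
      f-inj = proj₁ (proj₂ sub)
      f-adj = proj₂ (proj₂ sub)
      EF = vertex-enum F

    locate : ∀ x → ∃ λ v → vertex (f x) ≡ inj₁ v
    locate x = go (vertex (f x)) (avoids x)
      where
      go : ∀ z → (∀ {s} → z ≢ inj₂ s) → ∃ λ v → z ≡ inj₁ v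
      go (inj₁ v) _ = v , refl
      go (inj₂ s) ne = ⊥-elim (ne refl)

    pos : Fin (n G′) → V₁ × VU
    pos x = proj₁ (locate x)

    Inside Between Coloured : Fin q → V₁ × VU → V₁ × VU → Set
    Inside k (p , x) (p′ , x′) = p ≡ p′ × x ≢ x′ × ∃ λ e → ∃ λ i → ∃ λ i′ →
      inc U e i ≡ x × inc U e i′ ≡ x′ × κ i i′ ≡ k
    Between k (p , x) (p′ , x′) = ∃ λ β → Edge F β p p′ × k ≡ q₁ ↑ʳ β
    Coloured k v v′ = Inside k v v′ ⊎ Between k v v′

    coloured-sym : ∀ {k v v′} → Coloured k v v′ → Coloured k v′ v
    coloured-sym (inj₁ (p , ne , e , i , i′ , a , a′ , k)) =
      inj₁ (sym p , ne ∘ sym , e , i′ , i , a′ , a , trans (proj₁ κ-ok i′ i) k)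
    coloured-sym (inj₂ (β , e , k)) = inj₂ (β , edge-sym F e , k)

    abstract
      coloured? : ∀ v v′ → Dec (∃ λ k → Coloured k v v′)
      coloured? (p , x) (p′ , x′) = ∃? (Fin-enum q) λ k →
        (dec-≡ EF p p′ ×-dec ¬? (dec-≡ (V-enum U) x x′) ×-dec ∃? (E-enum U) λ e → Finₚ.any? λ i → Finₚ.any? λ i′ →
          dec-≡ (V-enum U) (inc U e i) x ×-dec dec-≡ (V-enum U) (inc U e i′) x′ ×-dec (κ i i′ ≟ k)) ⊎-dec
        (∃? (Fin-enum (suc q₂)) λ β → edge? F β p p′ ×-dec (k ≟ q₁ ↑ʳ β))

    adjacent⇒coloured : ∀ {v v′} → A (inj₁ v) (inj₁ v′) → ∃ λ k → Coloured k v v′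
    adjacent⇒coloured (inj₁ (p , ne , e , (i , a) , (i′ , a′))) = κ i i′ , inj₁ (p , ne , e , i , i′ , a , a′ , refl)
    adjacent⇒coloured (inj₂ (β , e)) = q₁ ↑ʳ β , inj₂ (β , e , refl)

    pick : ∀ {v v′} → Dec (∃ λ k → Coloured k v v′) → Fin q
    pick (yes (k , _)) = k
    pick (no _) = q₁ ↑ʳ zero

    pick-coloured : ∀ {v v′} (D : Dec (∃ λ k → Coloured k v v′)) → A (inj₁ v) (inj₁ v′) → Coloured (pick D) v v′
    pick-coloured (yes (_ , h)) _ = h
    pick-coloured (no none) a = ⊥-elim (none (adjacent⇒coloured a))

    typed-colouring : Colouring G′ q
    typed-colouring = colouring G′ (λ y z → pick (coloured? (pos y) (pos z)))

    pos-adjacent : ∀ {y z} → adj G′ y z ≡ true → A (inj₁ (pos y)) (inj₁ (pos z))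
    pos-adjacent {y} {z} a = subst₂ A (proj₂ (locate y)) (proj₂ (locate z)) (proj₂ (proj₂ (adj⇒joined (f-adj y z a))))

    edge-coloured : ∀ {y z} → adj G′ y z ≡ true → Coloured (col typed-colouring y z) (pos y) (pos z)
    edge-coloured {y} {z} a = either (symmetrise-either s y z)
      where
      s : Fin (n G′) → Fin (n G′) → Fin q
      s y z = pick (coloured? (pos y) (pos z))
      either : symmetrise s y z ≡ s y z ⊎ symmetrise s y z ≡ s z y → Coloured (symmetrise s y z) (pos y) (pos z)
      either (inj₁ eq) = subst (λ k → Coloured k (pos y) (pos z)) (sym eq)
        (pick-coloured (coloured? (pos y) (pos z)) (pos-adjacent a))
      either (inj₂ eq) = subst (λ k → Coloured k (pos y) (pos z)) (sym eq) (coloured-sym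
        (pick-coloured (coloured? (pos z) (pos y)) (A-sym {inj₁ (pos y)} {inj₁ (pos z)} (pos-adjacent a))))

    pos-injective : ∀ {y z} → (∃ λ y′ → adj G′ y y′ ≡ true) → (∃ λ z′ → adj G′ z z′ ≡ true) → pos y ≡ pos z → y ≡ z
    pos-injective {y} {z} (y′ , a) (z′ , b) eq = f-inj (vertex-injective
      (proj₁ (adj⇒joined (f-adj y y′ a))) (proj₁ (adj⇒joined (f-adj z z′ b)))
      (trans (proj₂ (locate y)) (trans (cong inj₁ eq) (sym (proj₂ (locate z))))))

    no-cycle : ∀ j → ¬ MonoCopy (C ℓ) G′ typed-colouring (j ↑ˡ suc q₂)
    no-cycle j (h , h-inj , e) = proj₂ (proj₂ κ-ok) j (λ i → ix i) (ix-inj , κ-mono)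
      where
      2≤ℓ : 2 ≤ ℓ
      2≤ℓ = ℕₚ.≤-trans (s≤s (s≤s z≤n)) 4≤ℓ
      edge : ∀ i → adj G′ (h i) (h (next i)) ≡ true × col typed-colouring (h i) (h (next i)) ≡ j ↑ˡ suc q₂
      edge i = e i (next i) (C-adj-next 2≤ℓ i)
      inside : ∀ i → Inside (j ↑ˡ suc q₂) (pos (h i)) (pos (h (next i)))
      inside i with subst (λ k → Coloured k (pos (h i)) (pos (h (next i)))) (proj₂ (edge i)) (edge-coloured (proj₁ (edge i)))
      ... | inj₁ p = p
      ... | inj₂ (β , _ , eq) = ⊥-elim (cycle≢clique-colour eq)
      block : ∀ i → proj₁ (pos (h i)) ≡ proj₁ (pos (h zero))
      block = constant-on-cycle (λ i → proj₁ (pos (h i))) (λ i → proj₁ (inside i))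
      u : Fin ℓ → VU
      u i = proj₂ (pos (h i))
      u-inj : Inj u
      u-inj {x} {y} eq = h-inj (pos-injective (_ , proj₁ (edge x)) (_ , proj₁ (edge y))
        (cong₂ _,_ (trans (block x) (sym (block y))) eq))
      hyperedge : Fin ℓ → E U
      hyperedge i = proj₁ (proj₂ (proj₂ (inside i)))
      ix : Fin ℓ → Fin (suc w)
      ix i = proj₁ (proj₂ (proj₂ (proj₂ (inside i))))
      ix⁺ : Fin ℓ → Fin (suc w)
      ix⁺ i = proj₁ (proj₂ (proj₂ (proj₂ (proj₂ (inside i)))))
      ix-at : ∀ i → inc U (hyperedge i) (ix i) ≡ u i
      ix-at i = proj₁ (proj₂ (proj₂ (proj₂ (proj₂ (proj₂ (inside i))))))
      ix⁺-at : ∀ i → inc U (hyperedge i) (ix⁺ i) ≡ u (next i)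
      ix⁺-at i = proj₁ (proj₂ (proj₂ (proj₂ (proj₂ (proj₂ (proj₂ (inside i)))))))
      one-edge : ∀ i → hyperedge i ≡ hyperedge zero
      one-edge = OneHyperedge.one-edge m U ℓ≤g U-girth u (λ {x} {y} → u-inj {x} {y}) hyperedge
        (λ i → ix i , ix-at i) (λ i → ix⁺ i , ix⁺-at i)
      ix-inj : Inj ix
      ix-inj {x} {y} eq = u-inj {x} {y} (trans (sym (ix-at x))
        (trans (cong₂ (inc U) (trans (one-edge x) (sym (one-edge y))) eq) (ix-at y)))
      ix-next : ∀ i → ix⁺ i ≡ ix (next i)
      ix-next i = inc-injective U (hyperedge i) (trans (ix⁺-at i) (trans (sym (ix-at (next i)))
        (cong (λ z → inc U z (ix (next i))) (trans (one-edge (next i)) (sym (one-edge i))))))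
      κ-mono : ∀ i → κ (ix i) (ix (next i)) ≡ j ↑ˡ suc q₂
      κ-mono i = trans (cong (κ (ix i)) (sym (ix-next i))) (proj₂ (proj₂ (proj₂ (proj₂ (proj₂ (proj₂ (proj₂ (inside i))))))))

    no-clique : ∀ β → ¬ MonoCopy (K (3 + t)) G′ typed-colouring (q₁ ↑ʳ β)
    no-clique β (h , h-inj , e) = clique-free F (λ i → proj₁ (pos (h i))) (λ ne → between ne)
      where
      between : ∀ {i j} → i ≢ j → Edge F β (proj₁ (pos (h i))) (proj₁ (pos (h j)))
      between {i} {j} ne with e i j (K-adj ne)
      ... | (a , eq) with subst (λ k → Coloured k (pos (h i)) (pos (h j))) eq (edge-coloured a)
      ...   | inj₂ (β′ , e′ , eq′) = subst (λ β → Edge F β _ _) (Finₚ.↑ʳ-injective q₁ β′ β (sym eq′)) e′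
      ...   | inj₁ (_ , x≢ , ē , i′ , j′ , a′ , b′ , k) =
        ⊥-elim (cycle≢clique-colour (trans
          (sym (proj₂ (proj₁ (proj₂ κ-ok) i′ j′ λ eq′ → x≢ (trans (sym a′) (trans (cong (inc U ē) eq′) b′))))) k))

    not-ramsey : ¬ IsRamsey q (𝒯 q₁ (suc q₂) ℓ (3 + t)) G′
    not-ramsey R with R typed-colouring
    ... | (k , M) with colour-view q₁ (suc q₂) k
    ...   | inj₁ (j , refl) = no-cycle j (subst (λ H → MonoCopy H G′ typed-colouring (j ↑ˡ suc q₂)) (𝒯-cycle q₁ (suc q₂) ℓ _ j) M)
    ...   | inj₂ (β , refl) = no-clique β (subst (λ H → MonoCopy H G′ typed-colouring (q₁ ↑ʳ β)) (𝒯-clique q₁ (suc q₂) ℓ _ β) M)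

module PatternGraph (r t d m : ℕ) (4≤ℓ : 4 ≤ suc m) (τ : Fin d → Fin d → Maybe (Fin r))
  (τ-sym : ∀ a b → τ a b ≡ τ b a)
  (τ-free : ∀ β (f : Fin (3 + t) → Fin d) → ¬ (∀ i j → i ≢ j → τ (f i) (f j) ≡ just β)) where

  pattern-graph : Typed r (3 + t)
  pattern-graph = typed-sum (typed-sum (Pendants.pendants τ τ-sym τ-free) (TypedCycles.typed-cycles r t m 4≤ℓ))
                            (MixedCliques.mixed-cliques r t)

  ι : Fin d → Vertex pattern-graph
  ι a = inj₁ (inj₁ (inj₁ a))

  pendant : Fin d → Fin r → Fin (suc t) → Vertex pattern-graph
  pendant a β i = inj₁ (inj₁ (inj₂ (a , β , i)))

  on-cycle : Fin r → Fin (suc m) → Vertex pattern-graph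
  on-cycle β i = inj₁ (inj₂ (β , i))

  mixed : Fin r → Fin r → Fin (3 + t) → Vertex pattern-graph
  mixed θ θ′ k = inj₂ (θ , θ′ , k)

from-ordered : ∀ {k} {B : Set} {R : B → B → Set} → (∀ {x y} → R x y → R y x) → (f : Fin k → B) →
  (∀ {i j} → i <ᶠ j → R (f i) (f j)) → ∀ {i j} → i ≢ j → R (f i) (f j)
from-ordered R-sym f h {i} {j} ne with ℕₚ.<-cmp (toℕ i) (toℕ j)
... | tri< lt _ _ = h lt
... | tri≈ _ ≈ _ = ⊥-elim (ne (Finₚ.toℕ-injective ≈))
... | tri> _ _ gt = R-sym (h gt)

module StarsForce (q₁ q₂ m t d : ℕ) (4≤ℓ : 4 ≤ suc m) (τ : Fin d → Fin d → Maybe (Fin (suc q₂)))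
  (τ-sym : ∀ a b → τ a b ≡ τ b a)
  (τ-free : ∀ β (f : Fin (3 + t) → Fin d) → ¬ (∀ i j → i ≢ j → τ (f i) (f j) ≡ just β))
  (conflict : ∀ c → Conflict q₁ (suc q₂) (2 + t) d τ c)
  (F : Typed (suc q₂) (3 + t)) {w : ℕ} (U : Hypergraph (suc w))
  (extremal : ¬ ∃ (CycleColourings.CycleFree q₁ q₂ m (ℕₚ.≤-trans (s≤s (s≤s z≤n)) 4≤ℓ) (suc (suc w))))
  (χ : Construction.W q₁ q₂ m t d 4≤ℓ F U → Construction.W q₁ q₂ m t d 4≤ℓ F U → Fin (q₁ + suc q₂))
  (χ-sym : ∀ x y → χ x y ≡ χ y x) where
  open Construction q₁ q₂ m t d 4≤ℓ F U
  open PatternGraph (suc q₂) t d m 4≤ℓ τ τ-sym τ-free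
  private
    L = pattern-graph
    EF = vertex-enum F
    2≤ℓ : 2 ≤ ℓ
    2≤ℓ = ℕₚ.≤-trans (s≤s (s≤s z≤n)) 4≤ℓ
    3≤ℓ : 3 ≤ ℓ
    3≤ℓ = ℕₚ.≤-trans (ℕₚ.n≤1+n 3) 4≤ℓ
    Φ = Vec-enum EF d

  -- Everything that is to become independent of the choice of one vertex per block: the colours
  -- between the chosen vertices, and those at the star of this choice for every selection of `d`
  -- blocks.
  Info : Set
  Info = Vec (Vec (Fin q) N₁) N₁ × Vec (Vec (Fin q) d) (size Φ)

  block-vertex : Vec VU (suc N₁) → V₁ → W
  block-vertex X p = inj₁ (p , coord X p)

  info : Vec VU (suc N₁) → Info
  info X = tabulate (λ k → tabulate (λ k′ → χ (block-vertex X (from EF k)) (block-vertex X (from EF k′)))) ,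
           tabulate (λ s → tabulate (λ a → χ (inj₂ (X , from Φ s)) (block-vertex X (Vec.lookup (from Φ s) a))))

  info-blocks : ∀ {X Y} → info X ≡ info Y → ∀ p p′ →
    χ (block-vertex X p) (block-vertex X p′) ≡ χ (block-vertex Y p) (block-vertex Y p′)
  info-blocks {X} {Y} eq p p′ = trans (sym (read X)) (trans
    (cong (λ T → Vec.lookup (Vec.lookup (proj₁ T) (to EF p)) (to EF p′)) eq) (read Y))
    where
    read : ∀ X → Vec.lookup (Vec.lookup (proj₁ (info X)) (to EF p)) (to EF p′) ≡ χ (block-vertex X p) (block-vertex X p′)
    read X = trans (cong (λ T → Vec.lookup T (to EF p′)) (Vecₚ.lookup∘tabulate _ (to EF p)))
      (trans (Vecₚ.lookup∘tabulate _ (to EF p′))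
             (cong₂ (λ a b → χ (block-vertex X a) (block-vertex X b)) (from-to EF p) (from-to EF p′)))

  info-stars : ∀ {X Y} → info X ≡ info Y → ∀ φ a →
    χ (inj₂ (X , φ)) (block-vertex X (Vec.lookup φ a)) ≡ χ (inj₂ (Y , φ)) (block-vertex Y (Vec.lookup φ a))
  info-stars {X} {Y} eq φ a = trans (sym (read X)) (trans
    (cong (λ T → Vec.lookup (Vec.lookup (proj₂ T) (to Φ φ)) a) eq) (read Y))
    where
    read : ∀ X → Vec.lookup (Vec.lookup (proj₂ (info X)) (to Φ φ)) a ≡ χ (inj₂ (X , φ)) (block-vertex X (Vec.lookup φ a))
    read X = trans (cong (λ T → Vec.lookup T a) (Vecₚ.lookup∘tabulate _ (to Φ φ)))
      (trans (Vecₚ.lookup∘tabulate _ a) (cong (λ φ → χ (inj₂ (X , φ)) (block-vertex X (Vec.lookup φ a))) (from-to Φ φ)))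

  module Blocks (es : Vec (E U) (suc N₁)) (es-mono : ∀ is js → info (points U es is) ≡ info (points U es js)) where

    slot : V₁ → Fin (suc N₁)
    slot p = suc (to EF p)

    pt : V₁ → Fin (suc w) → W
    pt p i = inj₁ (p , inc U (Vec.lookup es (slot p)) i)

    at-slot : ∀ is p → block-vertex (points U es is) p ≡ pt p (Vec.lookup is (slot p))
    at-slot is p = cong (λ x → inj₁ (p , x)) (Vecₚ.lookup-zipWith (inc U) (slot p) es is)

    -- dummy coordinate k, coordinate i in block p and j in all other blocks
    choose : Fin (suc w) → V₁ → Fin (suc w) → Fin (suc w) → Vec (Fin (suc w)) (suc N₁)
    choose k p i j = k ∷ tabulate (λ s → if ⌊ s ≟ to EF p ⌋ then i else j)

    choose-at : ∀ k p i j → Vec.lookup (choose k p i j) (slot p) ≡ i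
    choose-at k p i j = trans (Vecₚ.lookup∘tabulate _ (to EF p))
      (cong (λ b → if b then i else j) (true-⌊⌋ (to EF p ≟ to EF p) refl))

    choose-off : ∀ k {p p′} i j → p ≢ p′ → Vec.lookup (choose k p i j) (slot p′) ≡ j
    choose-off k {p} {p′} i j ne = trans (Vecₚ.lookup∘tabulate _ (to EF p′)) (off (to EF p′ ≟ to EF p))
      where
      off : (D : Dec (to EF p′ ≡ to EF p)) → (if ⌊ D ⌋ then i else j) ≡ j
      off (yes eq) = ⊥-elim (ne (sym (to-injective EF eq)))
      off (no _) = refl

    κ̂ : V₁ → V₁ → Fin q
    κ̂ p p′ = χ (pt p zero) (pt p′ zero)

    κ̂-sym : ∀ p p′ → κ̂ p p′ ≡ κ̂ p′ p
    κ̂-sym p p′ = χ-sym _ _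

    -- In different blocks the two vertices are separate coordinates of the product, so they can be
    -- prescribed independently.
    between-blocks : ∀ {p p′} → p ≢ p′ → ∀ i i′ → χ (pt p i) (pt p′ i′) ≡ κ̂ p p′
    between-blocks {p} {p′} ne i i′ = trans (sym (value i i′)) (trans
      (info-blocks (es-mono (choose zero p i i′) (choose zero p zero zero)) p p′) (value zero zero))
      where
      value : ∀ i i′ → χ (block-vertex (points U es (choose zero p i i′)) p) (block-vertex (points U es (choose zero p i i′)) p′) ≡
                       χ (pt p i) (pt p′ i′)
      value i i′ = cong₂ χ (trans (at-slot _ p) (cong (pt p) (choose-at zero p i i′)))
                           (trans (at-slot _ p′) (cong (pt p′) (choose-off zero i i′ ne)))

    pt-injective : ∀ {p p′ i i′} → pt p i ≡ pt p′ i′ → p ≡ p′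
    pt-injective eq = cong proj₁ (inj₁-injective eq)

    pt-injectiveʳ : ∀ {p i i′} → pt p i ≡ pt p i′ → i ≡ i′
    pt-injectiveʳ {p} eq = inc-injective U (Vec.lookup es (slot p)) (cong proj₂ (inj₁-injective eq))

    same-block : ∀ {p i i′} → i ≢ i′ → A (pt p i) (pt p i′)
    same-block {p} {i} {i′} ne = inj₁ (refl , (λ eq → ne (inc-injective U _ eq)) , Vec.lookup es (slot p) , (i , refl) , (i′ , refl))

    module Copy (no-cycle : NoCycle χ) (no-clique : NoClique χ)
      (ψ : Vertex L → V₁) (ψ-inj : Inj ψ) (ψ-edge : ∀ {β x y} → Edge L β x y → Edge F β (ψ x) (ψ y))
      (π : Fin (suc q₂) → Maybe (Fin q)) (π-mono : ∀ {β x y} → Edge L β x y → just (κ̂ (ψ x) (ψ y)) ≡ π β) where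

      Link : Fin q → W → W → Set
      Link k x y = A x y × χ x y ≡ k

      link-sym : ∀ {k x y} → Link k x y → Link k y x
      link-sym {k} {x} {y} (a , eq) = A-sym {x} {y} a , trans (χ-sym y x) eq

      no-ordered-clique : ∀ β (f : Fin (3 + t) → W) → ¬ (∀ {x y} → x <ᶠ y → Link (q₁ ↑ʳ β) (f x) (f y))
      no-ordered-clique β f h = no-clique β f
        (from-ordered {R = Link (q₁ ↑ʳ β)} (λ {x} {y} → link-sym {q₁ ↑ʳ β} {x} {y}) f h)

      cycle-edge : ∀ β i → Edge L β (on-cycle β i) (on-cycle β (next i))
      cycle-edge β i = refl , refl , C-adj-next 2≤ℓ i

      -- Read off the cycle of this type: every type has an edge there, so `π` has a proper colour
      -- for it.
      colour-of : Fin (suc q₂) → Fin q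
      colour-of β = κ̂ (ψ (on-cycle β zero)) (ψ (on-cycle β (next zero)))

      type-link : ∀ {β x y} → Edge L β x y → ∀ i i′ → Link (colour-of β) (pt (ψ x) i) (pt (ψ y) i′)
      type-link {β} {x} {y} e i i′ = inj₂ (β , ψ-edge e) ,
        trans (between-blocks distinct i i′) (just-injective (trans (π-mono e) (sym (π-mono (cycle-edge β zero)))))
        where
        distinct : ψ x ≢ ψ y
        distinct eq = edge-irrefl F (subst (Edge F β (ψ x)) (sym eq) (ψ-edge e))

      ρ-exists : ∀ β → ∃ λ θ → colour-of β ≡ q₁ ↑ʳ θ
      ρ-exists β = go (colour-view q₁ (suc q₂) (colour-of β))
        where
        go : ColourView q₁ (suc q₂) (colour-of β) → ∃ λ θ → colour-of β ≡ q₁ ↑ʳ θ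
        go (inj₂ p) = p
        go (inj₁ (j , eq)) = ⊥-elim (no-cycle j (λ i → pt (ψ (on-cycle β i)) zero)
          (λ {x} {y} eq′ → cong proj₂ (inj₂-injective (inj₁-injective (ψ-inj (pt-injective eq′)))))
          (λ i → let (a , k) = type-link (cycle-edge β i) zero zero in a , trans k eq))

      ρ : Fin (suc q₂) → Fin (suc q₂)
      ρ β = proj₁ (ρ-exists β)

      type-link-ρ : ∀ {β x y} → Edge L β x y → ∀ i i′ → Link (q₁ ↑ʳ ρ β) (pt (ψ x) i) (pt (ψ y) i′)
      type-link-ρ {β} e i i′ = let (a , k) = type-link e i i′ in a , trans k (proj₂ (ρ-exists β))

      ρ-injective : Inj ρ
      ρ-injective {θ} {θ′} eq with θ ≟ θ′
      ... | yes p = p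
      ... | no ne = ⊥-elim (no-clique (ρ θ) (λ k → pt (ψ (mixed θ θ′ k)) zero) link)
        where
        link : ∀ {k k′} → k ≢ k′ → Link (q₁ ↑ʳ ρ θ) (pt (ψ (mixed θ θ′ k)) zero) (pt (ψ (mixed θ θ′ k′)) zero)
        link k≢k′ with MixedCliques.mixed-edge (suc q₂) t ne k≢k′
        ... | (β , inj₁ refl , e) = type-link-ρ e zero zero
        ... | (β , inj₂ refl , e) = let (a , k) = type-link-ρ e zero zero in a , trans k (cong (q₁ ↑ʳ_) (sym eq))

      -- There are as many types as clique colours, so the injective `ρ` is a permutation: the
      -- pattern is found with its types renamed.
      ρ⁻¹ : Fin (suc q₂) → Fin (suc q₂)
      ρ⁻¹ θ = proj₁ (injective⇒surjective ρ ρ-injective θ)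

      ρ-ρ⁻¹ : ∀ θ → ρ (ρ⁻¹ θ) ≡ θ
      ρ-ρ⁻¹ θ = proj₂ (injective⇒surjective ρ ρ-injective θ)

      pendant-edge : ∀ a β i → Edge L β (ι a) (pendant a β i)
      pendant-edge a β i = refl , refl

      pendant-edges : ∀ a β {i j} → i ≢ j → Edge L β (pendant a β i) (pendant a β j)
      pendant-edges a β ne = refl , refl , refl , ne

      home : Fin d → V₁
      home a = ψ (ι a)

      -- An edge inside a block forms a clique with the pendant clique of any type.
      inside-block : ∀ a {i i′} → i ≢ i′ → ∃ λ j → χ (pt (home a) i) (pt (home a) i′) ≡ j ↑ˡ suc q₂
      inside-block a {i} {i′} ne = go (colour-view q₁ (suc q₂) (χ (pt (home a) i) (pt (home a) i′)))
        where
        go : ColourView q₁ (suc q₂) (χ (pt (home a) i) (pt (home a) i′)) →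
             ∃ λ j → χ (pt (home a) i) (pt (home a) i′) ≡ j ↑ˡ suc q₂
        go (inj₁ p) = p
        go (inj₂ (θ , eq)) = ⊥-elim (no-ordered-clique (ρ β) f ordered)
          where
          β = ρ⁻¹ θ
          f : Fin (3 + t) → W
          f zero = pt (home a) i
          f (suc zero) = pt (home a) i′
          f (suc (suc k)) = pt (ψ (pendant a β k)) zero
          ordered : ∀ {x y} → x <ᶠ y → Link (q₁ ↑ʳ ρ β) (f x) (f y)
          ordered {zero} {suc zero} _ = same-block ne , trans eq (cong (q₁ ↑ʳ_) (sym (ρ-ρ⁻¹ θ)))
          ordered {zero} {suc (suc k)} _ = type-link-ρ (pendant-edge a β k) i zero
          ordered {suc zero} {suc (suc k)} _ = type-link-ρ (pendant-edge a β k) i′ zero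
          ordered {suc (suc k)} {suc (suc k′)} (s≤s (s≤s lt)) =
            type-link-ρ (pendant-edges a β (λ eq′ → ℕₚ.<⇒≢ lt (cong toℕ eq′))) zero zero
          ordered {suc zero} {suc zero} (s≤s ())

      open CycleColourings q₁ q₂ m 2≤ℓ using (CycleFree; through-new-vertex)

      block-colouring : ∀ a → CycleFree (suc w) (λ i i′ → χ (pt (home a) i) (pt (home a) i′))
      block-colouring a = (λ _ _ → χ-sym _ _) , (λ _ _ → inside-block a) , λ j f (f-inj , h) →
        no-cycle j (λ i → pt (home a) (f i)) (λ {x} {y} eq → f-inj (pt-injectiveʳ {home a} {f x} {f y} eq))
          (λ i → same-block (λ eq → next≢ 2≤ℓ i (sym (f-inj eq))) , h i)

      φ : Vec V₁ d
      φ = tabulate home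

      star : Vec (Fin (suc w)) (suc N₁) → W
      star is = inj₂ (points U es is , φ)

      base : Vec (Fin (suc w)) (suc N₁)
      base = replicate (suc N₁) zero

      star-colour : Fin d → Fin q
      star-colour a = χ (star base) (block-vertex (points U es base) (Vec.lookup φ a))

      star-link : ∀ is a {i} → Vec.lookup is (slot (home a)) ≡ i → Link (star-colour a) (star is) (pt (home a) i)
      star-link is a {i} eq = (a , Vecₚ.lookup∘tabulate home a , cong proj₂ (inj₁-injective same)) ,
        trans (cong (χ (star is)) (trans (sym same) (cong (block-vertex (points U es is)) (sym (Vecₚ.lookup∘tabulate home a)))))
              (info-stars (es-mono is base) φ a)
        where
        same : block-vertex (points U es is) (home a) ≡ pt (home a) i
        same = trans (at-slot is (home a)) (cong (pt (home a)) eq)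

      -- Two edges of one cycle colour at every star, into the blocks a and b: in a monochromatic cycle through a
      -- new vertex i₀ of block a, replace i₀ by a vertex of block b and both its neighbours by stars.
      module Close {a b : Fin d} (a≢b : a ≢ b) {j : Fin q₁}
        (ca : star-colour a ≡ j ↑ˡ suc q₂) (cb : star-colour b ≡ j ↑ˡ suc q₂)
        (g : Fin ℓ → Fin (2 + w)) (g-inj : Inj g) (i₀ : Fin ℓ) (g-i₀ : g i₀ ≡ zero)
        (g-mono : ∀ i u v → g i ≡ suc u → g (next i) ≡ suc v → χ (pt (home a) u) (pt (home a) v) ≡ j ↑ˡ suc q₂) where

        private
          p pb : V₁
          p = home a
          pb = home b
          k = j ↑ˡ suc q₂

        p≢pb : p ≢ pb
        p≢pb eq = a≢b (inj₁-injective (inj₁-injective (inj₁-injective (ψ-inj eq))))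

        lower : Fin ℓ → Fin (suc w)
        lower i = drop (g i)
          module lower where
          drop : Fin (2 + w) → Fin (suc w)
          drop zero = zero
          drop (suc u) = u

        lower-correct : ∀ {i} → i ≢ i₀ → g i ≡ suc (lower i)
        lower-correct {i} ne = go (g i) refl
          where
          go : ∀ x → g i ≡ x → x ≡ suc (lower.drop i x)
          go zero eq = ⊥-elim (ne (g-inj (trans eq (sym g-i₀))))
          go (suc u) eq = refl

        lower-injective : ∀ {x y} → x ≢ i₀ → y ≢ i₀ → lower x ≡ lower y → x ≡ y
        lower-injective nx ny eq = g-inj (trans (lower-correct nx) (trans (cong suc eq) (sym (lower-correct ny))))

        after before : Fin ℓ
        after = next i₀
        before = prev i₀

        after≢ : after ≢ i₀
        after≢ = next≢ 2≤ℓ i₀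

        next-before : next before ≡ i₀
        next-before = next-prev i₀

        before≢ : before ≢ i₀
        before≢ eq = next≢ 2≤ℓ i₀ (trans (cong next (sym eq)) next-before)

        after≢before : after ≢ before
        after≢before eq = next²≢ 3≤ℓ i₀ (trans (cong next eq) next-before)

        choice : Fin ℓ → Fin ℓ → Vec (Fin (suc w)) (suc N₁)
        -- If `ℓ` is 4, `next after` and `prev before` coincide, and both stars pick the same vertex
        -- in every block; the dummy coordinate alone keeps them apart.
        choice dummy i = choose (lower dummy) p (lower i) zero

        star⁺ star⁻ vb : W
        star⁺ = star (choice after (next after))
        star⁻ = star (choice before (prev before))
        vb = pt pb zero

        stars-distinct : star⁺ ≢ star⁻
        stars-distinct eq = after≢before (lower-injective after≢ before≢ (inc-injective U (Vec.lookup es zero)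
          (trans (sym (Vecₚ.lookup-zipWith (inc U) zero es (choice after (next after))))
            (trans (cong (λ s → Vec.lookup (proj₁ s) zero) (inj₂-injective eq))
                   (Vecₚ.lookup-zipWith (inc U) zero es (choice before (prev before)))))))

        to-a : ∀ dummy i → Link k (star (choice dummy i)) (pt p (lower i))
        to-a dummy i = let (l , eq) = star-link (choice dummy i) a (choose-at (lower dummy) p (lower i) zero) in l , trans eq ca

        to-b : ∀ dummy i → Link k (star (choice dummy i)) vb
        to-b dummy i = let (l , eq) = star-link (choice dummy i) b (choose-off (lower dummy) (lower i) zero p≢pb) in l , trans eq cb

        data Kind (i : Fin ℓ) (x : W) : Set where
          is-b : i ≡ i₀ → x ≡ vb → Kind i x
          is-after : i ≡ after → x ≡ star⁺ → Kind i x
          is-before : next i ≡ i₀ → x ≡ star⁻ → Kind i x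
          is-plain : i ≢ i₀ → i ≢ after → next i ≢ i₀ → x ≡ pt p (lower i) → Kind i x

        vertex-at : ∀ i → ∃ (Kind i)
        vertex-at i with i ≟ i₀ | i ≟ after | next i ≟ i₀
        ... | yes eq | _ | _ = vb , is-b eq refl
        ... | no _ | yes eq | _ = star⁺ , is-after eq refl
        ... | no _ | no _ | yes eq = star⁻ , is-before eq refl
        ... | no n₁ | no n₂ | no n₃ = pt p (lower i) , is-plain n₁ n₂ n₃ refl

        f : Fin ℓ → W
        f i = proj₁ (vertex-at i)

        kinds-injective : ∀ {i i′ x x′} → Kind i x → Kind i′ x′ → x ≡ x′ → i ≡ i′
        kinds-injective (is-b q _) (is-b q′ _) eq = trans q (sym q′)
        kinds-injective (is-after q _) (is-after q′ _) eq = trans q (sym q′)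
        kinds-injective (is-before q _) (is-before q′ _) eq = next-injective (trans q (sym q′))
        kinds-injective (is-plain n₁ _ _ e) (is-plain n₁′ _ _ e′) eq =
          lower-injective n₁ n₁′ (pt-injectiveʳ {p} (trans (sym e) (trans eq e′)))
        kinds-injective (is-b _ refl) (is-after _ refl) ()
        kinds-injective (is-b _ refl) (is-before _ refl) ()
        kinds-injective (is-b _ refl) (is-plain _ _ _ refl) eq = ⊥-elim (p≢pb (sym (pt-injective eq)))
        kinds-injective (is-after _ refl) (is-b _ refl) ()
        kinds-injective (is-after _ refl) (is-before _ refl) eq = ⊥-elim (stars-distinct eq)
        kinds-injective (is-after _ refl) (is-plain _ _ _ refl) ()
        kinds-injective (is-before _ refl) (is-b _ refl) ()
        kinds-injective (is-before _ refl) (is-after _ refl) eq = ⊥-elim (stars-distinct (sym eq))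
        kinds-injective (is-before _ refl) (is-plain _ _ _ refl) ()
        kinds-injective (is-plain _ _ _ refl) (is-b _ refl) eq = ⊥-elim (p≢pb (pt-injective eq))
        kinds-injective (is-plain _ _ _ refl) (is-after _ refl) ()
        kinds-injective (is-plain _ _ _ refl) (is-before _ refl) ()

        kinds-linked : ∀ {i x y} → Kind i x → Kind (next i) y → Link k x y
        kinds-linked (is-b refl refl) (is-after _ refl) = link-sym {k} {star⁺} {vb} (to-b after (next after))
        kinds-linked (is-b refl _) (is-b q _) = ⊥-elim (after≢ q)
        kinds-linked (is-b refl _) (is-before q _) = ⊥-elim (next²≢ 3≤ℓ i₀ q)
        kinds-linked (is-b refl _) (is-plain _ n₂ _ _) = ⊥-elim (n₂ refl)
        kinds-linked (is-after refl refl) (is-plain _ _ _ refl) = to-a after (next after)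
        kinds-linked (is-after refl _) (is-b q _) = ⊥-elim (next²≢ 3≤ℓ i₀ q)
        kinds-linked (is-after refl _) (is-after q _) = ⊥-elim (next≢ 2≤ℓ after q)
        -- For `ℓ` equal to 3 the two stars would be consecutive on the cycle, but stars are never
        -- adjacent.
        kinds-linked (is-after refl _) (is-before q _) = ⊥-elim (next³≢ 4≤ℓ i₀ q)
        kinds-linked (is-before _ refl) (is-b _ refl) = to-b before (prev before)
        kinds-linked (is-before q _) (is-after q′ _) = ⊥-elim (after≢ (trans (sym q′) q))
        kinds-linked (is-before q _) (is-before q′ _) = ⊥-elim (after≢ (trans (cong next (sym q)) q′))
        kinds-linked (is-before q _) (is-plain n₁ _ _ _) = ⊥-elim (n₁ q)
        kinds-linked {i} (is-plain n₁ n₂ n₃ refl) (is-before q refl) =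
          subst (λ z → Link k (pt p (lower z)) star⁻) i≡ (link-sym {k} {star⁻} {pt p (lower (prev before))} (to-a before (prev before)))
          where
          i≡ : prev before ≡ i
          i≡ = trans (cong (prev ∘ prev) (sym q)) (trans (cong prev (prev-next (next i))) (prev-next i))
        kinds-linked (is-plain n₁ n₂ n₃ _) (is-b q _) = ⊥-elim (n₃ q)
        kinds-linked (is-plain n₁ n₂ n₃ _) (is-after q _) = ⊥-elim (n₁ (next-injective q))
        kinds-linked {i} (is-plain n₁ n₂ n₃ refl) (is-plain n₁′ _ _ refl) =
          same-block (λ eq → next≢ 2≤ℓ i (sym (lower-injective n₁ n₁′ eq))) ,
          g-mono i (lower i) (lower (next i)) (lower-correct n₁) (lower-correct n₁′)

        impossible : ⊥
        impossible = no-cycle j f (λ {x} {y} eq → kinds-injective (proj₂ (vertex-at x)) (proj₂ (vertex-at y)) eq)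
          (λ i → kinds-linked (proj₂ (vertex-at i)) (proj₂ (vertex-at (next i))))

      -- The star colours, read through the identification ρ of types with clique colours.
      translate : ∀ k → ColourView q₁ (suc q₂) k → Fin q
      translate k (inj₁ (j , _)) = j ↑ˡ suc q₂
      translate k (inj₂ (θ , _)) = q₁ ↑ʳ ρ⁻¹ θ

      translate-cycle : ∀ {k j} D → translate k D ≡ j ↑ˡ suc q₂ → k ≡ j ↑ˡ suc q₂
      translate-cycle (inj₁ (_ , p)) eq = trans p eq
      translate-cycle (inj₂ _) eq = ⊥-elim (cycle≢clique-colour (sym eq))

      translate-clique : ∀ {k β} D → translate k D ≡ q₁ ↑ʳ β → k ≡ q₁ ↑ʳ ρ β
      translate-clique (inj₁ _) eq = ⊥-elim (cycle≢clique-colour eq)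
      translate-clique (inj₂ (θ , p)) eq = trans p (cong (q₁ ↑ʳ_)
        (trans (sym (ρ-ρ⁻¹ θ)) (cong ρ (Finₚ.↑ʳ-injective q₁ _ _ eq))))

      star-view : ∀ a → ColourView q₁ (suc q₂) (star-colour a)
      star-view a = colour-view q₁ (suc q₂) (star-colour a)

      impossible : ⊥
      impossible = go (conflict (λ a → translate (star-colour a) (star-view a)))
        where
        go : Conflict q₁ (suc q₂) (2 + t) d τ (λ a → translate (star-colour a) (star-view a)) → ⊥
        go (inj₁ (j , a , b , a≢b , ea , eb)) =
          let (g , g-inj , (i₀ , g-i₀) , g-mono) = through-new-vertex extremal _ (block-colouring a) j in
          Close.impossible a≢b (translate-cycle (star-view a) ea) (translate-cycle (star-view b) eb) g g-inj i₀ g-i₀ g-mono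
        go (inj₂ (β , h , cl , eh)) = no-ordered-clique (ρ β) f ordered
          where
          f : Fin (3 + t) → W
          f zero = star base
          f (suc i) = pt (home (h i)) (Vec.lookup base (slot (home (h i))))
          ordered : ∀ {x y} → x <ᶠ y → Link (q₁ ↑ʳ ρ β) (f x) (f y)
          ordered {zero} {suc i} _ = let (l , eq) = star-link base (h i) refl in l , trans eq (translate-clique (star-view (h i)) (eh i))
          ordered {suc i} {suc i′} (s≤s lt) = type-link-ρ (cl i i′ (λ eq → ℕₚ.<⇒≢ lt (cong toℕ eq))) _ _

  stars-force : ProductUnavoidable U (suc N₁) Info →
    (∀ (κ : Vertex F → Vertex F → Fin q) → (∀ x y → κ x y ≡ κ y x) → TypeHomogeneousCopy L F κ) →
    NoCycle χ → NoClique χ → ⊥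
  stars-force U-product F-ramsey no-cycle no-clique = after-product (U-product info)
    where
    after-copy : ∀ es es-mono → TypeHomogeneousCopy L F (Blocks.κ̂ es es-mono) → ⊥
    after-copy es es-mono (ψ , ψ-inj , ψ-edge , π , π-mono) =
      Blocks.Copy.impossible es es-mono no-cycle no-clique ψ ψ-inj
        (λ {β} {x} {y} → ψ-edge {β} {x} {y}) π (λ {β} {x} {y} → π-mono {β} {x} {y})
    after-product : (Σ[ es ∈ Vec (E U) (suc N₁) ] (∀ is js → info (points U es is) ≡ info (points U es js))) → ⊥
    after-product (es , es-mono) =
      after-copy es es-mono (F-ramsey (Blocks.κ̂ es es-mono) (Blocks.κ̂-sym es es-mono))

-- Realisation of patterns and the theorem

module Realisation (q₁ q₂ m t d : ℕ) (4≤ℓ : 4 ≤ suc m) (τ : Fin d → Fin d → Maybe (Fin (suc q₂)))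
  (τ-sym : ∀ a b → τ a b ≡ τ b a)
  (τ-free : ∀ β (f : Fin (3 + t) → Fin d) → ¬ (∀ i j → i ≢ j → τ (f i) (f j) ≡ just β))
  (conflict : ∀ c → Conflict q₁ (suc q₂) (2 + t) d τ c)
  (F : Typed (suc q₂) (3 + t))
  (F-ramsey : ∀ (χ : Vertex F → Vertex F → Fin (q₁ + suc q₂)) → (∀ x y → χ x y ≡ χ y x) →
    TypeHomogeneousCopy (PatternGraph.pattern-graph (suc q₂) t d m 4≤ℓ τ τ-sym τ-free) F χ)
  {w : ℕ} (κ : Fin (suc w) → Fin (suc w) → Fin (q₁ + suc q₂))
  (κ-ok : CycleColourings.CycleFree q₁ q₂ m (ℕₚ.≤-trans (s≤s (s≤s z≤n)) 4≤ℓ) (suc w) κ)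
  (extremal : ¬ ∃ (CycleColourings.CycleFree q₁ q₂ m (ℕₚ.≤-trans (s≤s (s≤s z≤n)) 4≤ℓ) (suc (suc w))))
  (U : Hypergraph (suc w)) (U-girth : Girth> U (suc m))
  (U-product : ProductUnavoidable U (suc (size (vertex-enum F)))
    (Vec (Vec (Fin (q₁ + suc q₂)) (size (vertex-enum F))) (size (vertex-enum F)) ×
     Vec (Vec (Fin (q₁ + suc q₂)) d) (size (Vec-enum (vertex-enum F) d)))) where
  open Construction q₁ q₂ m t d 4≤ℓ F U
  private
    Hs = 𝒯 q₁ (suc q₂) ℓ (3 + t)

  graph-ramsey : IsRamsey q Hs graph
  graph-ramsey c = decide (Finₚ.any? (λ k → mono? (Hs k) graph c k))
    where
    tow : W → Fin (size W-enum)
    tow = to W-enum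
    χ : W → W → Fin q
    χ x y = col c (tow x) (tow y)
    χ-sym : ∀ x y → χ x y ≡ χ y x
    χ-sym x y = col-sym c (tow x) (tow y)
    decide : Dec (∃ λ k → MonoCopy (Hs k) graph c k) → ∃ λ k → MonoCopy (Hs k) graph c k
    decide (yes p) = p
    decide (no none) = ⊥-elim (StarsForce.stars-force q₁ q₂ m t d 4≤ℓ τ τ-sym τ-free conflict F U extremal χ χ-sym
      U-product F-ramsey no-cycle no-clique)
      where
      no-cycle : NoCycle χ
      no-cycle j f f-inj h = none (j ↑ˡ suc q₂ , subst (λ H → MonoCopy H graph c (j ↑ˡ suc q₂)) (sym (𝒯-cycle q₁ (suc q₂) ℓ _ j))
        (cycle-copy graph c (j ↑ˡ suc q₂) (tow ∘ f) (λ eq → f-inj (to-injective W-enum eq))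
          (λ i → A⇒adj (proj₁ (h i)) , proj₂ (h i))))
      no-clique : NoClique χ
      no-clique β f h = none (q₁ ↑ʳ β , subst (λ H → MonoCopy H graph c (q₁ ↑ʳ β)) (sym (𝒯-clique q₁ (suc q₂) ℓ _ β))
        (clique-copy graph c (q₁ ↑ʳ β) (tow ∘ f) (λ ne → A⇒adj (proj₁ (h ne)) , proj₂ (h ne))))

  star? : ∀ (z : W) → Dec (∃ λ (s : Star) → z ≡ inj₂ s)
  star? (inj₁ _) = no λ { (_ , ()) }
  star? (inj₂ s) = yes (s , refl)

  small-degree : ∀ G (sub : Subgraph G graph) → IsRamsey q Hs G →
    Dec (∃ λ x → ∃ λ s → vertex (proj₁ sub x) ≡ inj₂ s) → ∃ λ x → deg G x ≤ d
  small-degree G sub R (yes (x , s , eq)) = x , star-degree G sub x eq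
  small-degree G sub R (no none) = ⊥-elim (WithoutStars.not-ramsey ℕₚ.≤-refl U-girth κ κ-ok G sub
    (λ x {s} eq → none (x , s , eq)) R)

  minimal-with-small-degree : Σ[ G ∈ Graph ] IsRamseyMinimal q Hs G × ∃ λ x → deg G x ≤ d
  minimal-with-small-degree = conclude (MinimalSubgraph.minimal-subgraph Hs (size W-enum) graph ℕₚ.≤-refl graph-ramsey)
    where
    conclude : Σ[ G ∈ Graph ] Subgraph G graph × IsRamseyMinimal q Hs G →
      Σ[ G ∈ Graph ] IsRamseyMinimal q Hs G × ∃ λ x → deg G x ≤ d
    conclude (G , sub , minimal) = G , minimal ,
      small-degree G sub (proj₁ minimal) (Finₚ.any? (λ x → star? (vertex (proj₁ sub x))))

realise : ∀ q₁ q₂ m t d → 4 ≤ suc m → Pattern q₁ (suc q₂) (2 + t) d →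
  Σ[ G ∈ Graph ] IsRamseyMinimal (q₁ + suc q₂) (𝒯 q₁ (suc q₂) (suc m) (suc (suc (suc t)))) G × ∃ λ x → deg G x ≤ d
realise q₁ q₂ m t d 4≤ℓ (τ , τ-sym , τ-free , conflict) =
  let (F , F-ramsey) = typed-ramsey (PatternGraph.pattern-graph (suc q₂) t d m 4≤ℓ τ τ-sym τ-free) q
      (w , (κ , κ-ok) , extremal) = CycleColourings.extremal q₁ q₂ m (ℕₚ.≤-trans (s≤s (s≤s z≤n)) 4≤ℓ)
      N₁ = size (vertex-enum F)
      (U , U-girth , U-product) = sparse-product m w
        (Vec-enum (Vec-enum (Fin-enum q) N₁) N₁ ×-enum Vec-enum (Vec-enum (Fin-enum q) d) (size (Vec-enum (vertex-enum F) d))) (suc N₁)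
  in Realisation.minimal-with-small-degree q₁ q₂ m t d 4≤ℓ τ τ-sym τ-free conflict F F-ramsey κ κ-ok extremal U U-girth U-product
  where
  q = q₁ + suc q₂

K-copy : ∀ {R q M} (c : Colouring (K R) q) (η : Fin M → Fin R) → Increasing η → ∀ k →
  (∀ {x y} → x <ᶠ y → col c (η x) (η y) ≡ k) → ∀ H (e : Fin (n H) → Fin M) → Inj e → MonoCopy H (K R) c k
K-copy {R} c η η-inc k h H e e-inj = η ∘ e , (λ eq → e-inj (η-inj eq)) , λ x y a →
  let x≢y = adj⇒≢ H a in
  K-adj (λ eq → x≢y (e-inj (η-inj eq))) ,
  from-ordered {R = λ u v → col c u v ≡ k} (λ {u} {v} eq → trans (col-sym c v u) eq) η h (λ eq → x≢y (e-inj eq))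
  where
  η-inj = increasing⇒injective η η-inc

module _ (q₁ q₂ m t : ℕ) where
  private
    q = q₁ + suc q₂
    ℓ = suc m
    T′ : ℕ
    T′ = 3 + t
    Hs = 𝒯 q₁ (suc q₂) ℓ T′

  complete-ramsey : ∃ λ R → IsRamsey q Hs (K R)
  complete-ramsey = let (R , ramsey) = ramsey-pairs (Fin-enum q) (ℓ + T′) in R , λ c → go R c (ramsey (col c))
    where
    go : ∀ R (c : Colouring (K R) q) → Σ[ η ∈ (Fin (ℓ + T′) → Fin R) ] Increasing η × Σ[ k ∈ Fin q ]
      (∀ {x y} → x <ᶠ y → col c (η x) (η y) ≡ k) → ∃ λ k → MonoCopy (Hs k) (K R) c k
    go R c (η , η-inc , k , h) = k , by-colour k (colour-view q₁ (suc q₂) k) h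
      where
      by-colour : ∀ k → ColourView q₁ (suc q₂) k →
        (∀ {x y} → x <ᶠ y → col c (η x) (η y) ≡ k) → MonoCopy (Hs k) (K R) c k
      by-colour _ (inj₁ (j , refl)) h = subst (λ H → MonoCopy H (K R) c (j ↑ˡ suc q₂)) (sym (𝒯-cycle q₁ (suc q₂) ℓ T′ j))
        (K-copy c η η-inc _ h (C ℓ) (_↑ˡ T′) (Finₚ.↑ˡ-injective T′ _ _))
      by-colour _ (inj₂ (β , refl)) h = subst (λ H → MonoCopy H (K R) c (q₁ ↑ʳ β)) (sym (𝒯-clique q₁ (suc q₂) ℓ T′ β))
        (K-copy c η η-inc _ h (K T′) (ℓ ↑ʳ_) (Finₚ.↑ʳ-injective ℓ _ _))

  ramsey-vertex : ∀ G → IsRamsey q Hs G → Fin (n G)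
  ramsey-vertex G R with R (record { col = λ _ _ → q₁ ↑ʳ zero ; col-sym = λ _ _ → refl })
  ... | (k , f , _) with colour-view q₁ (suc q₂) k
  ...   | inj₁ (j , refl) = f (subst Fin (cong n (sym (𝒯-cycle q₁ (suc q₂) ℓ T′ j))) zero)
  ...   | inj₂ (β , refl) = f (subst Fin (cong n (sym (𝒯-clique q₁ (suc q₂) ℓ T′ β))) zero)

  module _ (4≤ℓ : 4 ≤ ℓ) where
    private
      P : ℕ → Set
      P = Pattern q₁ (suc q₂) (2 + t)

    min-degree-pattern : ∀ G → IsRamseyMinimal q Hs G → ∀ {d} → MinDeg G d → P d
    min-degree-pattern G minimal ((v , eq) , _) = subst P eq
      (pattern-of-minimal q₁ q₂ m (suc (suc t)) (ℕₚ.≤-trans (ℕₚ.n≤1+n 3) 4≤ℓ) G minimal v)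

    -- Patterns need not be built by hand: a large complete graph is Ramsey, and the minimum degree
    -- of a minimal Ramsey subgraph of it is the order of a pattern.
    some-pattern : ∃ P
    some-pattern = from-complete complete-ramsey
      where
      from-minimal : Σ[ G ∈ Graph ] IsRamseyMinimal q Hs G → ∃ P
      from-minimal (G , minimal) = let (d , D) = min-degree G (ramsey-vertex G (proj₁ minimal)) in
        d , min-degree-pattern G minimal D
      from-complete : (∃ λ R → IsRamsey q Hs (K R)) → ∃ P
      from-complete (R , ramsey) = let (G , _ , minimal) = MinimalSubgraph.minimal-subgraph Hs R (K R) ℕₚ.≤-refl ramsey in
        from-minimal (G , minimal)

    -- The realisation only bounds one degree from above. The minimum degree is exactly `k` because
    -- it is itself the order of a pattern.
    least-pattern⇒IsS : ∀ {k} → P k → (∀ d → P d → k ≤ d) → IsS q Hs k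
    least-pattern⇒IsS {k} pk k-least = attained (realise q₁ q₂ m t k 4≤ℓ pk) ,
      λ G d minimal D → k-least d (min-degree-pattern G minimal D)
      where
      attained : Σ[ G ∈ Graph ] IsRamseyMinimal q Hs G × (∃ λ x → deg G x ≤ k) →
        ∃ λ G → IsRamseyMinimal q Hs G × MinDeg G k
      attained (G , minimal , x , x≤k) = G , minimal , at-k (min-degree G x)
        where
        at-k : (∃ λ d → MinDeg G d) → MinDeg G k
        at-k (d , D) = subst (MinDeg G) (ℕₚ.≤-antisym (ℕₚ.≤-trans (proj₂ D x) x≤k) (k-least d (min-degree-pattern G minimal D))) D

    smallest : ∃ λ k → IsS q Hs k × P k × (∀ d → P d → k ≤ d)
    smallest = let (k , pk , k-least) = least (pattern? q₁ (suc q₂) (2 + t)) (proj₁ some-pattern) (proj₂ some-pattern) in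
      k , least-pattern⇒IsS pk k-least , pk , k-least

-- Give the first q₁ vertices distinct cycle colours.
drop-vertices : ∀ q₁ q₂ s {b} → Pattern q₁ q₂ (suc s) b → ∃ λ d → b ≡ q₁ + d × Pattern 0 q₂ (suc s) d
drop-vertices q₁ q₂ s {b} (τ , τ-sym , τ-free , conflict) with q₁ ≤? b
-- With fewer than `q₁` vertices all of them could be given distinct cycle colours, which leaves no
-- conflict.
... | no gt = ⊥-elim (clash (conflict (λ a → Data.Fin.inject≤ a b≤q₁ ↑ˡ q₂)))
  where
  b≤q₁ = ℕₚ.<⇒≤ (ℕₚ.≰⇒> gt)
  clash : ¬ Conflict q₁ q₂ (suc s) b τ (λ a → Data.Fin.inject≤ a b≤q₁ ↑ˡ q₂)
  clash (inj₁ (j , x , y , ne , p , p′)) =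
    ne (Finₚ.inject≤-injective b≤q₁ b≤q₁ x y (Finₚ.↑ˡ-injective q₂ _ _ (trans p (sym p′))))
  clash (inj₂ (β , f , _ , h)) = cycle≢clique-colour (h zero)
... | yes le with ℕₚ.m≤n⇒∃[o]m+o≡n le
...   | (d , refl) = d , refl , (λ x y → τ (q₁ ↑ʳ x) (q₁ ↑ʳ y)) , (λ _ _ → τ-sym _ _) ,
        (λ β f h → τ-free β (λ i → q₁ ↑ʳ f i) h) , λ c → restricted c (conflict (extend c))
  where
  extend : (Fin d → Fin q₂) → Fin (q₁ + d) → Fin (q₁ + q₂)
  extend c x = [ (λ i → i ↑ˡ q₂) , (λ y → q₁ ↑ʳ c y) ]′ (splitAt q₁ x)
  extend-↑ˡ : ∀ c i → extend c (i ↑ˡ d) ≡ i ↑ˡ q₂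
  extend-↑ˡ c i = cong [ (λ i → i ↑ˡ q₂) , (λ y → q₁ ↑ʳ c y) ]′ (Finₚ.splitAt-↑ˡ q₁ i d)
  extend-↑ʳ : ∀ c y → extend c (q₁ ↑ʳ y) ≡ q₁ ↑ʳ c y
  extend-↑ʳ c y = cong [ (λ i → i ↑ˡ q₂) , (λ y → q₁ ↑ʳ c y) ]′ (Finₚ.splitAt-↑ʳ q₁ d y)
  cycle-coloured : ∀ c x {j} → extend c x ≡ j ↑ˡ q₂ → x ≡ j ↑ˡ d
  cycle-coloured c x eq with colour-view q₁ d x
  ... | inj₁ (i , refl) = cong (_↑ˡ d) (Finₚ.↑ˡ-injective q₂ _ _ (trans (sym (extend-↑ˡ c i)) eq))
  ... | inj₂ (y , refl) = ⊥-elim (cycle≢clique-colour (trans (sym eq) (extend-↑ʳ c y)))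
  clique-coloured : ∀ c x {β} → extend c x ≡ q₁ ↑ʳ β → ∃ λ y → x ≡ q₁ ↑ʳ y × c y ≡ β
  clique-coloured c x eq with colour-view q₁ d x
  ... | inj₁ (i , refl) = ⊥-elim (cycle≢clique-colour (trans (sym (extend-↑ˡ c i)) eq))
  ... | inj₂ (y , refl) = y , refl , Finₚ.↑ʳ-injective q₁ _ _ (trans (sym (extend-↑ʳ c y)) eq)
  restricted : ∀ c → Conflict q₁ q₂ (suc s) (q₁ + d) τ (extend c) →
    Conflict 0 q₂ (suc s) d (λ x y → τ (q₁ ↑ʳ x) (q₁ ↑ʳ y)) c
  restricted c (inj₁ (j , x , y , ne , p , p′)) =
    ⊥-elim (ne (trans (cycle-coloured c x p) (sym (cycle-coloured c y p′))))
  restricted c (inj₂ (β , f , cl , h)) = inj₂ (β , (λ i → proj₁ (back i)) ,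
    (λ i j ne → trans (cong₂ τ (sym (proj₁ (proj₂ (back i)))) (sym (proj₁ (proj₂ (back j))))) (cl i j ne)) ,
    λ i → proj₂ (proj₂ (back i)))
    where
    back : ∀ i → ∃ λ y → f i ≡ q₁ ↑ʳ y × c y ≡ β
    back i = clique-coloured c (f i) (h i)

-- A clique of a forgotten type has two vertices of the same cycle colour.
forget-types : ∀ q₁ q₂ s {d} → Pattern 0 (q₁ + q₂) (suc (suc s)) d → Pattern q₁ q₂ (suc (suc s)) d
forget-types q₁ q₂ s {d} (τ , τ-sym , τ-free , conflict) =
  τ′ , (λ a b → cong keep (τ-sym a b)) ,
  (λ β f h → τ-free (q₁ ↑ʳ β) f (λ i j ne → kept (τ (f i) (f j)) (h i j ne))) ,
  λ c → translate c (conflict c)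
  where
  keep : Maybe (Fin (q₁ + q₂)) → Maybe (Fin q₂)
  keep nothing = nothing
  keep (just k) = clique-type q₁ k
  τ′ : Fin d → Fin d → Maybe (Fin q₂)
  τ′ a b = keep (τ a b)
  kept : ∀ x {β} → keep x ≡ just β → x ≡ just (q₁ ↑ʳ β)
  kept (just k) eq = cong just (clique-type⁻¹ q₁ k eq)
  irreflexive : ∀ {a k} → τ a a ≢ just k
  irreflexive {a} {k} eq = τ-free k (λ _ → a) (λ _ _ _ → eq)
  translate : ∀ c → Conflict 0 (q₁ + q₂) (suc (suc s)) d τ c → Conflict q₁ q₂ (suc (suc s)) d τ′ c
  translate c (inj₂ (k , f , cl , h)) with colour-view q₁ q₂ k
  ... | inj₁ (j , refl) = inj₁ (j , f zero , f (suc zero) , distinct , h zero , h (suc zero))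
    where
    distinct : f zero ≢ f (suc zero)
    distinct eq = irreflexive (subst (λ x → τ (f zero) x ≡ just (j ↑ˡ q₂)) (sym eq) (cl zero (suc zero) (λ ())))
  ... | inj₂ (β , refl) = inj₂ (β , f , (λ i j ne → trans (cong keep (cl i j ne)) (clique-type-↑ʳ q₁ β)) , h)

theorem1p3 : ∀ (ℓ t q₁ q₂ : ℕ) → 4 ≤ ℓ → 3 ≤ t → 1 ≤ q₁ → 1 ≤ q₂ →
    ∃ λ a → ∃ λ b → ∃ λ c →
    IsS q₂ (rep q₂ (K t)) a × IsS (q₁ + q₂) (𝒯 q₁ q₂ ℓ t) b × IsS (q₁ + q₂) (rep (q₁ + q₂) (K t)) c ×
    (a + q₁ ≤ b) × (b ≤ c)
theorem1p3 (suc m) (suc (suc (suc t))) (suc q₁) (suc q₂) 4≤ℓ (s≤s (s≤s (s≤s _))) (s≤s _) (s≤s _) =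
  -- Without cycle colours `𝒯` computes to the constant tuple of cliques, so one result provides all
  -- three numbers.
  combine (smallest 0 q₂ m t 4≤ℓ) (smallest (suc q₁) q₂ m t 4≤ℓ) (smallest 0 (q₁ + suc q₂) m t 4≤ℓ)
  where
  T′ : ℕ
  T′ = 3 + t
  s = suc (suc t)
  Q = suc q₁ + suc q₂
  Smallest : ∀ q → (Fin q → Graph) → (ℕ → Set) → Set
  Smallest q Hs P = ∃ λ k → IsS q Hs k × P k × (∀ d → P d → k ≤ d)
  combine : Smallest (suc q₂) (rep (suc q₂) (K T′)) (Pattern 0 (suc q₂) s) →
    Smallest Q (𝒯 (suc q₁) (suc q₂) (suc m) T′) (Pattern (suc q₁) (suc q₂) s) →
    Smallest Q (rep Q (K T′)) (Pattern 0 Q s) →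
    ∃ λ a → ∃ λ b → ∃ λ c → IsS (suc q₂) (rep (suc q₂) (K T′)) a × IsS Q (𝒯 (suc q₁) (suc q₂) (suc m) T′) b ×
      IsS Q (rep Q (K T′)) c × (a + suc q₁ ≤ b) × (b ≤ c)
  combine (a , Sa , _ , a-least) (b , Sb , pb , b-least) (c , Sc , pc , _) =
    a , b , c , Sa , Sb , Sc , lower (drop-vertices (suc q₁) (suc q₂) (suc t) pb) , b-least c (forget-types (suc q₁) (suc q₂) t pc)
    where
    lower : (∃ λ d → b ≡ suc q₁ + d × Pattern 0 (suc q₂) s d) → a + suc q₁ ≤ b
    lower (d , eq , pd) = ℕₚ.≤-trans (ℕₚ.+-monoˡ-≤ (suc q₁) (a-least d pd))
      (ℕₚ.≤-reflexive (trans (ℕₚ.+-comm d (suc q₁)) (sym eq)))
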